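{- Let $p$ be a prime, let $l,d\ge1$ be integers, and let $f\colon\mathbb{Z}_p\to\mathbb{Q}_p$ be an analytic function that is not identically zero. Let $\mathcal{R}_f$ be the set of roots of $f$ in $\mathbb{Z}_p$; for $\theta\in\mathcal{R}_f$ let $m_f(\theta)$ be its multiplicity and let $g_\theta\colon\mathbb{Z}_p\to\mathbb{Q}_p$ be the analytic function with $f(x)=(x-\theta)^{m_f(\theta)}g_\theta(x)$ for all $x\in\mathbb{Z}_p$. Put $$\mathcal{R}'_f=\{\theta\in\mathcal{R}_f:\ l\nmid m_f(\theta)\ \text{ or }\ \lambda\bigl(p^{\,ld-(\nu_p(g_\theta(\theta))\bmod l)}\bigr)\nmid m_f(\theta)\}.$$ Then the sequence $(\ell_{p^l,d}(f(n)))_{n\ge0}$ is (a) periodic if $\mathcal{R}'_f=\varnothing$, where a power of $p$ can be chosen as a period; (b) strictly $p$-automatic if $\varnothing\ne\mathcal{R}'_f\subset\mathbb{Q}$; (c) not automatic if $\mathcal{R}'_f\not\subset\mathbb{Q}$.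
   Context: $\mathbb{N}=\{0,1,2,\ldots\}$. A function $\mathbb{Z}_p\to\mathbb{Q}_p$ is analytic if it is given by a single Taylor (power) series convergent on all of $\mathbb{Z}_p$. $\nu_p$ is the $p$-adic valuation. $\lambda$ is the Carmichael function: $\lambda(n)$ is the least positive integer $m$ with $a^m\equiv1\pmod n$ for all integers $a$ coprime to $n$. $x\bmod l$ is the remainder in $\{0,\ldots,l-1\}$. For nonzero $x\in\mathbb{Q}_p$ put $\nu_{p^l}(x)=\lfloor\nu_p(x)/l\rfloor$, $\mathcal{L}_{p^l}(x)=p^{ -l\,\nu_{p^l}(x)}x\in\mathbb{Z}_p$; $\mathcal{L}_{p^l}(0)=0$; and $\ell_{p^l,d}(x)=\mathcal{L}_{p^l}(x)\bmod p^{ld}\in\{0,\ldots,p^{ld}-1\}$. For an integer $k\ge2$, a sequence $(a_n)_{n\ge0}$ is $k$-automatic if its $k$-kernel $\{(a_{k^in+j})_{n\ge0}: i\ge0,\ 0\le j\le k^i-1\}$ is finite. It is automatic if it is $k$-automatic for some $k\ge2$. It is strictly $k$-automatic if it is $k$-automatic and is not $m$-automatic for any integer $m\ge2$ multiplicatively independent of $k$ (i.e. with $k^a\neq m^c$ for all integers $a,c\ge1$). A period need not be minimal.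
   Formalization: In (a) "periodic" allows a preperiod when f has a zero at a natural number (pure periodicity then fails: f(x)=x, p=2, l=d=1 gives 0,1,1,1,…); if f has no natural zero, the sequence is shown purely periodic; the period is a power of p in both cases. -}

module Defs where

open import Axiom.ExcludedMiddle using (ExcludedMiddle)
open import Data.Fin.Base as Fin using (Fin; toℕ; fromℕ<)
open import Data.Fin.Properties using (pigeonhole; toℕ<n; fromℕ<-injective)
open import Data.Integer.Base as ℤ using (ℤ; +_; -[1+_]; 0ℤ; 1ℤ; _/ℕ_; _%ℕ_)
import Data.Integer.Coprimality as ℤC
open import Data.Integer.DivMod using (n%ℕd<d; a≡a%ℕn+[a/ℕn]*n)
open import Data.Integer.Divisibility.Signed as ℤD using () renaming (_∣_ to _∣ℤ_)
import Data.Integer.Properties as ℤP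
open import Data.Integer.Tactic.RingSolver using (solve-∀)
open import Data.List.Base using (List)
open import Data.List.Relation.Unary.Any using (Any)
import Data.Nat.Coprimality as ℕC
open import Data.Nat.Base as ℕ using (ℕ; zero; suc; NonZero; _≤_; _<_; _∸_; _!)
open import Data.Nat.Divisibility as ℕD using (_∣_)
open import Data.Nat.Induction using (<-rec)
import Data.Nat.Properties as ℕP
open import Data.Product.Base using (∃; Σ-syntax; ∃-syntax; _×_; _,_; proj₁; proj₂)
open import Data.Rational.Base as ℚ using (ℚ)
open import Data.Sum.Base using (_⊎_)
open import Level using (0ℓ)
open import Relation.Binary.PropositionalEquality
  using (_≡_; _≢_; _≗_; refl; sym; trans; cong; cong₂; subst; module ≡-Reasoning)
open import Relation.Nullary using (¬_; yes; no)
open import Relation.Nullary.Decidable using (decidable-stable)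

------------------------------------------------------------------------
-- Least witnesses

IsLeast : (ℕ → Set) → ℕ → Set
IsLeast P n = P n × (∀ m → P m → n ≤ m)

least : ExcludedMiddle 0ℓ → (P : ℕ → Set) → ∃ P → ∃ (IsLeast P)
least em P (n , pn) = <-rec (λ n → P n → ∃ (IsLeast P)) step n pn
  where
  step : ∀ n → (∀ {m} → m < n → P m → ∃ (IsLeast P)) → P n → ∃ (IsLeast P)
  step n rec pn with em {∃[ m ] (m < n × P m)}
  ... | yes (m , m<n , pm) = rec m<n pm
  ... | no none = n , pn , λ m pm → ℕP.≮⇒≥ (λ m<n → none (m , m<n , pm))

------------------------------------------------------------------------
-- The Carmichael function

KillsUnits : ℕ → ℕ → Set
KillsUnits n m = 1 ≤ m × (∀ a → ℤC.Coprime a (+ n) → + n ∣ℤ a ℤ.^ m ℤ.- 1ℤ)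

private
  cancelPower : ∀ n a i x → ℤC.Coprime a n → n ∣ℤ a ℤ.^ i ℤ.* x → n ∣ℤ x
  cancelPower n a zero    x c h = subst (n ∣ℤ_) (ℤP.*-identityˡ x) h
  cancelPower n a (suc i) x c h = cancelPower n a i x c
    (ℤD.∣ᵤ⇒∣ (ℤC.coprime-divisor n a _ (ℤC.sym {a} {n} c)
      (ℤD.∣⇒∣ᵤ (subst (n ∣ℤ_) (ℤP.*-assoc a (a ℤ.^ i) x) h))))

  powerOfOne : ∀ n b q → n ∣ℤ b ℤ.- 1ℤ → n ∣ℤ b ℤ.^ q ℤ.- 1ℤ
  powerOfOne n b zero    h = ℤD.divides 0ℤ refl
  powerOfOne n b (suc q) h = subst (n ∣ℤ_) (lemma b (b ℤ.^ q))
    (ℤD.∣m∣n⇒∣m+n (ℤD.∣n⇒∣m*n b (powerOfOne n b q h)) h)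
    where
    lemma : ∀ b c → b ℤ.* (c ℤ.- 1ℤ) ℤ.+ (b ℤ.- 1ℤ) ≡ b ℤ.* c ℤ.- 1ℤ
    lemma = solve-∀

  sameRemainder : ∀ n .{{_ : NonZero n}} x y → x %ℕ n ≡ y %ℕ n → + n ∣ℤ y ℤ.- x
  sameRemainder n x y eq = ℤD.divides ((y /ℕ n) ℤ.- (x /ℕ n))
    (trans (cong₂ ℤ._-_
             (trans (a≡a%ℕn+[a/ℕn]*n y n) (cong (λ r → + r ℤ.+ (y /ℕ n) ℤ.* + n) (sym eq)))
             (a≡a%ℕn+[a/ℕn]*n x n))
           (lemma (+ (x %ℕ n)) (y /ℕ n) (x /ℕ n) (+ n)))
    where
    lemma : ∀ r u v m → (r ℤ.+ u ℤ.* m) ℤ.- (r ℤ.+ v ℤ.* m) ≡ (u ℤ.- v) ℤ.* m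
    lemma = solve-∀

  factorialKillsUnits : ∀ n .{{_ : NonZero n}} → KillsUnits n (n !)
  factorialKillsUnits n = ℕP.1≤n! n , kills
    where
    kills : ∀ a → ℤC.Coprime a (+ n) → + n ∣ℤ a ℤ.^ (n !) ℤ.- 1ℤ
    kills a c
      with i , j , i<j , eq ← pigeonhole (ℕP.n<1+n n)
             (λ (i : Fin (suc n)) → fromℕ< (n%ℕd<d (a ℤ.^ toℕ i) n))
      = subst (λ m → + n ∣ℤ a ℤ.^ m ℤ.- 1ℤ) (sym n!≡)
          (subst (λ x → + n ∣ℤ x ℤ.- 1ℤ) (ℤP.^-*-assoc a e q)
            (powerOfOne (+ n) (a ℤ.^ e) q unit))
      where
      e : ℕ
      e = toℕ j ∸ toℕ i

      e>0 : 1 ≤ e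
      e>0 = ℕP.m<n⇒0<n∸m i<j

      e≤n : e ≤ n
      e≤n = ℕP.≤-trans (ℕP.m∸n≤m (toℕ j) (toℕ i)) (ℕP.<⇒≤pred (toℕ<n j))

      m∣m! : ∀ {m} → 1 ≤ m → m ∣ m !
      m∣m! {suc m} _ = ℕD.m∣m*n (m !)

      e∣n! : e ∣ n !
      e∣n! = ℕD.∣-trans (m∣m! e>0) (ℕD.m≤n⇒m!∣n! e≤n)

      q : ℕ
      q = ℕD.quotient e∣n!

      n!≡ : n ! ≡ e ℕ.* q
      n!≡ = trans (ℕD._∣_.equality e∣n!) (ℕP.*-comm q e)

      split : a ℤ.^ toℕ j ≡ a ℤ.^ toℕ i ℤ.* a ℤ.^ e
      split = trans (cong (a ℤ.^_) (sym (ℕP.m+[n∸m]≡n (ℕP.<⇒≤ i<j))))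
                    (ℤP.^-distribˡ-+-* a (toℕ i) e)

      lemma : ∀ x y → x ℤ.* y ℤ.- x ≡ x ℤ.* (y ℤ.- 1ℤ)
      lemma = solve-∀

      unit : + n ∣ℤ a ℤ.^ e ℤ.- 1ℤ
      unit = cancelPower (+ n) a (toℕ i) _ c
        (subst (+ n ∣ℤ_)
          (trans (cong (ℤ._- a ℤ.^ toℕ i) split) (lemma (a ℤ.^ toℕ i) (a ℤ.^ e)))
          (sameRemainder n (a ℤ.^ toℕ i) (a ℤ.^ toℕ j) (fromℕ<-injective _ _ _ _ eq)))

carmichael : ExcludedMiddle 0ℓ → (n : ℕ) .{{_ : NonZero n}} → ℕ
carmichael em n = proj₁ (least em (KillsUnits n) (n ! , factorialKillsUnits n))

------------------------------------------------------------------------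
-- p-adic integers: the inverse limit of the rings ℤ/pⁿ, an element being
-- given by integer representatives of its residues.  Equality is _≈ᶻ_.

record ℤₚ (p : ℕ) : Set where
  field
    residue  : ℕ → ℤ
    coherent : ∀ n → + (p ℕ.^ n) ∣ℤ residue (suc n) ℤ.- residue n

open ℤₚ public

module _ {p : ℕ} where

  infix  4 _≈ᶻ_
  infixl 6 _+ᶻ_ _-ᶻ_
  infixl 7 _*ᶻ_
  infixr 8 _^ᶻ_

  _≈ᶻ_ : ℤₚ p → ℤₚ p → Set
  x ≈ᶻ y = ∀ n → + (p ℕ.^ n) ∣ℤ residue x n ℤ.- residue y n

  fromℤ : ℤ → ℤₚ p
  fromℤ a .residue  n = a
  fromℤ a .coherent n = ℤD.divides 0ℤ (ℤP.+-inverseʳ a)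

  fromℕ : ℕ → ℤₚ p
  fromℕ n = fromℤ (+ n)

  _+ᶻ_ : ℤₚ p → ℤₚ p → ℤₚ p
  (x +ᶻ y) .residue  n = residue x n ℤ.+ residue y n
  (x +ᶻ y) .coherent n = subst (+ (p ℕ.^ n) ∣ℤ_)
    (lemma (residue x (suc n)) (residue x n) (residue y (suc n)) (residue y n))
    (ℤD.∣m∣n⇒∣m+n (coherent x n) (coherent y n))
    where
    lemma : ∀ a′ a b′ b → (a′ ℤ.- a) ℤ.+ (b′ ℤ.- b) ≡ (a′ ℤ.+ b′) ℤ.- (a ℤ.+ b)
    lemma = solve-∀

  _*ᶻ_ : ℤₚ p → ℤₚ p → ℤₚ p
  (x *ᶻ y) .residue  n = residue x n ℤ.* residue y n
  (x *ᶻ y) .coherent n = subst (+ (p ℕ.^ n) ∣ℤ_)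
    (lemma (residue x (suc n)) (residue x n) (residue y (suc n)) (residue y n))
    (ℤD.∣m∣n⇒∣m+n (ℤD.∣n⇒∣m*n (residue x (suc n)) (coherent y n))
                  (ℤD.∣n⇒∣m*n (residue y n) (coherent x n)))
    where
    lemma : ∀ a′ a b′ b → a′ ℤ.* (b′ ℤ.- b) ℤ.+ b ℤ.* (a′ ℤ.- a) ≡ a′ ℤ.* b′ ℤ.- a ℤ.* b
    lemma = solve-∀

  _-ᶻ_ : ℤₚ p → ℤₚ p → ℤₚ p
  x -ᶻ y = x +ᶻ (fromℤ ℤ.-1ℤ *ᶻ y)

  _^ᶻ_ : ℤₚ p → ℕ → ℤₚ p
  x ^ᶻ zero  = fromℤ 1ℤ
  x ^ᶻ suc n = x *ᶻ (x ^ᶻ n)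

------------------------------------------------------------------------
-- p-adic numbers: (z /p^ k) is p⁻ᵏ z.  Equality is _≈_.

infix 5 _/p^_

record ℚₚ (p : ℕ) : Set where
  constructor _/p^_
  field
    num : ℤₚ p
    den : ℕ

open ℚₚ public

module _ {p : ℕ} where

  infix  4 _≈_
  infixl 6 _+_ _-_
  infixl 7 _*_

  p^ : ℕ → ℤₚ p
  p^ k = fromℕ (p ℕ.^ k)

  _≈_ : ℚₚ p → ℚₚ p → Set
  x ≈ y = p^ (den y) *ᶻ num x ≈ᶻ p^ (den x) *ᶻ num y

  ι : ℤₚ p → ℚₚ p
  ι z = z /p^ 0

  0ₚ : ℚₚ p
  0ₚ = ι (fromℤ 0ℤ)

  _+_ : ℚₚ p → ℚₚ p → ℚₚ p
  x + y = (p^ (den y) *ᶻ num x +ᶻ p^ (den x) *ᶻ num y) /p^ (den x ℕ.+ den y)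

  _*_ : ℚₚ p → ℚₚ p → ℚₚ p
  x * y = (num x *ᶻ num y) /p^ (den x ℕ.+ den y)

  _-_ : ℚₚ p → ℚₚ p → ℚₚ p
  x - y = x + ι (fromℤ ℤ.-1ℤ) * y

  -- pⁱ x
  shift : ℤ → ℚₚ p → ℚₚ p
  shift (+ n)    x = (p^ n *ᶻ num x) /p^ den x
  shift -[1+ n ] x = num x /p^ (den x ℕ.+ suc n)

  -- x ∈ pᵐ ℤₚ, that is, |x| ≤ p⁻ᵐ
  _∈p^_ : ℚₚ p → ℕ → Set
  x ∈p^ m = + (p ℕ.^ (den x ℕ.+ m)) ∣ℤ residue (num x) (den x ℕ.+ m)

  -- The element x of ℤₚ is the image of q ∈ ℚ.
  _isImageOf_ : ℤₚ p → ℚ → Set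
  x isImageOf q = fromℤ (ℚ.↧ q) *ᶻ x ≈ᶻ fromℤ (ℚ.↥ q)

  Rational : ℤₚ p → Set
  Rational x = ∃[ q ] (x isImageOf q)

------------------------------------------------------------------------
-- Analytic functions on ℤₚ

  Converges : (ℕ → ℚₚ p) → ℚₚ p → Set
  Converges s y = ∀ m → ∃[ N ] (∀ n → N ≤ n → (s n - y) ∈p^ m)

  partialSum : (ℕ → ℚₚ p) → ℤₚ p → ℕ → ℚₚ p
  partialSum c x zero    = 0ₚ
  partialSum c x (suc n) = partialSum c x n + c n * ι (x ^ᶻ n)

  -- Since limits are unique up to _≈_, this includes that f respects _≈ᶻ_.
  Analytic : (ℤₚ p → ℚₚ p) → Set
  Analytic f = ∃[ c ] (∀ x → Converges (partialSum c x) (f x))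

  -- Multiplicity m = m_f(θ) and cofactor g = g_θ of a root θ of f.
  -- Being of multiplicity exactly m means that g does not vanish at θ.
  record Factorisation (f : ℤₚ p → ℚₚ p) (θ : ℤₚ p) : Set where
    field
      multiplicity : ℕ
      cofactor     : ℤₚ p → ℚₚ p
      analytic     : Analytic cofactor
      factors      : ∀ x → f x ≈ ι ((x -ᶻ θ) ^ᶻ multiplicity) * cofactor x
      nonvanishing : ¬ (cofactor θ ≈ 0ₚ)

------------------------------------------------------------------------
-- Valuation and last nonzero digits

-- As p-adic equality is undecidable, the functions below rest on excluded
-- middle.
module Digits (em : ExcludedMiddle 0ℓ) {p : ℕ} where

  private
    NonDivisible : ℤₚ p → ℕ → Set
    NonDivisible z n = ¬ (+ (p ℕ.^ suc n) ∣ℤ residue z (suc n))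

    nonDivisible : ∀ x → ¬ (x ≈ 0ₚ) → ∃ (NonDivisible (num x))
    nonDivisible x x≉0 = decidable-stable em λ none → x≉0 λ n →
      subst (+ (p ℕ.^ n) ∣ℤ_)
        (lemma (residue (num x) n) (+ (p ℕ.^ den x)))
        (all (λ n → decidable-stable em λ ∤ → none (n , ∤)) n)
      where
      all : (∀ n → + (p ℕ.^ suc n) ∣ℤ residue (num x) (suc n)) →
            ∀ n → + (p ℕ.^ n) ∣ℤ residue (num x) n
      all h zero    = ℤD.divides (residue (num x) 0) (sym (ℤP.*-identityʳ _))
      all h (suc n) = h n

      lemma : ∀ a q → a ≡ 1ℤ ℤ.* a ℤ.- q ℤ.* 0ℤ
      lemma = solve-∀

  -- The valuation of num x is the least n with pⁿ⁺¹ ∤ num x.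
  ν : (x : ℚₚ p) → ¬ (x ≈ 0ₚ) → ℤ
  ν x x≉0 = + proj₁ (least em (NonDivisible (num x)) (nonDivisible x x≉0)) ℤ.- + den x

  -- _/ℕ_ rounds down.
  𝓛 : (l : ℕ) .{{_ : NonZero l}} → ℚₚ p → ℚₚ p
  𝓛 l x with em {x ≈ 0ₚ}
  ... | yes _   = 0ₚ
  ... | no  x≉0 = shift (ℤ.- (+ l ℤ.* (ν x x≉0 /ℕ l))) x

  -- x mod pᵐ for x ∈ ℤₚ; the division by p^(den x) is then exact.
  _mod-p^_ : .{{_ : NonZero p}} → ℚₚ p → ℕ → ℕ
  x mod-p^ m =
    _%ℕ_ (_/ℕ_ (residue (num x) (den x ℕ.+ m)) (p ℕ.^ den x) {{ℕP.m^n≢0 p (den x)}})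
         (p ℕ.^ m) {{ℕP.m^n≢0 p m}}

  ℓ : .{{_ : NonZero p}} (l : ℕ) .{{_ : NonZero l}} (d : ℕ) → ℚₚ p → ℕ
  ℓ l d x = 𝓛 l x mod-p^ (l ℕ.* d)

  -- The set 𝓡′_f
  𝓡′ : .{{_ : NonZero p}} (l : ℕ) .{{_ : NonZero l}} (d : ℕ) →
       (ℤₚ p → ℚₚ p) → ℤₚ p → Set
  𝓡′ l d f θ = f θ ≈ 0ₚ × Σ[ F ∈ Factorisation f θ ]
    (let open Factorisation F
         e = l ℕ.* d ∸ (ν (cofactor θ) nonvanishing %ℕ l)
     in ¬ (l ∣ multiplicity)
        ⊎ ¬ (carmichael em (p ℕ.^ e) {{ℕP.m^n≢0 p e}} ∣ multiplicity))

------------------------------------------------------------------------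
-- Sequences

-- The k-kernel is finite as a set of sequences up to pointwise equality.
Automatic[_] : ℕ → (ℕ → ℕ) → Set
Automatic[ k ] a = Σ[ ss ∈ List (ℕ → ℕ) ]
  (∀ i j → j < k ℕ.^ i → Any ((λ n → a (k ℕ.^ i ℕ.* n ℕ.+ j)) ≗_) ss)

Automatic : (ℕ → ℕ) → Set
Automatic a = ∃[ k ] (2 ≤ k × Automatic[ k ] a)

MultiplicativelyIndependent : ℕ → ℕ → Set
MultiplicativelyIndependent k m = ∀ a c → 1 ≤ a → 1 ≤ c → k ℕ.^ a ≢ m ℕ.^ c

StrictlyAutomatic[_] : ℕ → (ℕ → ℕ) → Set
StrictlyAutomatic[ k ] a = Automatic[ k ] a ×
  (∀ m → 2 ≤ m → MultiplicativelyIndependent k m → ¬ Automatic[ m ] a)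

-- Periodicity with preperiod N.  Since ℓ is set to 0 at 0, a zero of f in ℕ
-- can force N > 0: for f(x) = x, p = 2, l = d = 1 the digits are 0,1,1,1,…
-- although 𝓡′_f is empty.
PeriodicFrom : ℕ → ℕ → (ℕ → ℕ) → Set
PeriodicFrom N T a = 1 ≤ T × (∀ n → N ≤ n → a (n ℕ.+ T) ≡ a n)

{-# OPTIONS --safe #-}
module Submission where

-- Near every θ ∈ ℤₚ one has f(x) = p^(-lC) (x - θ)ᵐ t(x) with t an integral
-- power series and t(θ) = pʷ γ ≠ 0 (synthetic division, which ends by
-- Strassmann's argument).  For x - θ = pᵛ u with u a unit, ℓ(f(x)) is then
-- p^((vm + w) mod l) uᵐ γ modulo p^(ld).  So ℓ(f(n)) is locally constant at θ,
-- away from θ itself, exactly if θ ∉ 𝓡′, and compactness of ℤₚ gives (a).  If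
-- 𝓡′ ⊂ ℚ, the kernel sequence n ↦ ℓ(f(pⁱ n + j)) around a root θ depends only on
-- i mod l and on (θ - j)/pⁱ, a rational number of bounded height; away from the
-- roots it is periodic.
-- Cobham's theorem is not needed.  The k-kernel sequence n ↦ ℓ(f(kⁱ n + j))
-- inherits the singularity θ ∈ 𝓡′ at y = (θ - j)/kⁱ if y ∈ ℤₚ, and its
-- singularities come from the finitely many roots of f.  A finite k-kernel thus
-- leaves only finitely many points y.  Equality of two of them with different i
-- makes θ rational, which gives (c); if k is not a power of p, there are more and
-- more points y for a single i, which gives (b).

open import Defs
open import Axiom.ExcludedMiddle using (ExcludedMiddle)
open import Data.Empty using (⊥; ⊥-elim)
open import Data.Fin.Base as Fin using (Fin; toℕ; fromℕ<)
import Data.Fin.Properties as FinP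
open import Data.Integer.Base as ℤ using (ℤ; +_; -[1+_]; 0ℤ; 1ℤ; _/ℕ_; _%ℕ_)
import Data.Integer.Coprimality as ℤC
import Data.Integer.DivMod as ℤDM
open import Data.Integer.Divisibility.Signed as ℤD using (divides) renaming (_∣_ to _∣ℤ_)
import Data.Integer.GCD as ℤGCD
import Data.Integer.Properties as ℤP
open import Data.Integer.Tactic.RingSolver using (solve-∀)
open import Data.List.Base as List using (List; length; lookup)
open import Data.List.Relation.Unary.Any as Any using (Any)
import Data.List.Relation.Unary.Any.Properties as AnyP
open import Data.Nat.Base as ℕ using (ℕ; zero; suc; NonZero; _^_; _≤_; _<_; z≤n; s≤s)
import Data.Nat.Coprimality as ℕC
import Data.Nat.Divisibility as ℕD
import Data.Nat.DivMod as ℕDM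
open import Data.Nat.Induction using (<-rec)
open import Data.Nat.Primality using (Prime; euclidsLemma; prime⇒nonTrivial; prime⇒irreducible)
import Data.Nat.Properties as ℕP
open import Data.Product.Base using (∃; ∃-syntax; Σ; Σ-syntax; _×_; _,_; proj₁; proj₂)
open import Data.Rational.Base as ℚ using (ℚ)
import Data.Rational.Properties as ℚP
open import Data.Sum.Base as Sum using (_⊎_; inj₁; inj₂; [_,_]′)
open import Function.Base using (_∘_; _$_)
open import Level using (0ℓ)
open import Relation.Binary.Bundles using (Setoid)
open import Relation.Binary.Definitions using (tri<; tri≈; tri>)
open import Relation.Binary.PropositionalEquality
  using (_≡_; _≢_; _≗_; refl; sym; trans; cong; cong₂; subst; subst₂; module ≡-Reasoning)
import Relation.Binary.Reasoning.Setoid as SetoidReasoning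
open import Relation.Nullary using (¬_; Dec; yes; no; contradiction)
open import Relation.Nullary.Decidable using (decidable-stable)
import Algebra.Properties.AbelianGroup ℤP.+-0-abelianGroup as ℤG

-- Congruences in ℤₚ

-- A finite kernel identifies sequences coming from different pairs (i, j), so a singularity has to
-- be visible in the values of a sequence alone: arbitrarily close to y it takes two different
-- values. To count the singular points of one sequence, a single form f(κ n + j) of it is fixed; y
-- ↦ κ y + j then maps them injectively to roots of f, and distinct roots differ modulo one fixed
-- power `p ^ level`. The number of points over kⁱ comes from k = pᵗ k′ with p ∤ k′. As k′ⁱ is a
-- unit, y ∈ ℤₚ only asks for j ≡ θ modulo p^(ti), and k′ⁱ of the j below kⁱ qualify: a single one
-- if k is a power of p, and an unbounded number otherwise. The value ℓ(0) = 0 is an obstacle of its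
-- own. At a root in ℕ the digits jump even if the root is not in 𝓡′. This causes the preperiod in
-- (a), and for automaticity it makes all rational roots, not only those in 𝓡′, go through the
-- argument with bounded heights.

module _ {p : ℕ} where

  infix  4 _≋_[_] _≅_
  infixl 6 _⊕_ _⊖_
  infixl 7 _⊗_
  infixr 8 _↑_

  -- The operations of Defs, sealed: unification would otherwise compare
  -- the coherence proofs of compound expressions.
  opaque
    _⊕_ _⊗_ : ℤₚ p → ℤₚ p → ℤₚ p
    _⊕_ = _+ᶻ_
    _⊗_ = _*ᶻ_

    int : ℤ → ℤₚ p
    int = fromℤ

    ϖ : ℕ → ℤₚ p
    ϖ k = fromℕ (p ^ k)

  0ᶻ 1ᶻ : ℤₚ p
  0ᶻ = int 0ℤ
  1ᶻ = int 1ℤ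

  _⊖_ : ℤₚ p → ℤₚ p → ℤₚ p
  x ⊖ y = x ⊕ int ℤ.-1ℤ ⊗ y

  _↑_ : ℤₚ p → ℕ → ℤₚ p
  x ↑ zero  = 1ᶻ
  x ↑ suc m = x ⊗ x ↑ m

  -- The wrappers make x and y inferable, which they are not from _≈ᶻ_.
  record _≋_[_] (x y : ℤₚ p) (n : ℕ) : Set where
    constructor congruent
    field difference : + (p ^ n) ∣ℤ residue x n ℤ.- residue y n

  record _≅_ (x y : ℤₚ p) : Set where
    constructor equal
    field levels : x ≈ᶻ y

  open _≋_[_] public
  open _≅_ public

  private variable
    x x′ y y′ z z′ : ℤₚ p
    k m n n′ : ℕ

  ≡⇒≋ : residue x n ≡ residue y n → x ≋ y [ n ]
  ≡⇒≋ {x} {n} {y} eq = congruent (divides 0ℤ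
    (trans (cong (ℤ._- residue y n) eq) (ℤP.+-inverseʳ (residue y n))))

  ≋-refl : x ≋ x [ n ]
  ≋-refl {x} = ≡⇒≋ {x} {_} {x} refl

  ≋-sym : x ≋ y [ n ] → y ≋ x [ n ]
  ≋-sym {x} {y} {n} (congruent h) = congruent
    (subst (_ ∣ℤ_) (identity (residue x n) (residue y n)) (ℤD.∣m⇒∣-m h))
    where
    identity : ∀ a b → ℤ.- (a ℤ.- b) ≡ b ℤ.- a
    identity = solve-∀

  ≋-trans : x ≋ y [ n ] → y ≋ z [ n ] → x ≋ z [ n ]
  ≋-trans {x} {y} {n} {z} (congruent h) (congruent h′) = congruent
    (subst (_ ∣ℤ_) (identity (residue x n) (residue y n) (residue z n)) (ℤD.∣m∣n⇒∣m+n h h′))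
    where
    identity : ∀ a b c → (a ℤ.- b) ℤ.+ (b ℤ.- c) ≡ a ℤ.- c
    identity = solve-∀

  opaque
    unfolding _⊕_

    +-cong-≋ : x ≋ x′ [ n ] → y ≋ y′ [ n ] → x ⊕ y ≋ x′ ⊕ y′ [ n ]
    +-cong-≋ {x} {x′} {n} {y} {y′} (congruent h) (congruent h′) = congruent
      (subst (_ ∣ℤ_) (identity (residue x n) (residue x′ n) (residue y n) (residue y′ n))
        (ℤD.∣m∣n⇒∣m+n h h′))
      where
      identity : ∀ a a′ b b′ → (a ℤ.- a′) ℤ.+ (b ℤ.- b′) ≡ (a ℤ.+ b) ℤ.- (a′ ℤ.+ b′)
      identity = solve-∀

    *-cong-≋ : x ≋ x′ [ n ] → y ≋ y′ [ n ] → x ⊗ y ≋ x′ ⊗ y′ [ n ]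
    *-cong-≋ {x} {x′} {n} {y} {y′} (congruent h) (congruent h′) = congruent
      (subst (_ ∣ℤ_) (identity (residue x n) (residue x′ n) (residue y n) (residue y′ n))
        (ℤD.∣m∣n⇒∣m+n (ℤD.∣n⇒∣m*n (residue y n) h) (ℤD.∣n⇒∣m*n (residue x′ n) h′)))
      where
      identity : ∀ a a′ b b′ → b ℤ.* (a ℤ.- a′) ℤ.+ a′ ℤ.* (b ℤ.- b′) ≡ a ℤ.* b ℤ.- a′ ℤ.* b′
      identity = solve-∀

  opaque
    unfolding _⊕_

    residue-int : ∀ a n → residue (int a) n ≡ a
    residue-int a n = refl

    residue-⊗ : ∀ (x y : ℤₚ p) n → residue (x ⊗ y) n ≡ residue x n ℤ.* residue y n
    residue-⊗ x y n = refl

    int-≋ : ∀ {a b} → + (p ^ n) ∣ℤ a ℤ.- b → int a ≋ int b [ n ]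
    int-≋ = congruent

    ≋-int : ∀ {a b} → int a ≋ int b [ n ] → + (p ^ n) ∣ℤ a ℤ.- b
    ≋-int = difference

  -‿cong-≋ : x ≋ x′ [ n ] → y ≋ y′ [ n ] → x ⊖ y ≋ x′ ⊖ y′ [ n ]
  -‿cong-≋ {x} {x′} {n} {y} {y′} h h′ =
    +-cong-≋ h (*-cong-≋ ≋-refl h′)

  ^-cong-≋ : ∀ m → x ≋ x′ [ n ] → x ↑ m ≋ x′ ↑ m [ n ]
  ^-cong-≋ {x} {x′} zero    h = ≋-refl
  ^-cong-≋ {x} {x′} (suc m) h = *-cong-≋ h (^-cong-≋ m h)

  pos-p^-+ : ∀ m n → + (p ^ (m ℕ.+ n)) ≡ + (p ^ m) ℤ.* + (p ^ n)
  pos-p^-+ m n = trans (cong +_ (ℕP.^-distribˡ-+-* p m n)) (ℤP.pos-* (p ^ m) (p ^ n))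

  p^-mono-∣ : m ≤ n → + (p ^ m) ∣ℤ + (p ^ n)
  p^-mono-∣ {m} {n} m≤n = divides (+ (p ^ (n ℕ.∸ m))) (trans
    (cong (λ k → + (p ^ k)) (sym (ℕP.m∸n+n≡m m≤n)))
    (pos-p^-+ (n ℕ.∸ m) m))

  residue-≋ : ∀ (x : ℤₚ p) {m n} → m ≤ n → + (p ^ m) ∣ℤ residue x n ℤ.- residue x m
  residue-≋ x {m} m≤n with k , refl ← ℕP.m≤n⇒∃[o]m+o≡n m≤n = go k
    where
    identity : ∀ a b c → (a ℤ.- b) ℤ.+ (b ℤ.- c) ≡ a ℤ.- c
    identity = solve-∀
    go : ∀ k → + (p ^ m) ∣ℤ residue x (m ℕ.+ k) ℤ.- residue x m
    go zero rewrite ℕP.+-identityʳ m = divides 0ℤ (ℤP.+-inverseʳ (residue x m))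
    go (suc k) rewrite ℕP.+-suc m k = subst (_ ∣ℤ_)
      (identity (residue x (suc (m ℕ.+ k))) (residue x (m ℕ.+ k)) (residue x m))
      (ℤD.∣m∣n⇒∣m+n (ℤD.∣-trans (p^-mono-∣ (ℕP.m≤m+n m k)) (coherent x (m ℕ.+ k))) (go k))

  opaque
    unfolding _⊕_

    -- This reduces p-adic congruences to divisibility in ℤ: modulo pᵐ, any later residue may stand
    -- for x.
    residue-const : ∀ (x : ℤₚ p) {m n} → m ≤ n → x ≋ int (residue x n) [ m ]
    residue-const x {m} {n} m≤n = ≋-sym {int (residue x n)} {x} (congruent (residue-≋ x m≤n))

  ≋-down : m ≤ n → x ≋ y [ n ] → x ≋ y [ m ]
  ≋-down {m} {n} {x} {y} m≤n (congruent h) =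
    ≋-trans (residue-const x m≤n) (≋-trans
      (int-≋ (ℤD.∣-trans (p^-mono-∣ m≤n) h)) (≋-sym (residue-const y m≤n)))

  ≋-level : m ≡ n → x ≋ y [ m ] → x ≋ y [ n ]
  ≋-level refl h = h

  ≋-zero : x ≋ y [ 0 ]
  ≋-zero {x} {y} = congruent (divides (residue x 0 ℤ.- residue y 0) (sym (ℤP.*-identityʳ _)))

  ≅⇒≋ : x ≅ y → x ≋ y [ n ]
  ≅⇒≋ (equal h) = congruent (h _)

  ≋⇒≅ : (∀ n → x ≋ y [ n ]) → x ≅ y
  ≋⇒≅ h = equal (difference ∘ h)

  identity : (∀ n → residue x n ≡ residue y n) → x ≅ y
  identity {x} {y} eq = ≋⇒≅ (λ n → ≡⇒≋ {x} {n} {y} (eq n))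

  ≅-refl : x ≅ x
  ≅-refl = ≋⇒≅ (λ _ → ≋-refl)

  ≅-sym : x ≅ y → y ≅ x
  ≅-sym h = ≋⇒≅ (λ _ → ≋-sym (≅⇒≋ h))

  ≅-trans : x ≅ y → y ≅ z → x ≅ z
  ≅-trans h h′ = ≋⇒≅ (λ _ → ≋-trans (≅⇒≋ h) (≅⇒≋ h′))

  ≅-reflexive : x ≡ y → x ≅ y
  ≅-reflexive refl = ≅-refl

  ≅-setoid : Setoid 0ℓ 0ℓ
  ≅-setoid = record
    { Carrier = ℤₚ p ; _≈_ = _≅_
    ; isEquivalence = record { refl = ≅-refl ; sym = ≅-sym ; trans = ≅-trans } }

  ≋-setoid : ℕ → Setoid 0ℓ 0ℓ
  ≋-setoid n = record
    { Carrier = ℤₚ p ; _≈_ = _≋_[ n ]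
    ; isEquivalence = record { refl = ≋-refl ; sym = ≋-sym ; trans = ≋-trans } }

  +-cong : x ≅ x′ → y ≅ y′ → x ⊕ y ≅ x′ ⊕ y′
  +-cong h h′ = ≋⇒≅ (λ _ → +-cong-≋ (≅⇒≋ h) (≅⇒≋ h′))

  *-cong : x ≅ x′ → y ≅ y′ → x ⊗ y ≅ x′ ⊗ y′
  *-cong h h′ = ≋⇒≅ (λ _ → *-cong-≋ (≅⇒≋ h) (≅⇒≋ h′))

  *-congˡ : ∀ (x : ℤₚ p) → y ≅ y′ → x ⊗ y ≅ x ⊗ y′
  *-congˡ x = *-cong ≅-refl

  *-congʳ : ∀ (y : ℤₚ p) → x ≅ x′ → x ⊗ y ≅ x′ ⊗ y
  *-congʳ y h = *-cong h ≅-refl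

  -‿cong : x ≅ x′ → y ≅ y′ → x ⊖ y ≅ x′ ⊖ y′
  -‿cong h h′ = ≋⇒≅ (λ _ → -‿cong-≋ (≅⇒≋ h) (≅⇒≋ h′))

  ^-cong : ∀ m → x ≅ x′ → x ↑ m ≅ x′ ↑ m
  ^-cong m h = ≋⇒≅ (λ _ → ^-cong-≋ m (≅⇒≋ h))

  opaque
    unfolding _⊕_

    ϖ-int : ∀ k → ϖ k ≅ int (+ (p ^ k))
    ϖ-int k = identity (λ _ → refl)

    int-⊗ : ∀ a b → int (a ℤ.* b) ≅ int a ⊗ int b
    int-⊗ a b = identity (λ _ → refl)

    *-assoc : ∀ (x y z : ℤₚ p) → (x ⊗ y) ⊗ z ≅ x ⊗ (y ⊗ z)
    *-assoc x y z = identity (λ n → ℤP.*-assoc (residue x n) (residue y n) (residue z n))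

    +-comm : ∀ (x y : ℤₚ p) → x ⊕ y ≅ y ⊕ x
    +-comm x y = identity (λ n → ℤP.+-comm (residue x n) (residue y n))

    *-comm : ∀ (x y : ℤₚ p) → x ⊗ y ≅ y ⊗ x
    *-comm x y = identity (λ n → ℤP.*-comm (residue x n) (residue y n))

    *-identityˡ : ∀ (x : ℤₚ p) → 1ᶻ ⊗ x ≅ x
    *-identityˡ x = identity (λ n → ℤP.*-identityˡ (residue x n))

    *-identityʳ : ∀ (x : ℤₚ p) → x ⊗ 1ᶻ ≅ x
    *-identityʳ x = identity (λ n → ℤP.*-identityʳ (residue x n))

    *-zeroˡ : ∀ (x : ℤₚ p) → 0ᶻ ⊗ x ≅ 0ᶻ
    *-zeroˡ x = identity (λ n → refl)

    *-zeroʳ : ∀ (x : ℤₚ p) → x ⊗ 0ᶻ ≅ 0ᶻ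
    *-zeroʳ x = identity (λ n → ℤP.*-zeroʳ (residue x n))

    +-identityʳ : ∀ (x : ℤₚ p) → x ⊕ 0ᶻ ≅ x
    +-identityʳ x = identity (λ n → ℤP.+-identityʳ (residue x n))

    -‿inverse : ∀ (x : ℤₚ p) → x ⊖ x ≅ 0ᶻ
    -‿inverse x = identity (λ n → lemma (residue x n))
      where
      lemma : ∀ a → a ℤ.+ ℤ.-1ℤ ℤ.* a ≡ 0ℤ
      lemma = solve-∀

    x-y+y : ∀ (x y : ℤₚ p) → (x ⊖ y) ⊕ y ≅ x
    x-y+y x y = identity (λ n → lemma (residue x n) (residue y n))
      where
      lemma : ∀ a b → (a ℤ.+ ℤ.-1ℤ ℤ.* b) ℤ.+ b ≡ a
      lemma = solve-∀

    x+y-y : ∀ (x y : ℤₚ p) → (x ⊕ y) ⊖ y ≅ x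
    x+y-y x y = identity (λ n → lemma (residue x n) (residue y n))
      where
      lemma : ∀ a b → (a ℤ.+ b) ℤ.+ ℤ.-1ℤ ℤ.* b ≡ a
      lemma = solve-∀

    *-distrib-- : ∀ (x y z : ℤₚ p) → x ⊗ (y ⊖ z) ≅ x ⊗ y ⊖ x ⊗ z
    *-distrib-- x y z = identity (λ n → lemma (residue x n) (residue y n) (residue z n))
      where
      lemma : ∀ a b c → a ℤ.* (b ℤ.+ ℤ.-1ℤ ℤ.* c) ≡ a ℤ.* b ℤ.+ ℤ.-1ℤ ℤ.* (a ℤ.* c)
      lemma = solve-∀

    *-distrib-+ : ∀ (x y z : ℤₚ p) → x ⊗ (y ⊕ z) ≅ x ⊗ y ⊕ x ⊗ z
    *-distrib-+ x y z = identity (λ n → ℤP.*-distribˡ-+ (residue x n) (residue y n) (residue z n))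

    ϖ-+ : ∀ m n → ϖ (m ℕ.+ n) ≅ ϖ m ⊗ ϖ n
    ϖ-+ m n = identity (λ _ → pos-p^-+ m n)

    +-identityˡ : ∀ (x : ℤₚ p) → 0ᶻ ⊕ x ≅ x
    +-identityˡ x = identity (λ n → ℤP.+-identityˡ (residue x n))

  *-swap : ∀ (x y z : ℤₚ p) → x ⊗ (y ⊗ z) ≅ y ⊗ (x ⊗ z)
  *-swap x y z = ≅-trans (≅-sym (*-assoc x y z))
    (≅-trans (*-congʳ z (*-comm x y)) (*-assoc y x z))

  *-interchange : ∀ (x y z w : ℤₚ p) → (x ⊗ y) ⊗ (z ⊗ w) ≅ (x ⊗ z) ⊗ (y ⊗ w)
  *-interchange x y z w = ≅-trans (*-assoc x y (z ⊗ w))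
    (≅-trans (*-congˡ x (*-swap y z w)) (≅-sym (*-assoc x z (y ⊗ w))))

  ≋⇒-≋0 : x ≋ y [ n ] → x ⊖ y ≋ 0ᶻ [ n ]
  ≋⇒-≋0 {y = y} h = ≋-trans (-‿cong-≋ h ≋-refl) (≅⇒≋ (-‿inverse y))

  -≋0⇒≋ : x ⊖ y ≋ 0ᶻ [ n ] → x ≋ y [ n ]
  -≋0⇒≋ {x} {y} h = ≋-trans (≅⇒≋ (≅-sym (x-y+y x y))) (≋-trans (+-cong-≋ h ≋-refl)
    (≅⇒≋ (+-identityˡ y)))

  -≅0⇒≅ : x ⊖ y ≅ 0ᶻ → x ≅ y
  -≅0⇒≅ h = ≋⇒≅ (λ _ → -≋0⇒≋ (≅⇒≋ h))

  ≅⇒-≅0 : x ≅ y → x ⊖ y ≅ 0ᶻ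
  ≅⇒-≅0 h = ≋⇒≅ (λ _ → ≋⇒-≋0 (≅⇒≋ h))

  ϖ-+-* : ∀ m n (x : ℤₚ p) → ϖ (m ℕ.+ n) ⊗ x ≅ ϖ m ⊗ (ϖ n ⊗ x)
  ϖ-+-* m n x = ≅-trans (*-congʳ x (ϖ-+ m n)) (*-assoc _ _ x)

  ^-distrib-* : ∀ (x y : ℤₚ p) m → (x ⊗ y) ↑ m ≅ x ↑ m ⊗ y ↑ m
  ^-distrib-* x y zero = ≅-sym (*-identityˡ 1ᶻ)
  ^-distrib-* x y (suc m) =
    ≅-trans (*-congˡ (x ⊗ y) (^-distrib-* x y m)) (*-interchange x y (x ↑ m) (y ↑ m))

  ϖ-^ : ∀ k m → ϖ k ↑ m ≅ ϖ (k ℕ.* m)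
  ϖ-^ k zero rewrite ℕP.*-zeroʳ k = ≅-sym (ϖ-int 0)
  ϖ-^ k (suc m) rewrite ℕP.*-suc k m =
    ≅-trans (*-congˡ (ϖ k) (ϖ-^ k m)) (≅-sym (ϖ-+ k (k ℕ.* m)))

  1^ : ∀ m → 1ᶻ ↑ m ≅ 1ᶻ
  1^ zero = ≅-refl
  1^ (suc m) = ≅-trans (*-identityˡ _) (1^ m)

  residue-^ : ∀ (x : ℤₚ p) m n → residue (x ↑ m) n ≡ residue x n ℤ.^ m
  residue-^ x zero    n = residue-int 1ℤ n
  residue-^ x (suc m) n rewrite residue-⊗ x (x ↑ m) n = cong (residue x n ℤ.*_) (residue-^ x m n)

  *-zero-irrelevant : ∀ (x y : ℤₚ p) → x ⊗ 0ᶻ ≅ y ⊗ 0ᶻ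
  *-zero-irrelevant x y = ≅-trans (*-zeroʳ x) (≅-sym (*-zeroʳ y))

  *-≋0ʳ : ∀ (x : ℤₚ p) → y ≋ 0ᶻ [ n ] → x ⊗ y ≋ 0ᶻ [ n ]
  *-≋0ʳ x h = ≋-trans (*-cong-≋ ≋-refl h) (≅⇒≋ (*-zeroʳ x))

  *-≋0ˡ : ∀ (y : ℤₚ p) → x ≋ 0ᶻ [ n ] → x ⊗ y ≋ 0ᶻ [ n ]
  *-≋0ˡ y h = ≋-trans (*-cong-≋ h ≋-refl) (≅⇒≋ (*-zeroˡ y))

  opaque
    unfolding _⊕_

    ∣⇒≋0 : + (p ^ n) ∣ℤ residue x n → x ≋ 0ᶻ [ n ]
    ∣⇒≋0 h = congruent (subst (_ ∣ℤ_) (sym (ℤP.+-identityʳ _)) h)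

    ≋0⇒∣ : x ≋ 0ᶻ [ n ] → + (p ^ n) ∣ℤ residue x n
    ≋0⇒∣ (congruent h) = subst (_ ∣ℤ_) (ℤP.+-identityʳ _) h

    ϖ-≋0 : ∀ (x : ℤₚ p) → n ≤ k → ϖ k ⊗ x ≋ 0ᶻ [ n ]
    ϖ-≋0 {n} {k} x n≤k = ∣⇒≋0 (ℤD.∣m⇒∣m*n (residue x n) (p^-mono-∣ n≤k))

  -- The residues at level k + n represent x and y to the precision of the conclusion, and by
  -- coherence their difference is still divisible by pⁿ.
  ≋-+ : ∀ k → x ≋ y [ n ] → ϖ k ⊗ x ≋ ϖ k ⊗ y [ k ℕ.+ n ]
  ≋-+ {x} {y} {n} k h =
    ≋-trans (*-cong-≋ ≋-refl (residue-const x ℕP.≤-refl)) (≋-trans (aux h′)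
      (*-cong-≋ ≋-refl (≋-sym (residue-const y ℕP.≤-refl))))
    where
    a = residue x (k ℕ.+ n)
    b = residue y (k ℕ.+ n)
    h′ : + (p ^ n) ∣ℤ a ℤ.- b
    h′ = ≋-int (≋-trans (≋-sym (residue-const x (ℕP.m≤n+m n k)))
      (≋-trans h (residue-const y (ℕP.m≤n+m n k))))
    lemma : ∀ q a b → q ℤ.* (a ℤ.- b) ≡ q ℤ.* a ℤ.- q ℤ.* b
    lemma = solve-∀
    opaque
      unfolding _⊕_
      aux : + (p ^ n) ∣ℤ a ℤ.- b → ϖ k ⊗ int a ≋ ϖ k ⊗ int b [ k ℕ.+ n ]
      aux h′ = congruent (subst₂ _∣ℤ_
        (sym (pos-p^-+ k n))
        (lemma (+ (p ^ k)) a b) (ℤD.*-monoʳ-∣ (+ (p ^ k)) h′))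

module _ {p : ℕ} .{{_ : NonZero p}} where

  private variable
    x y z u : ℤₚ p
    m n : ℕ

  p^≢0 : ∀ n → NonZero (p ^ n)
  p^≢0 n = ℕP.m^n≢0 p n

  opaque
    unfolding _⊕_

    int-cancel : ∀ k {a b} → ϖ {p} k ⊗ int a ≋ ϖ k ⊗ int b [ k ℕ.+ n ] → + (p ^ n) ∣ℤ a ℤ.- b
    int-cancel {n} k {a} {b} (congruent h) =
      ℤD.*-cancelˡ-∣ (+ (p ^ k)) {{p^≢0 k}} (subst₂ _∣ℤ_
        (pos-p^-+ {p} k n)
        (lemma (+ (p ^ k)) a b) h)
      where
      lemma : ∀ q a b → q ℤ.* a ℤ.- q ℤ.* b ≡ q ℤ.* (a ℤ.- b)
      lemma = solve-∀

  ≋-cancel : ∀ k → ϖ k ⊗ x ≋ ϖ k ⊗ y [ k ℕ.+ n ] → x ≋ y [ n ]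
  ≋-cancel {x} {y} {n} k h =
    ≋-trans (residue-const x n≤) (≋-trans (int-≋ (int-cancel k h′)) (≋-sym (residue-const y n≤)))
    where
    n≤ = ℕP.m≤n+m n k
    a = residue x (k ℕ.+ n)
    b = residue y (k ℕ.+ n)
    h′ : ϖ k ⊗ int a ≋ ϖ k ⊗ int b [ k ℕ.+ n ]
    h′ = ≋-trans (*-cong-≋ ≋-refl (≋-sym (residue-const x ℕP.≤-refl)))
      (≋-trans h (*-cong-≋ ≋-refl (residue-const y ℕP.≤-refl)))

  ≅-cancel : ∀ k → ϖ k ⊗ x ≅ ϖ k ⊗ y → x ≅ y
  ≅-cancel k h = ≋⇒≅ (λ n → ≋-cancel k (≅⇒≋ h))

  opaque
    -- Division costs k digits: residue n of the quotient is taken from residue k + n of x, and its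
    -- coherence is cancellation of pᵏ.
    divide : ∀ k → x ≋ 0ᶻ [ k ] → ∃[ y ] x ≅ ϖ k ⊗ y
    divide {x} k h = quot , ≋⇒≅ (λ n → ≋-trans (residue-const x (ℕP.m≤n+m n k))
        (≋-trans (≅⇒≋ (exact′ n)) (*-cong-≋ ≋-refl (≋-sym (residue-const quot ℕP.≤-refl)))))
      where
      divisible : ∀ n → + (p ^ k) ∣ℤ residue x (k ℕ.+ n)
      divisible n = subst (_ ∣ℤ_) (ℤP.+-identityʳ _)
        (≋-int (≋-trans (≋-sym (residue-const x (ℕP.m≤m+n k n))) h))
      q : ℕ → ℤ
      q n = _∣ℤ_.quotient (divisible n)
      exact : ∀ n → residue x (k ℕ.+ n) ≡ + (p ^ k) ℤ.* q n
      exact n = trans (_∣ℤ_.equality (divisible n)) (ℤP.*-comm (q n) _)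
      exact′ : ∀ n → int {p} (residue x (k ℕ.+ n)) ≅ ϖ k ⊗ int (q n)
      exact′ n = ≅-trans (≅-reflexive (cong int (exact n)))
        (≅-trans (int-⊗ _ _) (*-congʳ _ (≅-sym (ϖ-int k))))
      step : ∀ n → ϖ {p} k ⊗ int (q (suc n)) ≋ ϖ k ⊗ int (q n) [ k ℕ.+ n ]
      step n = ≋-trans (≅⇒≋ (≅-sym (exact′ (suc n))))
        (≋-trans (int-≋ (residue-≋ x (ℕP.+-monoʳ-≤ k (ℕP.n≤1+n n)))) (≅⇒≋ (exact′ n)))
      quot : ℤₚ p
      quot .residue = q
      quot .coherent n = int-cancel k (step n)

  digits : ℕ → ℤₚ p → ℕ
  digits n x = _%ℕ_ (residue x n) (p ^ n) {{p^≢0 n}}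

  digits-≋ : ∀ (x : ℤₚ p) n → x ≋ int (+ digits n x) [ n ]
  digits-≋ x n = ≋-trans (residue-const x ℕP.≤-refl) (int-≋ (divides (_/ℕ_ a (p ^ n) {{p^≢0 n}})
    (trans (cong (ℤ._- + digits n x) (ℤDM.a≡a%ℕn+[a/ℕn]*n a (p ^ n) {{p^≢0 n}}))
           (lemma (+ digits n x) _))))
    where
    a = residue x n
    lemma : ∀ r t → (r ℤ.+ t) ℤ.- r ≡ t
    lemma = solve-∀

  digits< : ∀ n (x : ℤₚ p) → digits n x < p ^ n
  digits< n x = ℤDM.n%ℕd<d (residue x n) (p ^ n) {{p^≢0 n}}

-- Uniqueness of remainders and quotients in ℤ

remainder-unique : ∀ {l r r′} → r < l → r′ < l → + l ∣ℤ + r ℤ.- + r′ → r ≡ r′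
remainder-unique {l} {r} {r′} r<l r′<l h =
  [ (λ r≤r′ → sym (ordered r′<l r≤r′ (subst (+ l ∣ℤ_) (negate (+ r) (+ r′)) (ℤD.∣m⇒∣-m h))))
  , (λ r′≤r → ordered r<l r′≤r h) ]′ (ℕP.≤-total r r′)
  where
  negate : ∀ a b → ℤ.- (a ℤ.- b) ≡ b ℤ.- a
  negate = solve-∀
  ordered : ∀ {m n} → m < l → n ≤ m → + l ∣ℤ + m ℤ.- + n → m ≡ n
  ordered {m} {n} m<l n≤m h
    with m ℕ.∸ n in eq
       | ℤD.∣⇒∣ᵤ (subst (+ l ∣ℤ_) (trans (ℤP.[+m]-[+n]≡m⊖n m n) (ℤP.⊖-≥ n≤m)) h)
  ... | zero  | _ = ℕP.≤-antisym (ℕP.m∸n≡0⇒m≤n eq) n≤m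
  ... | suc k | d = contradiction
    (ℕP.≤-trans (ℕD.∣⇒≤ d) (subst (_≤ m) eq (ℕP.m∸n≤m m n))) (ℕP.<⇒≱ m<l)

module _ (l : ℕ) .{{_ : NonZero l}} where

  %ℕ-unique : ∀ a {r} q → r < l → a ≡ + r ℤ.+ q ℤ.* + l → a %ℕ l ≡ r
  %ℕ-unique a {r} q r<l eq = remainder-unique (ℤDM.n%ℕd<d a l) r<l (divides (q ℤ.- a /ℕ l)
    (trans (solve (+ (a %ℕ l)) (a /ℕ l) (+ r) q (+ l) (trans (sym (ℤDM.a≡a%ℕn+[a/ℕn]*n a l)) eq)) refl))
    where
    lhs : ∀ x u m → (x ℤ.+ u ℤ.* m) ℤ.- u ℤ.* m ≡ x
    lhs = solve-∀
    rhs : ∀ y v u m → ((y ℤ.+ v ℤ.* m) ℤ.- u ℤ.* m) ℤ.- y ≡ (v ℤ.- u) ℤ.* m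
    rhs = solve-∀
    solve : ∀ x u y v m → x ℤ.+ u ℤ.* m ≡ y ℤ.+ v ℤ.* m → x ℤ.- y ≡ (v ℤ.- u) ℤ.* m
    solve x u y v m h = trans (cong (ℤ._- y) (trans (sym (lhs x u m)) (cong (ℤ._- u ℤ.* m) h)))
                              (rhs y v u m)

  /ℕ-unique : ∀ a {r} q → r < l → a ≡ + r ℤ.+ q ℤ.* + l → a /ℕ l ≡ q
  /ℕ-unique a {r} q r<l eq = ℤP.*-cancelʳ-≡ (a /ℕ l) q (+ l) (ℤG.∙-cancelˡ (+ r) _ _
    (trans (cong (λ t → + t ℤ.+ a /ℕ l ℤ.* + l) (sym (%ℕ-unique a q r<l eq)))
      (trans (sym (ℤDM.a≡a%ℕn+[a/ℕn]*n a l)) eq)))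

-- Fractions p⁻ᵏ z

module _ {p : ℕ} where

  infix 4 _~_[_]

  -- Reads X = p⁻ᵏ Z, cleared of denominators. With one k for all values of a function, computations
  -- take place among the integral representatives Z.
  _~_[_] : ℚₚ p → ℤₚ p → ℕ → Set
  X ~ Z [ k ] = ϖ k ⊗ num X ≅ ϖ (den X) ⊗ Z

  opaque
    unfolding _⊕_

    ^ᶻ≅↑ : ∀ (x : ℤₚ p) m → x ^ᶻ m ≅ x ↑ m
    ^ᶻ≅↑ x zero    = identity (λ _ → refl)
    ^ᶻ≅↑ x (suc m) = ≋⇒≅ λ n → congruent (difference (*-cong-≋ (≋-refl {x = x} {n}) (≅⇒≋ {n = n} (^ᶻ≅↑ x m))))

    -ᶻ≅⊖ : ∀ (x y : ℤₚ p) → x -ᶻ y ≅ x ⊖ y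
    -ᶻ≅⊖ x y = identity (λ _ → refl)

    fromℤ≅int : ∀ a → fromℤ a ≅ int {p} a
    fromℤ≅int a = identity (λ _ → refl)

    num-+ : ∀ (X Y : ℚₚ p) → num (X + Y) ≅ ϖ (den Y) ⊗ num X ⊕ ϖ (den X) ⊗ num Y
    num-+ X Y = identity (λ _ → refl)

    num-* : ∀ (X Y : ℚₚ p) → num (X * Y) ≅ num X ⊗ num Y
    num-* X Y = identity (λ _ → refl)

    num-shift : ∀ n (X : ℚₚ p) → num (shift (+ n) X) ≅ ϖ n ⊗ num X
    num-shift n X = identity (λ _ → refl)

    num-- : ∀ (X Y : ℚₚ p) → num (X - Y) ≅ ϖ (den Y) ⊗ num X ⊖ ϖ (den X) ⊗ num Y
    num-- X Y = identity (λ n → lemma (+ (p ^ den Y)) (residue (num X) n) (+ (p ^ den X)) (residue (num Y) n))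
      where
      lemma : ∀ a b c d → a ℤ.* b ℤ.+ c ℤ.* (ℤ.-1ℤ ℤ.* d) ≡ a ℤ.* b ℤ.+ ℤ.-1ℤ ℤ.* (c ℤ.* d)
      lemma = solve-∀

    ≈⇒≅ : ∀ {X Y : ℚₚ p} → X ≈ Y → ϖ (den Y) ⊗ num X ≅ ϖ (den X) ⊗ num Y
    ≈⇒≅ h = ≋⇒≅ (λ n → congruent (h n))

    ≅⇒≈ : ∀ {X Y : ℚₚ p} → ϖ (den Y) ⊗ num X ≅ ϖ (den X) ⊗ num Y → X ≈ Y
    ≅⇒≈ h n = difference (≅⇒≋ h)

    num-0ₚ : num (0ₚ {p}) ≅ 0ᶻ
    num-0ₚ = identity (λ _ → refl)

  ϖ-0 : ∀ (x : ℤₚ p) → ϖ 0 ⊗ x ≅ x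
  ϖ-0 x = ≅-trans (*-congʳ x (ϖ-int 0)) (*-identityˡ x)

  ≈0⇒ : ∀ {X : ℚₚ p} → X ≈ 0ₚ → num X ≅ 0ᶻ
  ≈0⇒ {X} h = ≅-trans (≅-sym (ϖ-0 _)) (≅-trans (≈⇒≅ {X} {0ₚ} h)
    (≅-trans (*-congˡ _ num-0ₚ) (*-zeroʳ _)))

  ⇒≈0 : ∀ {X : ℚₚ p} → num X ≅ 0ᶻ → X ≈ 0ₚ
  ⇒≈0 {X} h = ≅⇒≈ {X} {0ₚ} (≅-trans (*-congˡ _ h)
    (≅-trans (*-zeroʳ _) (≅-sym (≅-trans (*-congˡ _ num-0ₚ) (*-zeroʳ _)))))

  ∈p^⇒ : ∀ {X : ℚₚ p} {m} → X ∈p^ m → num X ≋ 0ᶻ [ den X ℕ.+ m ]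
  ∈p^⇒ = ∣⇒≋0

  ⇒∈p^ : ∀ {X : ℚₚ p} {m} → num X ≋ 0ᶻ [ den X ℕ.+ m ] → X ∈p^ m
  ⇒∈p^ = ≋0⇒∣

module _ {p : ℕ} .{{_ : NonZero p}} where

  private variable
    x y z u u′ : ℤₚ p
    m n k : ℕ

  digits-cong : x ≋ y [ n ] → digits n x ≡ digits n y
  digits-cong {x} {y} {n} h = remainder-unique (digits< n x) (digits< n y)
    (≋-int (≋-trans (≋-sym (digits-≋ x n)) (≋-trans h (digits-≋ y n))))

  digits-injective : digits n x ≡ digits n y → x ≋ y [ n ]
  digits-injective {n} {x} {y} eq = ≋-trans (digits-≋ x n)
    (subst (λ r → int (+ r) ≋ y [ n ]) (sym eq) (≋-sym (digits-≋ y n)))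

  ~-mono : ∀ {X : ℚₚ p} k → X ~ z [ n ] → X ~ ϖ k ⊗ z [ k ℕ.+ n ]
  ~-mono {z} {n} {X} k h = begin
    ϖ (k ℕ.+ n) ⊗ num X        ≈⟨ ϖ-+-* k n (num X) ⟩
    ϖ k ⊗ (ϖ n ⊗ num X)        ≈⟨ *-congˡ (ϖ k) h ⟩
    ϖ k ⊗ (ϖ (den X) ⊗ z)      ≈⟨ *-swap (ϖ k) (ϖ (den X)) z ⟩
    ϖ (den X) ⊗ (ϖ k ⊗ z)      ∎
    where open SetoidReasoning ≅-setoid

  ~-cong : ∀ {X : ℚₚ p} → x ≅ y → X ~ x [ n ] → X ~ y [ n ]
  ~-cong {X = X} e h = ≅-trans h (*-congˡ (ϖ (den X)) e)

  ~-≈ : ∀ {X Y : ℚₚ p} → X ≈ Y → Y ~ z [ n ] → X ~ z [ n ]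
  ~-≈ {z} {n} {X} {Y} e h = ≅-cancel (den Y) (begin
    ϖ (den Y) ⊗ (ϖ n ⊗ num X)     ≈⟨ *-swap _ _ _ ⟩
    ϖ n ⊗ (ϖ (den Y) ⊗ num X)     ≈⟨ *-congˡ (ϖ n) (≈⇒≅ {X = X} {Y} e) ⟩
    ϖ n ⊗ (ϖ (den X) ⊗ num Y)     ≈⟨ *-swap _ _ _ ⟩
    ϖ (den X) ⊗ (ϖ n ⊗ num Y)     ≈⟨ *-congˡ (ϖ (den X)) h ⟩
    ϖ (den X) ⊗ (ϖ (den Y) ⊗ z)   ≈⟨ *-swap _ _ _ ⟩
    ϖ (den Y) ⊗ (ϖ (den X) ⊗ z)   ∎)
    where open SetoidReasoning ≅-setoid

  ~⇒≈ : ∀ {X Y : ℚₚ p} → X ~ z [ n ] → Y ~ z [ n ] → X ≈ Y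
  ~⇒≈ {z} {n} {X} {Y} h h′ = ≅⇒≈ {X = X} {Y} (≅-cancel n (begin
    ϖ n ⊗ (ϖ (den Y) ⊗ num X)     ≈⟨ *-swap _ _ _ ⟩
    ϖ (den Y) ⊗ (ϖ n ⊗ num X)     ≈⟨ *-congˡ (ϖ (den Y)) h ⟩
    ϖ (den Y) ⊗ (ϖ (den X) ⊗ z)   ≈⟨ *-swap _ _ _ ⟩
    ϖ (den X) ⊗ (ϖ (den Y) ⊗ z)   ≈⟨ *-congˡ (ϖ (den X)) h′ ⟨
    ϖ (den X) ⊗ (ϖ n ⊗ num Y)     ≈⟨ *-swap _ _ _ ⟩
    ϖ n ⊗ (ϖ (den X) ⊗ num Y)     ∎))
    where open SetoidReasoning ≅-setoid

  ~-* : ∀ {X Y : ℚₚ p} → X ~ x [ m ] → Y ~ y [ n ] → X * Y ~ x ⊗ y [ m ℕ.+ n ]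
  ~-* {x} {m} {y} {n} {X} {Y} h h′ = begin
    ϖ (m ℕ.+ n) ⊗ num (X * Y)                   ≈⟨ *-cong (ϖ-+ m n) (num-* X Y) ⟩
    (ϖ m ⊗ ϖ n) ⊗ (num X ⊗ num Y)               ≈⟨ *-interchange _ _ _ _ ⟩
    (ϖ m ⊗ num X) ⊗ (ϖ n ⊗ num Y)               ≈⟨ *-cong h h′ ⟩
    (ϖ (den X) ⊗ x) ⊗ (ϖ (den Y) ⊗ y)           ≈⟨ *-interchange _ _ _ _ ⟩
    (ϖ (den X) ⊗ ϖ (den Y)) ⊗ (x ⊗ y)           ≈⟨ *-congʳ _ (ϖ-+ (den X) (den Y)) ⟨
    ϖ (den X ℕ.+ den Y) ⊗ (x ⊗ y)               ∎
    where open SetoidReasoning ≅-setoid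

  ~-+ : ∀ {X Y : ℚₚ p} → X ~ x [ n ] → Y ~ y [ n ] → X + Y ~ x ⊕ y [ n ]
  ~-+ {x} {n} {y} {X} {Y} h h′ = begin
    ϖ n ⊗ num (X + Y)                                           ≈⟨ *-congˡ (ϖ n) (num-+ X Y) ⟩
    ϖ n ⊗ (ϖ (den Y) ⊗ num X ⊕ ϖ (den X) ⊗ num Y)               ≈⟨ *-distrib-+ _ _ _ ⟩
    ϖ n ⊗ (ϖ (den Y) ⊗ num X) ⊕ ϖ n ⊗ (ϖ (den X) ⊗ num Y)       ≈⟨ +-cong (*-swap _ _ _) (*-swap _ _ _) ⟩
    ϖ (den Y) ⊗ (ϖ n ⊗ num X) ⊕ ϖ (den X) ⊗ (ϖ n ⊗ num Y)       ≈⟨ +-cong (*-congˡ _ h) (*-congˡ _ h′) ⟩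
    ϖ (den Y) ⊗ (ϖ (den X) ⊗ x) ⊕ ϖ (den X) ⊗ (ϖ (den Y) ⊗ y)   ≈⟨ +-cong (*-swap _ _ _) ≅-refl ⟩
    ϖ (den X) ⊗ (ϖ (den Y) ⊗ x) ⊕ ϖ (den X) ⊗ (ϖ (den Y) ⊗ y)   ≈⟨ +-cong (ϖ-+-* _ _ x) (ϖ-+-* _ _ y) ⟨
    ϖ (den X ℕ.+ den Y) ⊗ x ⊕ ϖ (den X ℕ.+ den Y) ⊗ y           ≈⟨ *-distrib-+ _ _ _ ⟨
    ϖ (den X ℕ.+ den Y) ⊗ (x ⊕ y)                               ∎
    where open SetoidReasoning ≅-setoid

  ~-- : ∀ {X Y : ℚₚ p} → X ~ x [ n ] → Y ~ y [ n ] → X - Y ~ x ⊖ y [ n ]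
  ~-- {x} {n} {y} {X} {Y} h h′ = begin
    ϖ n ⊗ num (X - Y)                                           ≈⟨ *-congˡ (ϖ n) (num-- X Y) ⟩
    ϖ n ⊗ (ϖ (den Y) ⊗ num X ⊖ ϖ (den X) ⊗ num Y)               ≈⟨ *-distrib-- _ _ _ ⟩
    ϖ n ⊗ (ϖ (den Y) ⊗ num X) ⊖ ϖ n ⊗ (ϖ (den X) ⊗ num Y)       ≈⟨ -‿cong (*-swap _ _ _) (*-swap _ _ _) ⟩
    ϖ (den Y) ⊗ (ϖ n ⊗ num X) ⊖ ϖ (den X) ⊗ (ϖ n ⊗ num Y)       ≈⟨ -‿cong (*-congˡ _ h) (*-congˡ _ h′) ⟩
    ϖ (den Y) ⊗ (ϖ (den X) ⊗ x) ⊖ ϖ (den X) ⊗ (ϖ (den Y) ⊗ y)   ≈⟨ -‿cong (*-swap _ _ _) ≅-refl ⟩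
    ϖ (den X) ⊗ (ϖ (den Y) ⊗ x) ⊖ ϖ (den X) ⊗ (ϖ (den Y) ⊗ y)   ≈⟨ -‿cong (ϖ-+-* _ _ x) (ϖ-+-* _ _ y) ⟨
    ϖ (den X ℕ.+ den Y) ⊗ x ⊖ ϖ (den X ℕ.+ den Y) ⊗ y           ≈⟨ *-distrib-- _ _ _ ⟨
    ϖ (den X ℕ.+ den Y) ⊗ (x ⊖ y)
      ≈⟨ *-congʳ _ (≅-reflexive (cong (λ k → ϖ k) (sym den≡))) ⟩
    ϖ (den (X - Y)) ⊗ (x ⊖ y)                               ∎
    where
    open SetoidReasoning ≅-setoid
    den≡ : den (X - Y) ≡ den X ℕ.+ den Y
    den≡ = refl

  ~-ι : ι z ~ z [ 0 ]
  ~-ι = ≅-refl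

  ~-/p^ : (z /p^ n) ~ z [ n ]
  ~-/p^ = ≅-refl

  ~-num : ∀ (X : ℚₚ p) → X ~ num X [ den X ]
  ~-num X = ≅-refl

  private
    rotate : ∀ a b c → a ℕ.+ (b ℕ.+ c) ≡ b ℕ.+ (a ℕ.+ c)
    rotate a b c = trans (sym (ℕP.+-assoc a b c))
      (trans (cong (ℕ._+ c) (ℕP.+-comm a b)) (ℕP.+-assoc b a c))

  ~⇒∈p^ : ∀ {X : ℚₚ p} → X ~ x [ n ] → x ≋ 0ᶻ [ n ℕ.+ m ] → X ∈p^ m
  ~⇒∈p^ {x} {n} {m} {X} h e = ⇒∈p^ {X = X} (≋-cancel n (≋-trans (≅⇒≋ h)
    (≋-trans (≋-level (rotate (den X) n m) (≋-+ (den X) e)) (≅⇒≋ (*-zero-irrelevant _ _)))))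

  ∈p^⇒~ : ∀ {X : ℚₚ p} → X ~ x [ n ] → X ∈p^ m → x ≋ 0ᶻ [ n ℕ.+ m ]
  ∈p^⇒~ {x} {n} {m} {X} h e = ≋-cancel (den X) (≋-trans (≅⇒≋ (≅-sym h))
    (≋-trans (≋-level (rotate n (den X) m) (≋-+ n (∈p^⇒ {X = X} {m} e)))
             (≅⇒≋ (*-zero-irrelevant _ _))))

  ~⇒≈0 : ∀ {X : ℚₚ p} → X ~ x [ n ] → x ≅ 0ᶻ → X ≈ 0ₚ
  ~⇒≈0 {n = n} {X} h e = ⇒≈0 {X = X} (≅-cancel n
    (≅-trans h (≅-trans (*-congˡ _ e) (*-zero-irrelevant _ _))))

  ≈0⇒~ : ∀ {X : ℚₚ p} → X ~ x [ n ] → X ≈ 0ₚ → x ≅ 0ᶻ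
  ≈0⇒~ {X = X} h e = ≅-cancel (den X) (≅-trans (≅-sym h)
    (≅-trans (*-congˡ _ (≈0⇒ {X = X} e)) (*-zero-irrelevant _ _)))

-- Units, valuations and last nonzero digits

Unit : ∀ {p} → ℤₚ p → Set
Unit u = ¬ (u ≋ 0ᶻ [ 1 ])

module _ {p : ℕ} .{{_ : NonZero p}} (prime : Prime p) where

  private variable
    x y z u v : ℤₚ p
    m n k : ℕ

  Unit-cong : 1 ≤ n → u ≋ v [ n ] → Unit u → Unit v
  Unit-cong 1≤n h unit v≋0 = unit (≋-trans (≋-down 1≤n h) v≋0)

  private
    ≋0⇒∣ᵤ : x ≋ 0ᶻ [ 1 ] → p ℕD.∣ ℤ.∣ residue x 1 ∣
    ≋0⇒∣ᵤ {x} h = subst (ℕD._∣ ℤ.∣ residue x 1 ∣) (ℕP.^-identityʳ p) (ℤD.∣⇒∣ᵤ (≋0⇒∣ h))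

    ∣ᵤ⇒≋0 : p ℕD.∣ ℤ.∣ residue x 1 ∣ → x ≋ 0ᶻ [ 1 ]
    ∣ᵤ⇒≋0 {x} h = ∣⇒≋0 (ℤD.∣ᵤ⇒∣ (subst (ℕD._∣ ℤ.∣ residue x 1 ∣) (sym (ℕP.^-identityʳ p)) h))

  p>1 : 1 < p
  p>1 = ℕ.nonTrivial⇒n>1 p {{prime⇒nonTrivial prime}}

  1-unit : Unit {p} 1ᶻ
  1-unit h = ℕP.<⇒≱ p>1 (ℕD.∣⇒≤ (subst (λ a → p ℕD.∣ ℤ.∣ a ∣) (residue-int 1ℤ 1) (≋0⇒∣ᵤ h)))

  Unit-⊗ : Unit u → Unit v → Unit (u ⊗ v)
  Unit-⊗ {u} {v} unit unit′ h = [ unit ∘ ∣ᵤ⇒≋0 , unit′ ∘ ∣ᵤ⇒≋0 ]′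
    (euclidsLemma ℤ.∣ residue u 1 ∣ ℤ.∣ residue v 1 ∣ prime
      (subst (p ℕD.∣_) (trans (cong ℤ.∣_∣ (residue-⊗ u v 1)) (ℤP.abs-* (residue u 1) (residue v 1)))
        (≋0⇒∣ᵤ h)))

  Unit-↑ : ∀ m → Unit u → Unit (u ↑ m)
  Unit-↑ zero    unit = 1-unit
  Unit-↑ (suc m) unit = Unit-⊗ unit (Unit-↑ m unit)

  private
    non-unit⇒≋0 : ∀ y → ¬ Unit y → y ≋ 0ᶻ [ 1 ]
    non-unit⇒≋0 y h with p ℕD.∣? ℤ.∣ residue y 1 ∣
    ... | yes d = ∣ᵤ⇒≋0 d
    ... | no ¬d = contradiction (¬d ∘ ≋0⇒∣ᵤ) h

  -- Induction on m, one digit at a time: if x = pᵐ y, then u y vanishes modulo p, and so does y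
  -- because p is prime.
  unit-cancel-0 : Unit u → u ⊗ x ≋ 0ᶻ [ n ] → ∀ m → m ≤ n → x ≋ 0ᶻ [ m ]
  unit-cancel-0 unit h zero _ = ≋-zero
  unit-cancel-0 {u} {x} {n} unit h (suc m) m<n = go (divide m (unit-cancel-0 unit h m (ℕP.<⇒≤ m<n)))
    where
    go : ∃[ y ] x ≅ ϖ m ⊗ y → x ≋ 0ᶻ [ suc m ]
    go (y , e) = subst (λ k → x ≋ 0ᶻ [ k ]) (ℕP.+-comm m 1) (begin
      x            ≈⟨ ≅⇒≋ e ⟩
      ϖ m ⊗ y      ≈⟨ ≋-+ m (non-unit⇒≋0 y (λ y-unit → Unit-⊗ unit y-unit (≋-cancel m uy≋0))) ⟩
      ϖ m ⊗ 0ᶻ     ≈⟨ ≅⇒≋ (*-zeroʳ (ϖ m)) ⟩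
      0ᶻ           ∎)
      where
      open SetoidReasoning (≋-setoid (m ℕ.+ 1))
      uy≋0 : ϖ m ⊗ (u ⊗ y) ≋ ϖ m ⊗ 0ᶻ [ m ℕ.+ 1 ]
      uy≋0 = begin
        ϖ m ⊗ (u ⊗ y)  ≈⟨ ≅⇒≋ (*-swap (ϖ m) u y) ⟩
        u ⊗ (ϖ m ⊗ y)  ≈⟨ ≅⇒≋ (*-congˡ u e) ⟨
        u ⊗ x          ≈⟨ ≋-down (subst (_≤ n) (ℕP.+-comm 1 m) m<n) h ⟩
        0ᶻ             ≈⟨ ≅⇒≋ (*-zeroʳ (ϖ m)) ⟨
        ϖ m ⊗ 0ᶻ       ∎

  unit-cancel : Unit u → u ⊗ x ≋ u ⊗ y [ n ] → x ≋ y [ n ]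
  unit-cancel {u} {x} {y} {n} unit h = -≋0⇒≋ (unit-cancel-0 unit
    (≋-trans (≅⇒≋ (*-distrib-- u x y)) (≋⇒-≋0 h)) n ℕP.≤-refl)

  ϖ-unit-≢0 : Unit u → k < n → ¬ (ϖ k ⊗ u ≋ 0ᶻ [ n ])
  ϖ-unit-≢0 {u} {k} {n} unit k<n h = unit (≋-cancel k (≋-trans
    (≋-down (subst (_≤ n) (ℕP.+-comm 1 k) k<n) h) (≅⇒≋ (≅-sym (*-zeroʳ _)))))

  -- Modulo the larger of pᵏ and pᵐ only one side would vanish. Equality of digits yields such
  -- congruences rather than equalities in ℤₚ.
  valuation-unique-≋ : Unit u → Unit v → k < n → m < n → ϖ k ⊗ u ≋ ϖ m ⊗ v [ n ] → k ≡ m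
  valuation-unique-≋ {k = k} {m = m} unit unit′ k<n m<n h with ℕP.<-cmp k m
  ... | tri< k<m _ _ = ⊥-elim (ϖ-unit-≢0 unit k<m (≋-trans (≋-down (ℕP.<⇒≤ m<n) h) (ϖ-≋0 _ ℕP.≤-refl)))
  ... | tri≈ _ k≡m _ = k≡m
  ... | tri> _ _ m<k = ⊥-elim (ϖ-unit-≢0 unit′ m<k
    (≋-trans (≋-down (ℕP.<⇒≤ k<n) (≋-sym h)) (ϖ-≋0 _ ℕP.≤-refl)))

  valuation-unique : Unit u → Unit v → ϖ k ⊗ u ≅ ϖ m ⊗ v → k ≡ m
  valuation-unique {k = k} {m} unit unit′ h =
    valuation-unique-≋ unit unit′ (ℕ.s≤s (ℕP.m≤m+n k m)) (ℕ.s≤s (ℕP.m≤n+m m k)) (≅⇒≋ h)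

  Unit⇒Coprime : ∀ u n → Unit {p} u → 1 ≤ n → ℤC.Coprime (residue u n) (+ (p ^ n))
  Unit⇒Coprime u n unit 1≤n {d} (d∣u , d∣pⁿ) = go n d∣pⁿ λ p∣d → unit (≋-trans
    (residue-const u 1≤n) (∣⇒≋0 (subst (+ (p ^ 1) ∣ℤ_) (sym (residue-int (residue u n) 1))
      (ℤD.∣ᵤ⇒∣ (subst (ℕD._∣ _) (sym (ℕP.^-identityʳ p)) (ℕD.∣-trans p∣d d∣u))))))
    where
    go : ∀ n {d} → d ℕD.∣ p ^ n → ¬ (p ℕD.∣ d) → d ≡ 1
    go zero    d∣1 _ = ℕD.∣1⇒≡1 d∣1
    go (suc n) d∣ p∤d = go n (ℕC.coprime-divisor (λ { (c∣d , c∣p) →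
      [ (λ c≡1 → c≡1) , (λ { refl → contradiction c∣d p∤d }) ]′ (prime⇒irreducible prime c∣p) }) d∣) p∤d

  Coprime⇒Unit : ∀ a n → 1 ≤ n → ℤC.Coprime a (+ (p ^ n)) → Unit {p} (int a)
  Coprime⇒Unit a (suc n) _ c h = ℕP.<⇒≢ p>1 (sym (c
    ( subst (λ a → p ℕD.∣ ℤ.∣ a ∣) (residue-int a 1) (≋0⇒∣ᵤ h)
    , ℕD.m∣m*n (p ^ n))))

module _ (em : ExcludedMiddle 0ℓ) {p : ℕ} .{{_ : NonZero p}} (prime : Prime p) where

  open Digits em

  private variable
    x y u : ℤₚ p

  opaque
    valuation : ¬ (x ≅ 0ᶻ) → ∃[ k ] ∃[ u ] (x ≅ ϖ k ⊗ u × Unit u)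
    valuation {x} x≇0 = from-least (least em (λ n → ¬ (x ≋ 0ᶻ [ suc n ])) nonzero)
      where
      nonzero : ∃[ n ] ¬ (x ≋ 0ᶻ [ suc n ])
      nonzero = decidable-stable em λ none → x≇0 (≋⇒≅ λ
        { zero → ≋-zero ; (suc n) → decidable-stable em (λ h → none (n , h)) })
      zero-below : ∀ n → (∀ m → ¬ (x ≋ 0ᶻ [ suc m ]) → n ≤ m) → x ≋ 0ᶻ [ n ]
      zero-below zero    _ = ≋-zero
      zero-below (suc n) minimal = decidable-stable em (λ h → ℕP.<⇒≱ (ℕP.n<1+n n) (minimal n h))
      from-least : ∃ (IsLeast (λ n → ¬ (x ≋ 0ᶻ [ suc n ]))) → ∃[ k ] ∃[ u ] (x ≅ ϖ k ⊗ u × Unit u)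
      from-least (n , x≢0 , minimal) with y , e ← divide n (zero-below n minimal) =
        n , y , e , λ y≋0 → x≢0 (≋-trans (≅⇒≋ e)
          (≋-trans (≋-level (ℕP.+-comm n 1) (≋-+ n y≋0)) (≅⇒≋ (*-zeroʳ _))))

  nonzero-⊗ : ¬ (x ≅ 0ᶻ) → ¬ (y ≅ 0ᶻ) → ¬ (x ⊗ y ≅ 0ᶻ)
  nonzero-⊗ {x} {y} x≇0 y≇0 h
    with j , u , eu , unit  ← valuation x≇0
       | k , v , ev , unit′ ← valuation y≇0 =
    ϖ-unit-≢0 prime (Unit-⊗ prime unit unit′) (ℕP.n<1+n (j ℕ.+ k)) (≅⇒≋ (begin
      ϖ (j ℕ.+ k) ⊗ (u ⊗ v)       ≈⟨ *-congʳ _ (ϖ-+ j k) ⟩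
      (ϖ j ⊗ ϖ k) ⊗ (u ⊗ v)       ≈⟨ *-interchange _ _ _ _ ⟩
      (ϖ j ⊗ u) ⊗ (ϖ k ⊗ v)       ≈⟨ *-cong eu ev ⟨
      x ⊗ y                       ≈⟨ h ⟩
      0ᶻ                          ∎))
    where open SetoidReasoning ≅-setoid

  ⊗-cancelˡ : ¬ (x ≅ 0ᶻ) → ∀ {y z} → x ⊗ y ≅ x ⊗ z → y ≅ z
  ⊗-cancelˡ {x} x≇0 {y} {z} h = -≅0⇒≅ (decidable-stable em λ y-z≇0 →
    nonzero-⊗ x≇0 y-z≇0 (≅-trans (*-distrib-- x y z) (≅⇒-≅0 h)))

  opaque
    ν-spec : ∀ (X : ℚₚ p) (X≉0 : ¬ (X ≈ 0ₚ)) → ∃[ k ] ∃[ u ]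
      (ν X X≉0 ≡ + k ℤ.- + den X × num X ≅ ϖ k ⊗ u × Unit u)
    ν-spec X X≉0 = extract (proj₂ (least em _ _)) (valuation (X≉0 ∘ ⇒≈0 {X = X})) refl
      where
      extract : ∀ {k n} → IsLeast (λ n → ¬ (+ (p ^ suc n) ∣ℤ residue (num X) (suc n))) k →
        ∃[ j ] ∃[ u ] (num X ≅ ϖ j ⊗ u × Unit u) → n ≡ + k ℤ.- + den X →
        ∃[ j ] ∃[ u ] (n ≡ + j ℤ.- + den X × num X ≅ ϖ j ⊗ u × Unit u)
      extract {k} (¬div , minimal) (j , u , e , unit) eq =
        j , u , trans eq (cong (λ k → + k ℤ.- + den X) (ℕP.≤-antisym k≤j j≤k)) , e , unit
        where
        k≤j : k ≤ j
        k≤j = minimal j λ h → ϖ-unit-≢0 prime unit (ℕP.n<1+n j)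
          (≋-trans (≅⇒≋ (≅-sym e)) (∣⇒≋0 {x = num X} h))
        j≤k : j ≤ k
        j≤k = ℕP.≮⇒≥ λ k<j → ¬div (≋0⇒∣ {x = num X} (≋-trans (≅⇒≋ e) (ϖ-≋0 u k<j)))

  ν-~ : ∀ {X : ℚₚ p} (X≉0 : ¬ (X ≈ 0ₚ)) {v n} → X ~ ϖ v ⊗ u [ n ] → Unit u →
    ν X X≉0 ≡ + v ℤ.- + n
  ν-~ {u} {X} X≉0 {v} {n} h unit = from-spec (ν-spec X X≉0)
    where
    open SetoidReasoning ≅-setoid
    valuations : ∀ {k w} → num X ≅ ϖ k ⊗ w → Unit w → n ℕ.+ k ≡ den X ℕ.+ v
    valuations {k} {w} e unit′ = valuation-unique prime unit′ unit (begin
      ϖ (n ℕ.+ k) ⊗ w          ≈⟨ ϖ-+-* n k w ⟩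
      ϖ n ⊗ (ϖ k ⊗ w)          ≈⟨ *-congˡ (ϖ n) e ⟨
      ϖ n ⊗ num X              ≈⟨ h ⟩
      ϖ (den X) ⊗ (ϖ v ⊗ u)    ≈⟨ ϖ-+-* (den X) v u ⟨
      ϖ (den X ℕ.+ v) ⊗ u      ∎)
    lhs : ∀ k d n → k ℤ.- d ≡ (n ℤ.+ k) ℤ.- (n ℤ.+ d)
    lhs = solve-∀
    rhs : ∀ d v n → (d ℤ.+ v) ℤ.- (n ℤ.+ d) ≡ v ℤ.- n
    rhs = solve-∀
    rearrange : ∀ k d v n → n ℤ.+ k ≡ d ℤ.+ v → k ℤ.- d ≡ v ℤ.- n
    rearrange k d v n eq = trans (lhs k d n) (trans (cong (ℤ._- (n ℤ.+ d)) eq) (rhs d v n))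
    from-spec : ∀ {i} → ∃[ k ] ∃[ w ] (i ≡ + k ℤ.- + den X × num X ≅ ϖ k ⊗ w × Unit w) → i ≡ + v ℤ.- + n
    from-spec (k , w , ν≡ , e , unit′) = trans ν≡ (rearrange (+ k) (+ den X) (+ v) (+ n)
      (trans (sym (ℤP.pos-+ n k)) (trans (cong +_ (valuations e unit′)) (ℤP.pos-+ (den X) v))))

  module _ (l : ℕ) .{{_ : NonZero l}} where

    private
      split : ∀ v c → + v ℤ.- + (l ℕ.* c) ≡ + (v ℕ.% l) ℤ.+ (+ (v ℕ./ l) ℤ.- + c) ℤ.* + l
      split v c = trans (cong₂ ℤ._-_
          (trans (cong +_ (ℕDM.m≡m%n+[m/n]*n v l))
            (trans (ℤP.pos-+ (v ℕ.% l) _) (cong (λ t → + (v ℕ.% l) ℤ.+ t) (ℤP.pos-* (v ℕ./ l) l))))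
          (ℤP.pos-* l c))
        (ring (+ (v ℕ.% l)) (+ (v ℕ./ l)) (+ l) (+ c))
        where
        ring : ∀ r q l c → (r ℤ.+ q ℤ.* l) ℤ.- l ℤ.* c ≡ r ℤ.+ (q ℤ.- c) ℤ.* l
        ring = solve-∀

    -- The denominator exponent is a multiple of l, so it shifts the quotient of the valuation by l
    -- and leaves the remainder alone.
    ν-%ℕ : ∀ {X : ℚₚ p} (X≉0 : ¬ (X ≈ 0ₚ)) {v c} → X ~ ϖ v ⊗ u [ l ℕ.* c ] → Unit u →
      ν X X≉0 %ℕ l ≡ v ℕ.% l
    ν-%ℕ X≉0 {v} {c} h unit = trans (cong (_%ℕ l) (ν-~ X≉0 {v} {l ℕ.* c} h unit)) $
      %ℕ-unique l _ (+ (v ℕ./ l) ℤ.- + c) (ℕDM.m%n<n v l) (split v c)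

    ν-/ℕ : ∀ {X : ℚₚ p} (X≉0 : ¬ (X ≈ 0ₚ)) {v c} → X ~ ϖ v ⊗ u [ l ℕ.* c ] → Unit u →
      ν X X≉0 /ℕ l ≡ + (v ℕ./ l) ℤ.- + c
    ν-/ℕ X≉0 {v} {c} h unit = trans (cong (_/ℕ l) (ν-~ X≉0 {v} {l ℕ.* c} h unit)) $
      /ℕ-unique l _ (+ (v ℕ./ l) ℤ.- + c) (ℕDM.m%n<n v l) (split v c)

  mod-p^-char : ∀ (Z : ℚₚ p) {Y} m → num Z ≅ ϖ (den Z) ⊗ Y → Z mod-p^ m ≡ digits m Y
  mod-p^-char Z {Y} m h =
    trans (cong (λ a → _%ℕ_ a (p ^ m) {{p^≢0 m}}) (trans quot≡ (sym (residue-int q m))))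
      (digits-cong (≋-trans (int-≋ (divides t (difference-multiple b t (+ (p ^ m)))))
        (≋-sym (residue-const Y (ℕP.m≤n+m m d)))))
    where
    d = den Z
    b = residue Y (d ℕ.+ m)
    level : + (p ^ (d ℕ.+ m)) ∣ℤ residue (num Z) (d ℕ.+ m) ℤ.- + (p ^ d) ℤ.* b
    level = ≋-int (≋-trans (≋-sym (residue-const (num Z) ℕP.≤-refl)) (≋-trans (≅⇒≋ h)
      (≋-trans (*-cong-≋ (≅⇒≋ (ϖ-int d)) (residue-const Y ℕP.≤-refl)) (≅⇒≋ (≅-sym (int-⊗ _ _))))))
    t = _∣ℤ_.quotient level
    -- At level d + m the numerator is pᵈ b + t p^(d+m), so the rounding quotient by pᵈ is exactly
    -- q, which agrees with b modulo pᵐ.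
    q = b ℤ.+ t ℤ.* + (p ^ m)
    difference-multiple : ∀ r t m → (r ℤ.+ t ℤ.* m) ℤ.- r ≡ t ℤ.* m
    difference-multiple = solve-∀
    factor : ∀ c b t m → t ℤ.* (c ℤ.* m) ℤ.+ c ℤ.* b ≡ 0ℤ ℤ.+ (b ℤ.+ t ℤ.* m) ℤ.* c
    factor = solve-∀
    add-back : ∀ a c → a ≡ (a ℤ.- c) ℤ.+ c
    add-back = solve-∀
    quot≡ : _/ℕ_ (residue (num Z) (d ℕ.+ m)) (p ^ d) {{p^≢0 d}} ≡ q
    quot≡ = /ℕ-unique (p ^ d) {{p^≢0 d}} (residue (num Z) (d ℕ.+ m)) q (ℕ.>-nonZero⁻¹ (p ^ d) {{p^≢0 d}})
      (trans (add-back (residue (num Z) (d ℕ.+ m)) (+ (p ^ d) ℤ.* b)) (trans (cong (ℤ._+ + (p ^ d) ℤ.* b)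
        (trans (_∣ℤ_.equality level) (cong (t ℤ.*_) (pos-p^-+ {p} d m))))
        (factor (+ (p ^ d)) b t (+ (p ^ m)))))

  -- `shift` enlarges the numerator or the denominator according to the sign of k. Writing k as a -
  -- b gives both cases one hypothesis with natural exponents.
  num-shift-char : ∀ (X : ℚₚ p) {Y} k a b → k ≡ + a ℤ.- + b →
    ϖ a ⊗ num X ≅ ϖ (b ℕ.+ den X) ⊗ Y → num (shift k X) ≅ ϖ (den (shift k X)) ⊗ Y
  num-shift-char X {Y} (+ n) a b eq h = ≅-cancel b (begin
    ϖ b ⊗ num (shift (+ n) X)    ≈⟨ *-congˡ (ϖ b) (num-shift n X) ⟩
    ϖ b ⊗ (ϖ n ⊗ num X)          ≈⟨ ϖ-+-* b n (num X) ⟨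
    ϖ (b ℕ.+ n) ⊗ num X          ≈⟨ *-congʳ (num X) (≅-reflexive (cong ϖ b+n≡a)) ⟩
    ϖ a ⊗ num X                  ≈⟨ h ⟩
    ϖ (b ℕ.+ den X) ⊗ Y          ≈⟨ ϖ-+-* b (den X) Y ⟩
    ϖ b ⊗ (ϖ (den X) ⊗ Y)        ∎)
    where
    open SetoidReasoning ≅-setoid
    ring : ∀ a b → b ℤ.+ (a ℤ.- b) ≡ a
    ring = solve-∀
    b+n≡a : b ℕ.+ n ≡ a
    b+n≡a = ℤP.+-injective (trans (ℤP.pos-+ b n)
      (trans (cong (λ t → + b ℤ.+ t) eq) (ring (+ a) (+ b))))
  num-shift-char X {Y} -[1+ n ] a b eq h = ≅-cancel a (begin
    ϖ a ⊗ num X                          ≈⟨ h ⟩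
    ϖ (b ℕ.+ den X) ⊗ Y                  ≈⟨ *-congʳ Y (≅-reflexive (cong (λ k → ϖ (k ℕ.+ den X)) b≡)) ⟩
    ϖ (a ℕ.+ suc n ℕ.+ den X) ⊗ Y        ≈⟨ *-congʳ Y (≅-reflexive (cong ϖ (trans
      (ℕP.+-assoc a (suc n) (den X)) (cong (a ℕ.+_) (ℕP.+-comm (suc n) (den X)))))) ⟩
    ϖ (a ℕ.+ (den X ℕ.+ suc n)) ⊗ Y      ≈⟨ ϖ-+-* a (den X ℕ.+ suc n) Y ⟩
    ϖ a ⊗ (ϖ (den X ℕ.+ suc n) ⊗ Y)      ∎)
    where
    open SetoidReasoning ≅-setoid
    ring : ∀ a b → b ≡ a ℤ.+ ℤ.- (a ℤ.- b)
    ring = solve-∀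
    b≡ : b ≡ a ℕ.+ suc n
    b≡ = ℤP.+-injective (trans (ring (+ a) (+ b))
      (trans (cong (λ t → + a ℤ.+ ℤ.- t) (sym eq)) (sym (ℤP.pos-+ a (suc n)))))

  module _ (l : ℕ) .{{_ : NonZero l}} where

    𝓛-elim : ∀ (P : ℚₚ p → Set) X → (X ≈ 0ₚ → P 0ₚ) →
      ((X≉0 : ¬ (X ≈ 0ₚ)) → P (shift (ℤ.- (+ l ℤ.* (ν X X≉0 /ℕ l))) X)) → P (𝓛 l X)
    𝓛-elim P X z nz with em {X ≈ 0ₚ}
    ... | yes X≈0 = z X≈0
    ... | no X≉0  = nz X≉0

    ℓ-zero : ∀ d (X : ℚₚ p) → X ≈ 0ₚ → ℓ l d X ≡ 0ₚ {p} mod-p^ (l ℕ.* d)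
    ℓ-zero d X X≈0 = 𝓛-elim (λ Z → Z mod-p^ (l ℕ.* d) ≡ 0ₚ {p} mod-p^ (l ℕ.* d)) X
      (λ _ → refl) (λ X≉0 → contradiction X≈0 X≉0)

    -- The valuation v - lc has quotient ⌊v/l⌋ - c by l. Removing l times this power of p cancels
    -- the denominator p^(lc) and leaves p^(v mod l) u.
    ℓ-char : ∀ d (X : ℚₚ p) {v u c} → X ~ ϖ v ⊗ u [ l ℕ.* c ] → Unit u →
      ℓ l d X ≡ digits (l ℕ.* d) (ϖ (v ℕ.% l) ⊗ u)
    ℓ-char d X {v} {u} {c} h unit =
      𝓛-elim (λ Z → Z mod-p^ (l ℕ.* d) ≡ digits (l ℕ.* d) (ϖ (v ℕ.% l) ⊗ u)) X
        (λ X≈0 → ⊥-elim (ϖ-unit-≢0 prime unit (ℕP.n<1+n v) (≅⇒≋ (≈0⇒~ {X = X} h X≈0))))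
        (λ X≉0 → mod-p^-char (shift (ℤ.- (+ l ℤ.* (ν X X≉0 /ℕ l))) X) (l ℕ.* d)
          (num-shift-char X _ (l ℕ.* c) (l ℕ.* (v ℕ./ l))
            (exponent (ν X X≉0 /ℕ l) (ν-/ℕ l X≉0 {v} {c} h unit)) (begin
          ϖ (l ℕ.* c) ⊗ num X                                    ≈⟨ h ⟩
          ϖ (den X) ⊗ (ϖ v ⊗ u)                                  ≈⟨ ϖ-+-* (den X) v u ⟨
          ϖ (den X ℕ.+ v) ⊗ u                                    ≈⟨ *-congʳ u (≅-reflexive (cong ϖ exponents)) ⟩
          ϖ (l ℕ.* (v ℕ./ l) ℕ.+ den X ℕ.+ v ℕ.% l) ⊗ u          ≈⟨ ϖ-+-* _ (v ℕ.% l) u ⟩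
          ϖ (l ℕ.* (v ℕ./ l) ℕ.+ den X) ⊗ (ϖ (v ℕ.% l) ⊗ u)      ∎)))
      where
      open SetoidReasoning ≅-setoid
      ring : ∀ l q c → ℤ.- (l ℤ.* (q ℤ.- c)) ≡ l ℤ.* c ℤ.- l ℤ.* q
      ring = solve-∀
      exponent : ∀ q → q ≡ + (v ℕ./ l) ℤ.- + c →
        ℤ.- (+ l ℤ.* q) ≡ + (l ℕ.* c) ℤ.- + (l ℕ.* (v ℕ./ l))
      exponent q eq = trans (cong (λ q → ℤ.- (+ l ℤ.* q)) eq)
        (trans (ring (+ l) (+ (v ℕ./ l)) (+ c)) (cong₂ ℤ._-_ (sym (ℤP.pos-* l c)) (sym (ℤP.pos-* l (v ℕ./ l)))))
      exponents : den X ℕ.+ v ≡ l ℕ.* (v ℕ./ l) ℕ.+ den X ℕ.+ v ℕ.% l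
      exponents = trans (cong (den X ℕ.+_) (trans (ℕDM.m≡m%n+[m/n]*n v l)
          (trans (ℕP.+-comm (v ℕ.% l) _) (cong (ℕ._+ v ℕ.% l) (ℕP.*-comm (v ℕ./ l) l)))))
        (trans (sym (ℕP.+-assoc (den X) _ _)) (cong (ℕ._+ v ℕ.% l) (ℕP.+-comm (den X) _)))

    ℓ< : ∀ d (X : ℚₚ p) → ℓ l d X < p ^ (l ℕ.* d)
    ℓ< d X = mod-p^< (𝓛 l X) (l ℕ.* d)
      where
      mod-p^< : ∀ (Z : ℚₚ p) m → Z mod-p^ m < p ^ m
      mod-p^< Z m = ℤDM.n%ℕd<d
        (_/ℕ_ (residue (num Z) (den Z ℕ.+ m)) (p ^ den Z) {{p^≢0 (den Z)}}) (p ^ m) {{p^≢0 m}}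

-- Power series

module _ {p : ℕ} where

  poly : (ℕ → ℤₚ p) → ℤₚ p → ℕ → ℤₚ p
  poly c x zero    = 0ᶻ
  poly c x (suc n) = poly c x n ⊕ c n ⊗ x ↑ n

  private variable
    x y z : ℤₚ p
    m n k : ℕ
    a : ℕ → ℤₚ p

  ≋-+0 : y ≋ 0ᶻ [ n ] → x ⊕ y ≋ x [ n ]
  ≋-+0 {x = x} h = ≋-trans (+-cong-≋ ≋-refl h) (≅⇒≋ (+-identityʳ x))

  poly-cong-≋ : ∀ n → x ≋ y [ k ] → poly a x n ≋ poly a y n [ k ]
  poly-cong-≋ zero    h = ≋-refl
  poly-cong-≋ (suc n) h = +-cong-≋ (poly-cong-≋ n h) (*-cong-≋ ≋-refl (^-cong-≋ n h))

  poly-tail : ∀ {K} j → (∀ n → K ≤ n → a n ≋ 0ᶻ [ k ]) → poly a x (j ℕ.+ K) ≋ poly a x K [ k ]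
  poly-tail zero    h = ≋-refl
  poly-tail {k = k} {x = x} {K} (suc j) h =
    ≋-trans (≋-+0 (*-≋0ˡ (x ↑ (j ℕ.+ K)) (h (j ℕ.+ K) (ℕP.m≤n+m K j)))) (poly-tail j h)

  poly-suc : ∀ (c : ℕ → ℤₚ p) x n → poly c x (suc n) ≅ c 0 ⊕ x ⊗ poly (c ∘ suc) x n
  poly-suc c x zero = ring₀ (c 0) x
    where
    opaque
      unfolding _⊕_
      ring₀ : ∀ (a x : ℤₚ p) → 0ᶻ ⊕ a ⊗ 1ᶻ ≅ a ⊕ x ⊗ 0ᶻ
      ring₀ a x = identity (λ n → lemma (residue a n) (residue x n))
        where
        lemma : ∀ a x → 0ℤ ℤ.+ a ℤ.* 1ℤ ≡ a ℤ.+ x ℤ.* 0ℤ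
        lemma = solve-∀
  poly-suc c x (suc n) = ≅-trans (+-cong (poly-suc c x n) ≅-refl)
    (ring₁ (c 0) x (poly (c ∘ suc) x n) (c (suc n)) (x ↑ n))
    where
    opaque
      unfolding _⊕_
      ring₁ : ∀ (a x q b w : ℤₚ p) → (a ⊕ x ⊗ q) ⊕ b ⊗ (x ⊗ w) ≅ a ⊕ x ⊗ (q ⊕ b ⊗ w)
      ring₁ a x q b w = identity (λ n → lemma (residue a n) (residue x n) (residue q n) (residue b n) (residue w n))
        where
        lemma : ∀ a x q b w → (a ℤ.+ x ℤ.* q) ℤ.+ b ℤ.* (x ℤ.* w) ≡ a ℤ.+ x ℤ.* (q ℤ.+ b ℤ.* w)
        lemma = solve-∀

  Null : (ℕ → ℤₚ p) → Set
  Null c = ∀ k → ∃[ K ] (∀ n → K ≤ n → c n ≋ 0ᶻ [ k ])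

  record Series : Set where
    field
      coefficient : ℕ → ℤₚ p
      null        : Null coefficient

  open Series public

  tail : Series → Series
  tail s .coefficient = coefficient s ∘ suc
  tail s .null k with K , h ← null s k = K , λ n K≤n → h (suc n) (ℕP.m≤n⇒m≤1+n K≤n)

  -- Both truncations agree with the one of length K + K′.
  poly-agree : ∀ K K′ → (∀ n → K ≤ n → a n ≋ 0ᶻ [ k ]) → (∀ n → K′ ≤ n → a n ≋ 0ᶻ [ k ]) →
    poly a x K ≋ poly a x K′ [ k ]
  poly-agree {a} {k} {x} K K′ h h′ = ≋-trans (≋-sym (poly-tail K′ h))
    (subst (λ j → poly a x j ≋ poly a x K′ [ k ]) (ℕP.+-comm K K′) (poly-tail K h′))

  opaque
    -- The limit is taken level by level: modulo pⁿ the series is a polynomial, whose length depends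
    -- on n.
    eval : Series → ℤₚ p → ℤₚ p
    eval s x .residue  n = residue (poly (coefficient s) x (proj₁ (null s n))) n
    eval s x .coherent n = ≋-int {p} (≋-trans (≋-sym (residue-const _ (ℕP.n≤1+n n)))
      (≋-trans (poly-agree _ _ (λ j h → ≋-down (ℕP.n≤1+n n) (proj₂ (null s (suc n)) j h)) (proj₂ (null s n)))
        (residue-const _ ℕP.≤-refl)))

    eval-residue : ∀ s x k → residue (eval s x) k ≡ residue (poly (coefficient s) x (proj₁ (null s k))) k
    eval-residue s x k = refl

  eval-≋ : ∀ s x k n → (∀ j → n ≤ j → coefficient s j ≋ 0ᶻ [ k ]) →
    eval s x ≋ poly (coefficient s) x n [ k ]
  eval-≋ s x k n h = ≋-trans (≡⇒≋ (eval-residue s x k)) (poly-agree _ n (proj₂ (null s k)) h)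

  eval-cong-≋ : ∀ s → x ≋ y [ k ] → eval s x ≋ eval s y [ k ]
  eval-cong-≋ {x} {y} {k} s h with K , zero-from ← null s k =
    ≋-trans (eval-≋ s x k K zero-from) (≋-trans (poly-cong-≋ K h) (≋-sym (eval-≋ s y k K zero-from)))

  eval-suc : ∀ s x → eval s x ≅ coefficient s 0 ⊕ x ⊗ eval (tail s) x
  eval-suc s x = ≋⇒≅ λ k → let K , h = null s k in
    ≋-trans (eval-≋ s x k (suc K) (λ j K<j → h j (ℕP.<⇒≤ K<j)))
      (≋-trans (≅⇒≋ (poly-suc (coefficient s) x K))
        (+-cong-≋ ≋-refl (*-cong-≋ ≋-refl (≋-sym (eval-≋ (tail s) x k K (λ j K≤j → h (suc j) (ℕP.m≤n⇒m≤1+n K≤j)))))))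

  eval-zero : ∀ s x → (∀ n → coefficient s n ≋ 0ᶻ [ k ]) → eval s x ≋ 0ᶻ [ k ]
  eval-zero {k} s x h = eval-≋ s x k 0 (λ j _ → h j)

  -- Synthetic division by x - θ: the k-th coefficient is Σ_{n>k} cₙ θⁿ⁻¹⁻ᵏ.
  quotientCoefficient : Series → ℤₚ p → ℕ → ℤₚ p
  quotientCoefficient s θ zero    = eval (tail s) θ
  quotientCoefficient s θ (suc k) = quotientCoefficient (tail s) θ k

  -- Horner's recurrence, which for a polynomial would start at the leading coefficient; here each
  -- coefficient is a convergent tail instead.
  quotientCoefficient-suc : ∀ s θ k → quotientCoefficient s θ k ≅
    coefficient s (suc k) ⊕ θ ⊗ quotientCoefficient s θ (suc k)
  quotientCoefficient-suc s θ zero    = eval-suc (tail s) θ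
  quotientCoefficient-suc s θ (suc k) = quotientCoefficient-suc (tail s) θ k

  quotientCoefficient-zero : ∀ s θ j → (∀ n → j < n → coefficient s n ≋ 0ᶻ [ k ]) →
    quotientCoefficient s θ j ≋ 0ᶻ [ k ]
  quotientCoefficient-zero s θ zero    h = eval-zero (tail s) θ (λ n → h (suc n) (s≤s z≤n))
  quotientCoefficient-zero s θ (suc j) h = quotientCoefficient-zero (tail s) θ j (λ n j<n → h (suc n) (s≤s j<n))

  quotientBy : ℤₚ p → Series → Series
  quotientBy θ s .coefficient = quotientCoefficient s θ
  quotientBy θ s .null k with K , h ← null s k = K , λ j K≤j →
    quotientCoefficient-zero s θ j (λ n j<n → h n (ℕP.≤-trans K≤j (ℕP.<⇒≤ j<n)))

  -- Truncating the division leaves the error θ dₙ xⁿ, which tends to 0 with dₙ. The hypothesis on θ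
  -- enters for n = 0, where the left side is s(θ).
  poly-quotient : ∀ s θ x → eval s θ ≅ 0ᶻ → ∀ n →
    let d = quotientCoefficient s θ in
    poly (coefficient s) x (suc n) ⊕ θ ⊗ (d n ⊗ x ↑ n) ≅ (x ⊖ θ) ⊗ poly d x n
  poly-quotient s θ x root zero = ≅-trans (ring₀ _ θ _ ) (≅-trans (≅-sym (eval-suc s θ))
      (≅-trans root (≅-sym (*-zeroʳ (x ⊖ θ)))))
    where
    opaque
      unfolding _⊕_
      ring₀ : ∀ (c θ d : ℤₚ p) → (0ᶻ ⊕ c ⊗ 1ᶻ) ⊕ θ ⊗ (d ⊗ 1ᶻ) ≅ c ⊕ θ ⊗ d
      ring₀ c θ d = identity (λ n → lemma (residue c n) (residue θ n) (residue d n))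
        where
        lemma : ∀ c θ d → (0ℤ ℤ.+ c ℤ.* 1ℤ) ℤ.+ θ ℤ.* (d ℤ.* 1ℤ) ≡ c ℤ.+ θ ℤ.* d
        lemma = solve-∀
  poly-quotient s θ x root (suc n) = begin
    (P ⊕ c (suc n) ⊗ (x ⊗ w)) ⊕ θ ⊗ (d (suc n) ⊗ (x ⊗ w))   ≈⟨ ring₁ P (c (suc n)) x w θ (d (suc n)) ⟩
    P ⊕ (c (suc n) ⊕ θ ⊗ d (suc n)) ⊗ (x ⊗ w)
      ≈⟨ +-cong ≅-refl (*-congʳ (x ⊗ w) (quotientCoefficient-suc s θ n)) ⟨
    P ⊕ d n ⊗ (x ⊗ w)                                       ≈⟨ ring₂ P (d n) x w θ ⟩
    (P ⊕ θ ⊗ (d n ⊗ w)) ⊕ (x ⊖ θ) ⊗ (d n ⊗ w)               ≈⟨ +-cong (poly-quotient s θ x root n) ≅-refl ⟩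
    (x ⊖ θ) ⊗ poly d x n ⊕ (x ⊖ θ) ⊗ (d n ⊗ w)              ≈⟨ *-distrib-+ _ _ _ ⟨
    (x ⊖ θ) ⊗ (poly d x n ⊕ d n ⊗ w)                        ∎
    where
    open SetoidReasoning ≅-setoid
    c = coefficient s
    d = quotientCoefficient s θ
    P = poly c x (suc n)
    w = x ↑ n
    opaque
      unfolding _⊕_
      ring₁ : ∀ (P c x w θ e : ℤₚ p) →
        (P ⊕ c ⊗ (x ⊗ w)) ⊕ θ ⊗ (e ⊗ (x ⊗ w)) ≅ P ⊕ (c ⊕ θ ⊗ e) ⊗ (x ⊗ w)
      ring₁ P c x w θ e = identity (λ n → lemma (residue P n) (residue c n) (residue x n)
          (residue w n) (residue θ n) (residue e n))
        where
        lemma : ∀ P c x w θ e → (P ℤ.+ c ℤ.* (x ℤ.* w)) ℤ.+ θ ℤ.* (e ℤ.* (x ℤ.* w)) ≡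
          P ℤ.+ (c ℤ.+ θ ℤ.* e) ℤ.* (x ℤ.* w)
        lemma = solve-∀
      ring₂ : ∀ (P e x w θ : ℤₚ p) →
        P ⊕ e ⊗ (x ⊗ w) ≅ (P ⊕ θ ⊗ (e ⊗ w)) ⊕ (x ⊖ θ) ⊗ (e ⊗ w)
      ring₂ P e x w θ = identity (λ n → lemma (residue P n) (residue e n) (residue x n) (residue w n) (residue θ n))
        where
        lemma : ∀ P e x w θ → P ℤ.+ e ℤ.* (x ℤ.* w) ≡
          (P ℤ.+ θ ℤ.* (e ℤ.* w)) ℤ.+ (x ℤ.+ ℤ.-1ℤ ℤ.* θ) ℤ.* (e ℤ.* w)
        lemma = solve-∀

  eval-quotient : ∀ s θ x → eval s θ ≅ 0ᶻ → eval s x ≅ (x ⊖ θ) ⊗ eval (quotientBy θ s) x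
  eval-quotient s θ x root = ≋⇒≅ λ k → at-level k (null s k)
    where
    d = quotientCoefficient s θ
    at-level : ∀ k → ∃[ K ] (∀ n → K ≤ n → coefficient s n ≋ 0ᶻ [ k ]) →
      eval s x ≋ (x ⊖ θ) ⊗ eval (quotientBy θ s) x [ k ]
    at-level k (K , h) = begin
      eval s x                                                ≈⟨ eval-≋ s x k (suc K) (λ j K<j → h j (ℕP.<⇒≤ K<j)) ⟩
      poly (coefficient s) x (suc K)                          ≈⟨ ≋-+0 (*-≋0ʳ θ (*-≋0ˡ (x ↑ K) (d≋0 K ℕP.≤-refl))) ⟨
      poly (coefficient s) x (suc K) ⊕ θ ⊗ (d K ⊗ x ↑ K)      ≈⟨ ≅⇒≋ (poly-quotient s θ x root K) ⟩
      (x ⊖ θ) ⊗ poly d x K                                    ≈⟨ *-cong-≋ ≋-refl (eval-≋ (quotientBy θ s) x k K d≋0) ⟨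
      (x ⊖ θ) ⊗ eval (quotientBy θ s) x                       ∎
      where
      open SetoidReasoning (≋-setoid k)
      d≋0 : ∀ j → K ≤ j → d j ≋ 0ᶻ [ k ]
      d≋0 j K≤j = quotientCoefficient-zero s θ j (λ n j<n → h n (ℕP.≤-trans K≤j (ℕP.<⇒≤ j<n)))

  -- Strassmann's condition, modulo pᴹ.  It bounds the number of zeros by N:
  -- division by x - θ turns N into N - 1.
  Dominant : ℕ → ℕ → Series → Set
  Dominant M N s = ¬ (coefficient s N ≋ 0ᶻ [ M ]) × (∀ n → N < n → coefficient s n ≋ 0ᶻ [ M ])

  -- Horner's recurrence reads d_N = c_(N+1) + θ d_(N+1), and d_(N+1) involves only coefficients
  -- that vanish modulo pᴹ.
  Dominant-quotient : ∀ {M N} s θ → Dominant M (suc N) s → Dominant M N (quotientBy θ s)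
  Dominant-quotient {M} {N} s θ (≢0 , zero-after) =
    (λ d≋0 → ≢0 (≋-trans (≋-sym (≋-+0 (*-≋0ʳ θ (above N ℕP.≤-refl))))
        (≋-trans (≅⇒≋ (≅-sym (quotientCoefficient-suc s θ N))) d≋0))) ,
    λ { (suc n) (s≤s N≤n) → above n N≤n }
    where
    above : ∀ n → N ≤ n → quotientCoefficient s θ (suc n) ≋ 0ᶻ [ M ]
    above n N≤n = quotientCoefficient-zero s θ (suc n) (λ j n<j → zero-after j (ℕP.≤-trans (s≤s (s≤s N≤n)) n<j))

  -- Modulo pᴹ the series is its constant term, so s(θ) ≡ c₀ for every θ.
  Dominant-0 : ∀ {M} s θ → Dominant M 0 s → ¬ (eval s θ ≅ 0ᶻ)
  Dominant-0 s θ (≢0 , zero-after) root = ≢0 (≋-trans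
    (≋-sym (≋-+0 (*-≋0ʳ θ (quotientCoefficient-zero s θ 0 zero-after))))
    (≅⇒≋ (≅-trans (≅-sym (eval-suc s θ)) root)))

module _ (em : ExcludedMiddle 0ℓ) {p : ℕ} where

  Factored : Series {p} → ℤₚ p → Set
  Factored s θ = ∃[ m ] Σ[ t ∈ Series ] ((∀ x → eval s x ≅ (x ⊖ θ) ↑ m ⊗ eval t x) × ¬ (eval t θ ≅ 0ᶻ))

  factor-root : ∀ {M} N s θ → Dominant M N s → Factored s θ
  factor-root zero    s θ dom = 0 , s , (λ x → ≅-sym (*-identityˡ _)) , Dominant-0 s θ dom
  factor-root (suc N) s θ dom = by-cases em
    where
    extend : eval s θ ≅ 0ᶻ → Factored (quotientBy θ s) θ → Factored s θ
    extend root (m , t , eq , nonroot) = suc m , t , (λ x → ≅-trans (eval-quotient s θ x root)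
      (≅-trans (*-congˡ _ (eq x)) (≅-sym (*-assoc _ _ _)))) , nonroot
    by-cases : Dec (eval s θ ≅ 0ᶻ) → Factored s θ
    by-cases (no nonroot) = 0 , s , (λ x → ≅-sym (*-identityˡ _)) , nonroot
    by-cases (yes root)   = extend root (factor-root N (quotientBy θ s) θ (Dominant-quotient s θ dom))

  -- Some coefficient is nonzero modulo some pᴹ. As the coefficients tend to 0, there is a last one
  -- that is nonzero modulo pᴹ, and N is its index.
  dominant : ∀ (s : Series {p}) → ¬ (∀ n → coefficient s n ≅ 0ᶻ) → ∃[ M ] ∃[ N ] Dominant M N s
  dominant s nonzero = from-coefficient (decidable-stable em λ none → nonzero λ n → ≋⇒≅ λ M →
      decidable-stable em λ ≢0 → none (M , n , ≢0))
    where
    last : ∀ {M} n → ¬ (coefficient s n ≋ 0ᶻ [ M ]) → ∀ K →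
      (∀ j → K ≤ j → coefficient s j ≋ 0ᶻ [ M ]) → ∃[ N ] Dominant M N s
    last n n≢0 zero    h = contradiction (h n z≤n) n≢0
    last {M} n n≢0 (suc K) h with em {coefficient s K ≋ 0ᶻ [ M ]}
    ... | no ≢0  = K , ≢0 , h
    ... | yes ≋0 = last n n≢0 K λ j K≤j → [ h j , (λ { refl → ≋0 }) ]′ (ℕP.m≤n⇒m<n∨m≡n K≤j)
    from-coefficient : ∃[ M ] ∃[ n ] ¬ (coefficient s n ≋ 0ᶻ [ M ]) → ∃[ M ] ∃[ N ] Dominant M N s
    from-coefficient (M , n , n≢0) = M , last n n≢0 (proj₁ (null s M)) (proj₂ (null s M))

module _ {p : ℕ} .{{_ : NonZero p}} where

  private variable
    z w : ℤₚ p
    m n k : ℕ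

  ~-level : ∀ {X : ℚₚ p} → m ≡ n → X ~ z [ m ] → X ~ z [ n ]
  ~-level refl h = h

  ~-lift : ∀ (X : ℚₚ p) E → den X ≤ E → ∃[ z ] X ~ z [ E ]
  ~-lift X E den≤E = ϖ (E ℕ.∸ den X) ⊗ num X ,
    ~-level {X = X} (ℕP.m∸n+n≡m den≤E) (~-mono {X = X} (E ℕ.∸ den X) (~-num X))

  partialSum-~ : ∀ {c a E} → (∀ n → c n ~ a n [ E ]) → ∀ x n → partialSum c x n ~ poly a x n [ E ]
  partialSum-~ h x zero = ≅-trans (*-congˡ _ num-0ₚ) (*-zero-irrelevant _ _)
  partialSum-~ {c} {a} {E} h x (suc n) =
    ~-+ {X = partialSum c x n} {c n * ι (x ^ᶻ n)} (partialSum-~ {c} h x n)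
      (~-level {X = c n * ι (x ^ᶻ n)} (ℕP.+-identityʳ E) (~-* {X = c n} {ι (x ^ᶻ n)} (h n)
        (~-cong {X = ι (x ^ᶻ n)} (^ᶻ≅↑ x n) (~-ι {z = x ^ᶻ n}))))

  eval-analytic : ∀ (s : Series {p}) C → Analytic (λ x → eval s x /p^ C)
  eval-analytic s C = c , λ x m → proj₁ (null s (C ℕ.+ m)) , λ n K≤n →
    ~⇒∈p^ {X = partialSum c x n - (eval s x /p^ C)}
      (~-- {X = partialSum c x n} {eval s x /p^ C}
        (partialSum-~ {c} (λ n → ~-/p^ {z = coefficient s n}) x n) (~-/p^ {z = eval s x}))
      (≋⇒-≋0 (≋-sym (eval-≋ s x (C ℕ.+ m) n (λ j n≤j → proj₂ (null s (C ℕ.+ m)) j (ℕP.≤-trans K≤n n≤j)))))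
    where
    c : ℕ → ℚₚ p
    c n = coefficient s n /p^ C

  -- Consecutive partial sums at x = 1 differ by a coefficient.
  coefficients-null : ∀ {h : ℤₚ p → ℚₚ p} (f-analytic : Analytic h) m →
    ∃[ N ] (∀ n → N ≤ n → proj₁ f-analytic n ∈p^ m)
  coefficients-null {h} (c , conv) m = N , λ n N≤n → small n (close n N≤n) (close (suc n) (ℕP.m≤n⇒m≤1+n N≤n))
    where
    one = fromℤ {p} 1ℤ
    N = proj₁ (conv one m)
    close = proj₂ (conv one m)
    small : ∀ n → (partialSum c one n - h one) ∈p^ m → (partialSum c one (suc n) - h one) ∈p^ m → c n ∈p^ m
    small n h₁ h₂ = ~⇒∈p^ {X = c n} c~ (begin
      b
        ≈⟨ ≅⇒≋ (≅-trans (≅-sym (*-identityʳ b)) (*-congˡ b (≅-sym (≅-trans (^-cong n (fromℤ≅int 1ℤ)) (1^ n))))) ⟩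
      b ⊗ one ↑ n       ≈⟨ ≅⇒≋ (ring a (b ⊗ one ↑ n)) ⟩
      (a ⊕ b ⊗ one ↑ n) ⊖ a    ≈⟨ -‿cong-≋ (-≋0⇒≋ (∈p^⇒~ {X = S′ - Y} (~-- {X = S′} {Y} S′~ Y~) h₂))
                                           (-≋0⇒≋ (∈p^⇒~ {X = S - Y} (~-- {X = S} {Y} S~ Y~) h₁)) ⟩
      e ⊖ e             ≈⟨ ≅⇒≋ (-‿inverse e) ⟩
      0ᶻ                ∎)
      where
      S = partialSum c one n
      S′ = partialSum c one (suc n)
      Y = h one
      -- One denominator exponent for both partial sums and the coefficient, so that their
      -- differences can be taken in ℤₚ.
      E = den S ℕ.+ den (c n) ℕ.+ den Y
      open SetoidReasoning (≋-setoid {p} (E ℕ.+ m))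
      liftS = ~-lift S E (ℕP.≤-trans (ℕP.m≤m+n _ _) (ℕP.m≤m+n _ _))
      liftC = ~-lift (c n) E (ℕP.≤-trans (ℕP.m≤n+m (den (c n)) (den S)) (ℕP.m≤m+n _ _))
      liftY = ~-lift Y E (ℕP.m≤n+m _ _)
      a = proj₁ liftS
      b = proj₁ liftC
      e = proj₁ liftY
      S~ : S ~ a [ E ]
      S~ = proj₂ liftS
      c~ : c n ~ b [ E ]
      c~ = proj₂ liftC
      Y~ : Y ~ e [ E ]
      Y~ = proj₂ liftY
      S′~ : S′ ~ a ⊕ b ⊗ one ↑ n [ E ]
      S′~ = ~-+ {X = S} {c n * ι (one ^ᶻ n)} S~
        (~-level {X = c n * ι (one ^ᶻ n)} (ℕP.+-identityʳ E) (~-* {X = c n} {ι (one ^ᶻ n)} c~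
          (~-cong {X = ι (one ^ᶻ n)} (^ᶻ≅↑ one n) (~-ι {z = one ^ᶻ n}))))
      opaque
        unfolding _⊕_
        ring : ∀ (a t : ℤₚ p) → t ≅ (a ⊕ t) ⊖ a
        ring a t = identity (λ n → lemma (residue a n) (residue t n))
          where
          lemma : ∀ a t → t ≡ (a ℤ.+ t) ℤ.+ ℤ.-1ℤ ℤ.* a
          lemma = solve-∀

  opaque
    integral : ∀ (X : ℚₚ p) → X ∈p^ 0 → ∃[ z ] X ~ z [ 0 ]
    integral X h with z , e ← divide (den X) (≋-level (ℕP.+-identityʳ (den X)) (∈p^⇒ {X = X} h)) =
      z , ≅-trans (ϖ-0 (num X)) e

  private
    total : (ℕ → ℕ) → ℕ → ℕ
    total a zero    = 0
    total a (suc n) = total a n ℕ.+ a n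

    ≤total : ∀ a {j} n → j < n → a j ≤ total a n
    ≤total a {j} (suc n) (s≤s j≤n) with ℕP.m≤n⇒m<n∨m≡n j≤n
    ... | inj₁ j<n  = ℕP.≤-trans (≤total a n j<n) (ℕP.m≤m+n _ _)
    ... | inj₂ refl = ℕP.m≤n+m _ _

  -- The coefficients tend to 0, so all but finitely many are integral and one power of p clears the
  -- rest. Its exponent is a multiple of l in order to be invisible to `ℓ` and to ν modulo l.
  analytic-series : ∀ l .{{_ : NonZero l}} {h : ℤₚ p → ℚₚ p} → Analytic h →
    ∃[ C ] Σ[ s ∈ Series ] (∀ x → h x ~ eval s x [ l ℕ.* C ])
  analytic-series l {h} h-analytic@(c , conv) = C , s , value
    where
    small : ∀ m → ∃[ N ] (∀ n → N ≤ n → c n ∈p^ m)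
    small = coefficients-null {h} h-analytic
    C E : ℕ
    -- The sum of the denominator exponents before N₀ bounds each of them; from N₀ on the
    -- coefficients are integral.
    C = total (den ∘ c) (proj₁ (small 0))
    E = l ℕ.* C
    N₀ = proj₁ (small 0)
    from-integral : ∀ n → ∃[ z ] c n ~ z [ 0 ] → ∃[ z ] c n ~ z [ E ]
    from-integral n (z , c~) = ϖ E ⊗ z , ~-level {X = c n} (ℕP.+-identityʳ E) (~-mono {X = c n} E c~)
    lift : ∀ n → ∃[ z ] c n ~ z [ E ]
    lift n = [ (λ n<N → ~-lift (c n) E (ℕP.≤-trans (≤total (den ∘ c) N₀ n<N) (ℕP.m≤n*m C l)))
             , (λ N≤n → from-integral n (integral (c n) (proj₂ (small 0) n N≤n))) ]′ (ℕP.<-≤-connex n N₀)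
    s : Series
    s .coefficient n = proj₁ (lift n)
    s .null m = proj₁ (small m) , λ n N≤n → ≋-down (ℕP.m≤n+m m E)
      (∈p^⇒~ {X = c n} (proj₂ (lift n)) (proj₂ (small m) n N≤n))
    value : ∀ x → h x ~ eval s x [ E ]
    value x = ≋⇒≅ λ m → level m (conv x m) (null s m)
      where
      D = den (h x)
      a = num (h x)
      level : ∀ m → ∃[ N ] (∀ n → N ≤ n → (partialSum c x n - h x) ∈p^ m) →
        ∃[ K ] (∀ n → K ≤ n → coefficient s n ≋ 0ᶻ [ m ]) → ϖ E ⊗ a ≋ ϖ D ⊗ eval s x [ m ]
      level m (N , close) (K , zero-from) = begin
        ϖ E ⊗ a                            ≈⟨ ≋-down (ℕP.m≤n+m m (E ℕ.+ D)) (-≋0⇒≋ (∈p^⇒~ {X = S - h x}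
          (~-- {X = S} {h x} S~ (~-mono {X = h x} E (~-num (h x)))) (close J (ℕP.m≤m+n N K)))) ⟨
        ϖ D ⊗ poly (coefficient s) x J     ≈⟨ *-cong-≋ ≋-refl (eval-≋ s x m J λ j J≤j →
          zero-from j (ℕP.≤-trans (ℕP.m≤n+m K N) J≤j)) ⟨
        ϖ D ⊗ eval s x                     ∎
        where
        open SetoidReasoning (≋-setoid {p} m)
        J = N ℕ.+ K
        S = partialSum c x J
        S~ : S ~ ϖ D ⊗ poly (coefficient s) x J [ E ℕ.+ D ]
        S~ = ~-level {X = S} (ℕP.+-comm D E) (~-mono {X = S} D (partialSum-~ {c} (λ n → proj₂ (lift n)) x J))

-- Powers of units and the Carmichael function

module _ {p : ℕ} where

  ↑-+ : ∀ (x : ℤₚ p) a b → x ↑ (a ℕ.+ b) ≅ x ↑ a ⊗ x ↑ b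
  ↑-+ x zero    b = ≅-sym (*-identityˡ _)
  ↑-+ x (suc a) b = ≅-trans (*-congˡ x (↑-+ x a b)) (≅-sym (*-assoc _ _ _))

  ↑-* : ∀ (x : ℤₚ p) a b → x ↑ (a ℕ.* b) ≅ (x ↑ b) ↑ a
  ↑-* x zero    b = ≅-refl
  ↑-* x (suc a) b = ≅-trans (↑-+ x b (a ℕ.* b)) (*-congˡ (x ↑ b) (↑-* x a b))

  0↑-suc : ∀ {x : ℤₚ p} m → x ≅ 0ᶻ → x ↑ suc m ≅ 0ᶻ
  0↑-suc m h = ≅-trans (*-congʳ _ h) (*-zeroˡ _)

  x+y-x : ∀ (x y : ℤₚ p) → (x ⊕ y) ⊖ x ≅ y
  x+y-x x y = ≅-trans (-‿cong (+-comm x y) ≅-refl) (x+y-y y x)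

%-cancel : ∀ l .{{_ : NonZero l}} a m → (m ℕ.+ a) ℕ.% l ≡ a ℕ.% l → l ℕD.∣ m
%-cancel l a m eq = ℕD.∣m+n∣m⇒∣n (subst (l ℕD.∣_) multiples (ℕD.n∣m*n ((m ℕ.+ a) ℕ./ l))) (ℕD.n∣m*n (a ℕ./ l))
  where
  multiples : (m ℕ.+ a) ℕ./ l ℕ.* l ≡ a ℕ./ l ℕ.* l ℕ.+ m
  multiples = ℕP.+-cancelˡ-≡ (a ℕ.% l) _ _ (begin
    a ℕ.% l ℕ.+ (m ℕ.+ a) ℕ./ l ℕ.* l            ≡⟨ cong (ℕ._+ (m ℕ.+ a) ℕ./ l ℕ.* l) eq ⟨
    (m ℕ.+ a) ℕ.% l ℕ.+ (m ℕ.+ a) ℕ./ l ℕ.* l    ≡⟨ ℕDM.m≡m%n+[m/n]*n (m ℕ.+ a) l ⟨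
    m ℕ.+ a                                      ≡⟨ ℕP.+-comm m a ⟩
    a ℕ.+ m                                      ≡⟨ cong (ℕ._+ m) (ℕDM.m≡m%n+[m/n]*n a l) ⟩
    a ℕ.% l ℕ.+ a ℕ./ l ℕ.* l ℕ.+ m              ≡⟨ ℕP.+-assoc (a ℕ.% l) _ m ⟩
    a ℕ.% l ℕ.+ (a ℕ./ l ℕ.* l ℕ.+ m)            ∎)
    where open ≡-Reasoning

%-absorb : ∀ l .{{_ : NonZero l}} {m} a → l ℕD.∣ m → (m ℕ.+ a) ℕ.% l ≡ a ℕ.% l
%-absorb l a (ℕD.divides q refl) = trans (cong (ℕ._% l) (ℕP.+-comm (q ℕ.* l) a)) (ℕDM.[m+kn]%n≡m%n a q l)

-- Division with remainder: a nonzero remainder of m would satisfy P and undercut b.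
minimal-divides : ∀ (P : ℕ → Set) b .{{_ : NonZero b}} → (∀ r → 1 ≤ r → P r → b ≤ r) →
  (∀ r q → P (r ℕ.+ q ℕ.* b) → P r) → ∀ m → P m → b ℕD.∣ m
minimal-divides P b minimal reduce m Pm = go (m ℕ.% b) refl
  where
  go : ∀ r → m ℕ.% b ≡ r → b ℕD.∣ m
  go zero    eq = ℕD.m%n≡0⇒n∣m m b eq
  go (suc r) eq = contradiction
    (minimal (suc r) (s≤s z≤n) (reduce (suc r) (m ℕ./ b)
      (subst P (trans (ℕDM.m≡m%n+[m/n]*n m b) (cong (ℕ._+ m ℕ./ b ℕ.* b) eq)) Pm)))
    (ℕP.<⇒≱ (subst (_< b) eq (ℕDM.m%n<n m b)))

-- Unlike `KillsUnits`, this admits m = 0, the multiplicity of a non-root.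
UnitsKilled : ℕ → ℕ → ℕ → Set
UnitsKilled p e m = ∀ (u : ℤₚ p) → Unit u → u ↑ m ≋ 1ᶻ [ e ]

module _ {p : ℕ} .{{_ : NonZero p}} (prime : Prime p) {e : ℕ} (1≤e : 1 ≤ e) where

  UnitsKilled⇒KillsUnits : ∀ {m} → 1 ≤ m → UnitsKilled p e m → KillsUnits (p ^ e) m
  UnitsKilled⇒KillsUnits {m} 1≤m h = 1≤m , λ a c → subst (+ (p ^ e) ∣ℤ_)
    (cong₂ ℤ._-_ (trans (residue-^ (int a) m e) (cong (ℤ._^ m) (residue-int a e))) (residue-int 1ℤ e))
    (difference (h (int a) (Coprime⇒Unit prime a e 1≤e c)))

  KillsUnits⇒UnitsKilled : ∀ {m} → KillsUnits (p ^ e) m → UnitsKilled p e m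
  KillsUnits⇒UnitsKilled {m} (_ , h) u unit = congruent (subst (+ (p ^ e) ∣ℤ_)
    (cong₂ ℤ._-_ (sym (residue-^ u m e)) (sym (residue-int 1ℤ e)))
    (h (residue u e) (λ {i} → Unit⇒Coprime prime u e unit 1≤e {i})))

  ↑-*-killed : ∀ {u : ℤₚ p} q {b} → u ↑ b ≋ 1ᶻ [ e ] → u ↑ (q ℕ.* b) ≋ 1ᶻ [ e ]
  ↑-*-killed {u} q {b} h = ≋-trans (≅⇒≋ (↑-* u q b)) (≋-trans (^-cong-≋ q h) (≅⇒≋ (1^ q)))

  UnitsKilled-remainder : ∀ r q {b} → UnitsKilled p e b → UnitsKilled p e (r ℕ.+ q ℕ.* b) → UnitsKilled p e r
  UnitsKilled-remainder r q {b} kills h u unit = begin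
    u ↑ r                         ≈⟨ ≅⇒≋ (*-identityʳ (u ↑ r)) ⟨
    u ↑ r ⊗ 1ᶻ                    ≈⟨ *-cong-≋ ≋-refl (↑-*-killed q {b} (kills u unit)) ⟨
    u ↑ r ⊗ u ↑ (q ℕ.* b)         ≈⟨ ≅⇒≋ (↑-+ u r (q ℕ.* b)) ⟨
    u ↑ (r ℕ.+ q ℕ.* b)           ≈⟨ h u unit ⟩
    1ᶻ                            ∎
    where open SetoidReasoning (≋-setoid {p} e)

  least∣⇒UnitsKilled : ∀ {b m} → IsLeast (KillsUnits (p ^ e)) b → b ℕD.∣ m → UnitsKilled p e m
  least∣⇒UnitsKilled {b} (kills , _) (ℕD.divides q refl) u unit =
    ↑-*-killed q {b} (KillsUnits⇒UnitsKilled {b} kills u unit)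

  -- With the converse above, λ(pᵉ) ∣ m comes to mean that uᵐ ≡ 1 modulo pᵉ for all units u, the
  -- form in which the digits of f meet the condition.
  UnitsKilled⇒least∣ : ∀ {b} m → IsLeast (KillsUnits (p ^ e)) b → UnitsKilled p e m → b ℕD.∣ m
  UnitsKilled⇒least∣ {b} m (kills , minimal) = minimal-divides (UnitsKilled p e) b {{ℕ.>-nonZero (proj₁ kills)}}
    (λ r 1≤r killed → minimal r (UnitsKilled⇒KillsUnits {r} 1≤r killed))
    (λ r q → UnitsKilled-remainder r q {b} (KillsUnits⇒UnitsKilled {b} kills)) m

-- Compactness, inverses of units and rational points

n<b^n : ∀ {b} → 1 < b → ∀ n → n < b ^ n
n<b^n 1<b zero    = s≤s z≤n
n<b^n {b} 1<b (suc n) = ℕP.≤-<-trans (n<b^n 1<b n) (ℕP.^-monoʳ-< b 1<b (ℕP.n<1+n n))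

module _ {p : ℕ} .{{_ : NonZero p}} (prime : Prime p) where

  opaque
    unfolding _⊕_

    -- With θ = κ y + j, this translates closeness of n to y into closeness of the kernel index κ n
    -- + j to θ.
    int-offset : ∀ κ n j (y : ℤₚ p) → fromℕ (κ ℕ.* n ℕ.+ j) ⊖ (int (+ κ) ⊗ y ⊕ int (+ j)) ≅ int (+ κ) ⊗ (int (+ n) ⊖ y)
    int-offset κ n j y = identity (λ i → trans
      (cong (λ t → t ℤ.+ ℤ.-1ℤ ℤ.* (+ κ ℤ.* residue y i ℤ.+ + j))
        (trans (ℤP.pos-+ (κ ℕ.* n) j) (cong (λ t → t ℤ.+ + j) (ℤP.pos-* κ n))))
      (lemma (+ κ) (+ n) (+ j) (residue y i)))
      where
      lemma : ∀ κ n j y → (κ ℤ.* n ℤ.+ j) ℤ.+ ℤ.-1ℤ ℤ.* (κ ℤ.* y ℤ.+ j) ≡ κ ℤ.* (n ℤ.+ ℤ.-1ℤ ℤ.* y)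
      lemma = solve-∀

  -- A positive integer k is smaller than pᵏ and hence not divisible by it.
  int≅0⇒≡0 : ∀ a → int {p} a ≅ 0ᶻ → ℤ.∣ a ∣ ≡ 0
  int≅0⇒≡0 a h with ℤ.∣ a ∣ in eq
  ... | zero  = refl
  ... | suc k = contradiction (ℕD.∣⇒≤ (subst (p ^ suc k ℕD.∣_) eq (ℤD.∣⇒∣ᵤ
    (subst (+ (p ^ suc k) ∣ℤ_) (ℤP.+-identityʳ a) (≋-int (≅⇒≋ {n = suc k} h)))))) (ℕP.<⇒≱ (n<b^n (p>1 prime) (suc k)))

  pos≇0 : ∀ κ .{{_ : NonZero κ}} → ¬ (int {p} (+ κ) ≅ 0ᶻ)
  pos≇0 κ@(suc _) h with () ← int≅0⇒≡0 (+ κ) h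

bounded-choice : (Q : ℕ → ℕ → Set) → (∀ {i S S′} → S ≤ S′ → Q i S → Q i S′) →
  ∀ k → (∀ i → i < k → ∃[ S ] Q i S) → ∃[ S ] (∀ i → i < k → Q i S)
bounded-choice Q mono zero    h = 0 , λ _ ()
bounded-choice Q mono (suc k) h = combine (bounded-choice Q mono k (λ i i<k → h i (ℕP.m≤n⇒m≤1+n i<k))) (h k ℕP.≤-refl)
  where
  combine : ∃[ S ] (∀ i → i < k → Q i S) → ∃[ S ] Q k S → ∃[ S ] (∀ i → i < suc k → Q i S)
  combine (S , q) (S′ , q′) = S ℕ.+ S′ , λ i i<1+k → [ (λ i<k → mono (ℕP.m≤m+n S S′) (q i i<k))
    , (λ { refl → mono (ℕP.m≤n+m S′ S) q′ }) ]′ (ℕP.m≤n⇒m<n∨m≡n (ℕP.≤-pred i<1+k))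

module _ {p : ℕ} .{{_ : NonZero p}} where

  opaque
    unfolding _⊕_

    int-affine : ∀ t i j → ϖ t ⊗ int (+ i) ⊕ int (+ j) ≅ int {p} (+ (j ℕ.+ p ^ t ℕ.* i))
    int-affine t i j = identity λ _ → trans (ℤP.+-comm (+ (p ^ t) ℤ.* + i) (+ j))
      (sym (trans (ℤP.pos-+ j (p ^ t ℕ.* i)) (cong (λ c → + j ℤ.+ c) (ℤP.pos-* (p ^ t) i))))

  int-affine-≋ : ∀ t i j → int {p} (+ (j ℕ.+ p ^ t ℕ.* i)) ≋ int (+ j) [ t ]
  int-affine-≋ t i j = ≋-trans (≅⇒≋ (≅-sym (int-affine t i j)))
    (≋-trans (+-cong-≋ (ϖ-≋0 _ ℕP.≤-refl) ≋-refl) (≅⇒≋ (+-identityˡ _)))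

  opaque
    limit : (w : ℕ → ℤₚ p) → (∀ n → w (suc n) ≋ w n [ n ]) → ∃[ x ] (∀ n → x ≋ w n [ n ])
    limit w coh = x , λ n → ≋-trans (residue-const x ℕP.≤-refl) (≋-sym (residue-const (w n) ℕP.≤-refl))
      where
      x : ℤₚ p
      x .residue n = residue (w n) n
      x .coherent n = ≋-int (≋-trans (≋-sym (residue-const (w (suc n)) (ℕP.n≤1+n n)))
        (≋-trans (coh n) (residue-const (w n) ℕP.≤-refl)))

module _ (em : ExcludedMiddle 0ℓ) {p : ℕ} .{{_ : NonZero p}} (prime : Prime p) where

  opaque
    killing-exponent : ∀ n .(nz : NonZero n) → ∃[ m ] KillsUnits n m
    killing-exponent n nz = carmichael em n {{nz}} , proj₁ (proj₂ (least em (KillsUnits n) _))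

    -- Modulo pⁿ⁺¹ some m ≥ 1 has uᵐ ≡ 1, which makes uᵐ⁻¹ an inverse there. Inverses at successive
    -- levels agree because u can be cancelled. Level n + 1 instead of n avoids the trivial modulus
    -- p⁰.
    inverse : ∀ (u : ℤₚ p) → Unit u → ∃[ v ] u ⊗ v ≅ 1ᶻ
    inverse u unit = from-limit (limit w (λ n → unit-cancel prime unit (≋-trans
        (≋-down (ℕP.n≤1+n n) (u⊗w≋1 (suc n))) (≋-sym (u⊗w≋1 n)))))
      where
      killing : ∀ n → ∃[ m ] KillsUnits (p ^ suc n) m
      killing n = killing-exponent (p ^ suc n) (p^≢0 (suc n))
      w : ℕ → ℤₚ p
      w n = u ↑ ℕ.pred (proj₁ (killing n))
      u⊗w≋1 : ∀ n → u ⊗ w n ≋ 1ᶻ [ n ]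
      u⊗w≋1 n = ≋-down (ℕP.n≤1+n n) (from-kills (killing n))
        where
        from-kills : (k : ∃[ m ] KillsUnits (p ^ suc n) m) → u ⊗ u ↑ ℕ.pred (proj₁ k) ≋ 1ᶻ [ suc n ]
        from-kills (suc m , kills) = KillsUnits⇒UnitsKilled prime (s≤s z≤n) {suc m} kills u unit
      from-limit : ∃[ v ] (∀ n → v ≋ w n [ n ]) → ∃[ v ] u ⊗ v ≅ 1ᶻ
      from-limit (v , h) = v , ≋⇒≅ λ n → ≋-trans (*-cong-≋ ≋-refl (h n)) (u⊗w≋1 n)

  module _ (P : ℤₚ p → ℕ → Set) where

    private
      -- The ball j + pᵗ ℤₚ is covered by finitely many of the given balls.
      Covered : ℕ → ℕ → Set
      Covered j t = ∃[ S ] (∀ z → z ≋ int (+ j) [ t ] → ∃[ x ] ∃[ s ] (s ≤ S × z ≋ x [ s ] × P x s))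

      subdivide : ∀ j t → (∀ i → i < p ^ 1 → Covered (j ℕ.+ p ^ t ℕ.* i) (suc t)) → Covered j t
      subdivide j t h = assemble (bounded-choice
          (λ i S → ∀ z → z ≋ int (+ (j ℕ.+ p ^ t ℕ.* i)) [ suc t ] → ∃[ x ] ∃[ s ] (s ≤ S × z ≋ x [ s ] × P x s))
          (λ S≤S′ q z near → let x , s , s≤S , rest = q z near in x , s , ℕP.≤-trans s≤S S≤S′ , rest) (p ^ 1) h)
        where
        assemble : ∃[ S ] (∀ i → i < p ^ 1 → ∀ z → z ≋ int (+ (j ℕ.+ p ^ t ℕ.* i)) [ suc t ] →
          ∃[ x ] ∃[ s ] (s ≤ S × z ≋ x [ s ] × P x s)) → Covered j t
        assemble (S , cover) = S , λ z near → from-quotient z (divide t (≋⇒-≋0 near))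
          where
          from-quotient : ∀ z → ∃[ q ] z ⊖ int (+ j) ≅ ϖ t ⊗ q → ∃[ x ] ∃[ s ] (s ≤ S × z ≋ x [ s ] × P x s)
          from-quotient z (q , e) = cover (digits 1 q) (digits< 1 q) z (begin
            z                                             ≈⟨ ≅⇒≋ (x-y+y z (int (+ j))) ⟨
            (z ⊖ int (+ j)) ⊕ int (+ j)                   ≈⟨ +-cong-≋ (≅⇒≋ e) ≋-refl ⟩
            ϖ t ⊗ q ⊕ int (+ j)
              ≈⟨ +-cong-≋ (≋-level (ℕP.+-comm t 1) (≋-+ t (digits-≋ q 1))) ≋-refl ⟩
            ϖ t ⊗ int (+ digits 1 q) ⊕ int (+ j)          ≈⟨ ≅⇒≋ (int-affine t (digits 1 q) j) ⟩
            int (+ (j ℕ.+ p ^ t ℕ.* digits 1 q))          ∎)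
            where
            open SetoidReasoning (≋-setoid {p} (suc t))

      child : ∀ t ((j , _) : ∃[ j ] ¬ Covered j t) → ∃[ j′ ] (¬ Covered j′ (suc t) × int {p} (+ j′) ≋ int (+ j) [ t ])
      child t (j , bad) = select (decidable-stable em λ none → bad (subdivide j t λ i i<p →
          decidable-stable em λ h → none (i , h)))
        where
        select : ∃[ i ] ¬ Covered (j ℕ.+ p ^ t ℕ.* i) (suc t) →
          ∃[ j′ ] (¬ Covered j′ (suc t) × int {p} (+ j′) ≋ int (+ j) [ t ])
        select (i , h) = j ℕ.+ p ^ t ℕ.* i , h , int-affine-≋ t i j

      descend : ¬ Covered 0 0 → ∀ t → ∃[ j ] ¬ Covered j t
      descend bad zero    = 0 , bad
      descend bad (suc t) = proj₁ (child t (descend bad t)) , proj₁ (proj₂ (child t (descend bad t)))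

    opaque
      -- An uncovered ball contains an uncovered ball of the next level. The nested balls shrink to
      -- a point x, and the ball given at x, with some exponent s, covers the s-th of them. The
      -- bound S expresses finiteness, as there are only finitely many balls with exponent at most
      -- S.
      compact : (∀ x → ∃[ s ] P x s) → ∃[ S ] (∀ z → ∃[ x ] ∃[ s ] (s ≤ S × z ≋ x [ s ] × P x s))
      compact h = restrict (decidable-stable em λ bad → contradict bad (limit (w bad) (λ t →
          proj₂ (proj₂ (child t (descend bad t))))))
        where
        restrict : Covered 0 0 → ∃[ S ] (∀ z → ∃[ x ] ∃[ s ] (s ≤ S × z ≋ x [ s ] × P x s))
        restrict (S , cover) = S , λ z → cover z ≋-zero
        w : ¬ Covered 0 0 → ℕ → ℤₚ p
        w bad t = int (+ proj₁ (descend bad t))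
        contradict : (bad : ¬ Covered 0 0) → ∃[ x ] (∀ t → x ≋ w bad t [ t ]) → ⊥
        contradict bad (x , near) = from-ball (h x)
          where
          from-ball : ∃[ s ] P x s → ⊥
          from-ball (s , Pxs) = proj₂ (descend bad s)
            (s , λ z z≋ → x , s , ℕP.≤-refl , ≋-trans z≋ (≋-sym (near s)) , Pxs)

factor-out : ∀ p → 1 < p → ∀ k → 1 ≤ k → ∃[ t ] ∃[ k′ ] (k ≡ p ^ t ℕ.* k′ × ¬ (p ℕD.∣ k′))
factor-out p 1<p = <-rec _ step
  where
  step : ∀ k → (∀ {j} → j < k → 1 ≤ j → ∃[ t ] ∃[ k′ ] (j ≡ p ^ t ℕ.* k′ × ¬ (p ℕD.∣ k′))) →
    1 ≤ k → ∃[ t ] ∃[ k′ ] (k ≡ p ^ t ℕ.* k′ × ¬ (p ℕD.∣ k′))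
  step k rec 1≤k with p ℕD.∣? k
  ... | no p∤k = 0 , k , sym (ℕP.*-identityˡ k) , p∤k
  ... | yes (ℕD.divides zero refl) = contradiction 1≤k λ ()
  ... | yes (ℕD.divides q@(suc _) refl)
    with t , k′ , q≡ , p∤k′ ← rec {q} (ℕP.m<m*n q p 1<p) (s≤s z≤n) =
    suc t , k′ , trans (cong (ℕ._* p) q≡) (trans (ℕP.*-comm (p ^ t ℕ.* k′) p) (sym (ℕP.*-assoc p (p ^ t) k′))) , p∤k′

module _ (em : ExcludedMiddle 0ℓ) {p : ℕ} .{{_ : NonZero p}} (prime : Prime p) where

  opaque
    unfolding _⊕_

    fromℕ≅int : ∀ n → fromℕ n ≅ int {p} (+ n)
    fromℕ≅int n = ≅-refl

    Rational-intro : ∀ {θ : ℤₚ p} q → int (ℚ.↧ q) ⊗ θ ≅ int (ℚ.↥ q) → Rational θ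
    Rational-intro q (equal h) = q , h

    Rational-elim : ∀ {θ : ℤₚ p} → Rational θ → ∃[ q ] (int (ℚ.↧ q) ⊗ θ ≅ int (ℚ.↥ q))
    Rational-elim (q , h) = q , equal h

  int-∣ : ∀ {a : ℕ} → int {p} (+ a) ≋ 0ᶻ [ 1 ] → p ℕD.∣ a
  int-∣ {a} h = subst (ℕD._∣ a) (ℕP.^-identityʳ p) (ℤD.∣⇒∣ᵤ (subst (+ (p ^ 1) ∣ℤ_) (ℤP.+-identityʳ (+ a)) (≋-int h)))

  int-injective : ∀ {a b : ℕ} → int {p} (+ a) ≅ int (+ b) → a ≡ b
  int-injective {a} {b} h = remainder-unique {p ^ (a ℕ.+ b)}
    (ℕP.≤-<-trans (ℕP.m≤m+n a b) (n<b^n (p>1 prime) (a ℕ.+ b)))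
    (ℕP.≤-<-trans (ℕP.m≤n+m b a) (n<b^n (p>1 prime) (a ℕ.+ b)))
    (≋-int {p} (≅⇒≋ {n = a ℕ.+ b} h))

  -- The fraction A / B is stored in lowest terms, so the equation has to be divided by gcd(A, B),
  -- which is nonzero in ℤₚ.
  rational-by-equation : ∀ {θ : ℤₚ p} A B .{{_ : NonZero B}} → int (+ B) ⊗ θ ≅ int A → Rational θ
  rational-by-equation {θ} A B h = Rational-intro q (⊗-cancelˡ em prime g≇0 (begin
    int g ⊗ (int (ℚ.↧ q) ⊗ θ)        ≈⟨ *-assoc _ _ _ ⟨
    (int g ⊗ int (ℚ.↧ q)) ⊗ θ        ≈⟨ *-congʳ θ (int-⊗ g (ℚ.↧ q)) ⟨
    int (g ℤ.* ℚ.↧ q) ⊗ θ            ≈⟨ *-congʳ θ (≅-reflexive (cong int (trans (ℤP.*-comm g _) (ℚP.↧-/ A B)))) ⟩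
    int (+ B) ⊗ θ                    ≈⟨ h ⟩
    int A                            ≈⟨ ≅-reflexive (cong int (trans (ℤP.*-comm g _) (ℚP.↥-/ A B))) ⟨
    int (g ℤ.* ℚ.↥ q)                ≈⟨ int-⊗ g (ℚ.↥ q) ⟩
    int g ⊗ int (ℚ.↥ q)              ∎))
    where
    open SetoidReasoning (≅-setoid {p})
    q : ℚ
    q = A ℚ./ B
    g : ℤ
    g = ℤGCD.gcd A (+ B)
    g≇0 : ¬ (int {p} g ≅ 0ᶻ)
    g≇0 e = pos≇0 prime B (begin
      int (+ B)                  ≈⟨ ≅-reflexive (cong int (ℚP.↧-/ A B)) ⟨
      int (ℚ.↧ q ℤ.* g)          ≈⟨ int-⊗ (ℚ.↧ q) g ⟩
      int (ℚ.↧ q) ⊗ int g        ≈⟨ *-congˡ _ e ⟩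
      int (ℚ.↧ q) ⊗ 0ᶻ           ≈⟨ *-zeroʳ _ ⟩
      0ᶻ                         ∎)

-- A point y at which the kernel sequence a(kⁱn + j) inherits the singularity θ of a.
record Point {p : ℕ} (k : ℕ) (θ : ℤₚ p) (i j : ℕ) : Set where
  field
    j<kⁱ     : j < k ^ i
    y        : ℤₚ p
    equation : int (+ (k ^ i)) ⊗ y ⊕ int (+ j) ≅ θ

open Point public

^-distribʳ-* : ∀ m n i → (m ℕ.* n) ^ i ≡ m ^ i ℕ.* n ^ i
^-distribʳ-* m n zero    = refl
^-distribʳ-* m n (suc i) = trans (cong (m ℕ.* n ℕ.*_) (^-distribʳ-* m n i)) (ℕP.[m*n]*[o*p]≡[m*o]*[n*p] m n (m ^ i) (n ^ i))

prime∤^ : ∀ {p} → Prime p → ∀ {k} → ¬ (p ℕD.∣ k) → ∀ i → ¬ (p ℕD.∣ k ^ i)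
prime∤^ p-prime p∤k zero    p∣1 = ℕP.<⇒≱ (ℕ.nonTrivial⇒n>1 _ {{prime⇒nonTrivial p-prime}}) (ℕD.∣⇒≤ p∣1)
prime∤^ p-prime {k} p∤k (suc i) h = [ p∤k , prime∤^ p-prime p∤k i ]′ (euclidsLemma k (k ^ i) p-prime h)

-- Finite families of sequences

-- The list only has to cover P and may contain further sequences, so that subfamilies inherit it
-- unchanged.
FiniteFamily : ((ℕ → ℕ) → Set) → Set
FiniteFamily P = Σ[ ss ∈ List (ℕ → ℕ) ] (∀ b → P b → Any (b ≗_) ss)

module _ (em : ExcludedMiddle 0ℓ) where

  finite-⊆ : ∀ {P Q : (ℕ → ℕ) → Set} → (∀ b → P b → Q b) → FiniteFamily Q → FiniteFamily P
  finite-⊆ P⊆Q (ss , cover) = ss , λ b Pb → cover b (P⊆Q b Pb)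

  finite-∅ : ∀ {P : (ℕ → ℕ) → Set} → (∀ b → ¬ P b) → FiniteFamily P
  finite-∅ none = List.[] , λ b Pb → ⊥-elim (none b Pb)

  finite-∪ : ∀ {P Q : (ℕ → ℕ) → Set} → FiniteFamily P → FiniteFamily Q → FiniteFamily (λ b → P b ⊎ Q b)
  finite-∪ (ss , cover) (ss′ , cover′) = ss List.++ ss′ , λ
    { b (inj₁ Pb) → AnyP.++⁺ˡ (cover b Pb) ; b (inj₂ Qb) → AnyP.++⁺ʳ ss (cover′ b Qb) }

  finite-⋃ : ∀ {M} {Q : Fin M → (ℕ → ℕ) → Set} → (∀ c → FiniteFamily (Q c)) → FiniteFamily (λ b → ∃[ c ] Q c b)
  finite-⋃ {zero}  fin = finite-∅ λ { _ (() , _) }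
  finite-⋃ {suc M} fin = finite-⊆ (λ { b (Fin.zero , q) → inj₁ q ; b (Fin.suc c , q) → inj₂ (c , q) })
    (finite-∪ (fin Fin.zero) (finite-⋃ (λ c → fin (Fin.suc c))))

  finite-subsingleton : ∀ {P : (ℕ → ℕ) → Set} → (∀ b b′ → P b → P b′ → b ≗ b′) → FiniteFamily P
  finite-subsingleton {P} same = by-cases em
    where
    by-cases : Dec (∃ P) → FiniteFamily P
    by-cases (yes (b , Pb)) = List.[ b ] , λ b′ Pb′ → Any.here (same b′ b Pb′ Pb)
    by-cases (no none)      = finite-∅ λ b Pb → none (b , Pb)

  Periodic : ℕ → ℕ → (ℕ → ℕ) → Set
  Periodic T B b = (∀ n → b (n ℕ.+ T) ≡ b n) × (∀ n → b n < B)

  periodic-% : ∀ {T B b} .{{_ : NonZero T}} → Periodic T B b → ∀ n → b n ≡ b (n ℕ.% T)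
  periodic-% {T} {B} {b} (periodic , _) n =
    trans (cong b (ℕDM.m≡m%n+[m/n]*n n T)) (iterate (n ℕ./ T))
    where
    iterate : ∀ q → b (n ℕ.% T ℕ.+ q ℕ.* T) ≡ b (n ℕ.% T)
    iterate zero    = cong b (ℕP.+-identityʳ (n ℕ.% T))
    iterate (suc q) = trans (cong b (trans (cong (n ℕ.% T ℕ.+_) (ℕP.+-comm T (q ℕ.* T)))
        (sym (ℕP.+-assoc (n ℕ.% T) (q ℕ.* T) T))))
      (trans (periodic _) (iterate q))

  -- The first T values determine such a sequence, and they form one of Bᵀ functions from `Fin T` to
  -- `Fin B`.
  finite-periodic : ∀ T B .{{_ : NonZero T}} → FiniteFamily (Periodic T B)
  finite-periodic T B = finite-⊆ (λ b h → code b h , h , refl) (finite-⋃ {B ^ T} λ c → finite-subsingleton (same c))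
    where
    values : ∀ b → Periodic T B b → Fin T → Fin B
    values b (_ , bounded) c = fromℕ< (bounded (toℕ c))
    code : ∀ b → Periodic T B b → Fin (B ^ T)
    code b h = Fin.funToFin (values b h)
    same : ∀ c b b′ → Σ[ h ∈ Periodic T B b ] (code b h ≡ c) → Σ[ h ∈ Periodic T B b′ ] (code b′ h ≡ c) → b ≗ b′
    same _ b b′ (h , refl) (h′ , eq) n = trans (periodic-% h n) (trans (subst (λ k → b k ≡ b′ k) (FinP.toℕ-fromℕ< (ℕDM.m%n<n n T))
        (FinP.fromℕ<-injective _ _ _ _ values≡)) (sym (periodic-% h′ n)))
      where
      c : Fin T
      c = fromℕ< (ℕDM.m%n<n n T)
      values≡ : values b h c ≡ values b′ h′ c
      values≡ = trans (sym (FinP.finToFun-funToFin (values b h) c))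
        (trans (cong (λ F → Fin.finToFun F c) (sym eq)) (FinP.finToFun-funToFin (values b′ h′) c))

-- Local behaviour of the digits of f

module _ (em : ExcludedMiddle 0ℓ) {p : ℕ} .{{_ : NonZero p}} (prime : Prime p)
         (l d : ℕ) .{{_ : NonZero l}} .{{_ : NonZero d}} where

  open Digits em {p}

  D : ℕ
  D = l ℕ.* d

  l≤D : l ≤ D
  l≤D = ℕP.m≤m*n l d

  %<D : ∀ a → a ℕ.% l < D
  %<D a = ℕP.<-≤-trans (ℕDM.m%n<n a l) l≤D

  1≤D : 1 ≤ D
  1≤D = ℕP.≤-trans (ℕ.>-nonZero⁻¹ l) l≤D

  -- f(x) = p^(-lC) (x - θ)ᵐ t(x) with t an integral series and t(θ) = pʷ γ.
  -- The denominator p^(lC) does not affect ℓ.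
  record Local (f : ℤₚ p → ℚₚ p) (θ : ℤₚ p) : Set where
    field
      m C w  : ℕ
      t      : Series {p}
      γ      : ℤₚ p
      shape  : ∀ x → f x ~ (x ⊖ θ) ↑ m ⊗ eval t x [ l ℕ.* C ]
      value  : eval t θ ≅ ϖ w ⊗ γ
      γ-unit : Unit γ

  -- The condition that defines 𝓡′, for r = w mod l. The factor pʳ leaves ld - r digits of uᵐ γ
  -- visible.
  Singular : ℕ → ℕ → Set
  Singular m r = ¬ (l ℕD.∣ m) ⊎ ¬ UnitsKilled p (l ℕ.* d ℕ.∸ r) m

  private
    1≤∸ : ∀ {r} → r < l → 1 ≤ l ℕ.* d ℕ.∸ r
    1≤∸ r<l = ℕP.m<n⇒0<n∸m (ℕP.<-≤-trans r<l l≤D)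

  opaque
    local : ∀ {f} → Analytic f → ¬ (∀ x → f x ≈ 0ₚ) → ∀ θ → Local f θ
    local {f} f-analytic nonzero θ = from-series (analytic-series l {f} f-analytic)
      where
      from-series : ∃[ C ] Σ[ s ∈ Series ] (∀ x → f x ~ eval s x [ l ℕ.* C ]) → Local f θ
      from-series (C , s , f~) = from-dominant (dominant em s coefficients)
        where
        coefficients : ¬ (∀ n → coefficient s n ≅ 0ᶻ)
        coefficients z = nonzero λ x → ~⇒≈0 {X = f x} (f~ x) (≋⇒≅ λ k → eval-zero s x (λ n → ≅⇒≋ (z n)))
        from-factor : Factored em s θ → Local f θ
        from-dominant : ∃[ M ] ∃[ N ] Dominant M N s → Local f θ
        from-dominant (_ , N , dom) = from-factor (factor-root em N s θ dom)
        from-factor (m , t , eq , nonroot) with w , γ , value , unit ← valuation em prime nonroot = record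
          { m = m ; C = C ; w = w ; t = t ; γ = γ
          ; shape = λ x → ~-cong {X = f x} (eq x) (f~ x)
          ; value = value ; γ-unit = unit }

  opaque
    -- Clearing the denominators of the cofactor by p^(lC) preserves its valuation at θ modulo l.
    factorisation-local : ∀ {f θ} (F : Factorisation f θ) → let open Factorisation F in
      Σ[ L ∈ Local f θ ] (Local.m L ≡ multiplicity × ν (cofactor θ) nonvanishing %ℕ l ≡ Local.w L ℕ.% l)
    factorisation-local {f} {θ} F = from-series (analytic-series l {cofactor} analytic)
      where
      open Factorisation F
      Goal : Set
      Goal = Σ[ L ∈ Local f θ ] (Local.m L ≡ multiplicity × ν (cofactor θ) nonvanishing %ℕ l ≡ Local.w L ℕ.% l)
      from-series : ∃[ C ] Σ[ s ∈ Series ] (∀ x → cofactor x ~ eval s x [ l ℕ.* C ]) → Goal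
      from-series (C , t , g~) = from-valuation (valuation em prime (nonvanishing ∘ ~⇒≈0 {X = cofactor θ} (g~ θ)))
        where
        shape : ∀ x → f x ~ (x ⊖ θ) ↑ multiplicity ⊗ eval t x [ l ℕ.* C ]
        shape x = ~-≈ {X = f x} {Y} (factors x) (~-* {X = ι ((x -ᶻ θ) ^ᶻ multiplicity)} {cofactor x}
          (~-cong {X = ι ((x -ᶻ θ) ^ᶻ multiplicity)} (≅-trans (^ᶻ≅↑ _ multiplicity) (^-cong multiplicity (-ᶻ≅⊖ x θ)))
            (~-ι {z = (x -ᶻ θ) ^ᶻ multiplicity})) (g~ x))
          where
          Y : ℚₚ p
          Y = ι ((x -ᶻ θ) ^ᶻ multiplicity) * cofactor x
        from-valuation : ∃[ w ] ∃[ γ ] (eval t θ ≅ ϖ w ⊗ γ × Unit γ) → Goal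
        from-valuation (w , γ , value , unit) =
          record { m = multiplicity ; C = C ; w = w ; t = t ; γ = γ ; shape = shape ; value = value ; γ-unit = unit }
          , refl , ν-%ℕ em prime l {X = cofactor θ} nonvanishing {w} {C} (~-cong {X = cofactor θ} value (g~ θ)) unit

    -- The cofactor is p^(-lC) t, whose valuation at θ is w - lC.
    local-factorisation : ∀ {f θ} (L : Local f θ) → let open Local L in
      Σ[ F ∈ Factorisation f θ ] (m ≡ Factorisation.multiplicity F
        × w ℕ.% l ≡ ν (Factorisation.cofactor F θ) (Factorisation.nonvanishing F) %ℕ l)
    local-factorisation {f} {θ} L = F , refl ,
        sym (ν-%ℕ em prime l {X = g θ} nonvanishing {w} {C} (~-cong {X = g θ} value (~-/p^ {z = eval t θ})) γ-unit)
      where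
      open Local L
      g : ℤₚ p → ℚₚ p
      g x = eval t x /p^ (l ℕ.* C)
      nonvanishing : ¬ (g θ ≈ 0ₚ)
      nonvanishing h = ϖ-unit-≢0 prime γ-unit (ℕP.n<1+n w)
        (≅⇒≋ (≅-trans (≅-sym value) (≈0⇒~ {X = g θ} (~-/p^ {z = eval t θ}) h)))
      F : Factorisation f θ
      F = record { multiplicity = m ; cofactor = g ; analytic = eval-analytic t (l ℕ.* C)
        ; factors = λ x → ~⇒≈ {X = f x} {ι ((x -ᶻ θ) ^ᶻ m) * g x} (shape x)
            (~-* {X = ι ((x -ᶻ θ) ^ᶻ m)} {g x}
              (~-cong {X = ι ((x -ᶻ θ) ^ᶻ m)} (≅-trans (^ᶻ≅↑ _ m) (^-cong m (-ᶻ≅⊖ x θ)))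
                (~-ι {z = (x -ᶻ θ) ^ᶻ m})) (~-/p^ {z = eval t x}))
        ; nonvanishing = nonvanishing }

  exponent : ∀ {f θ} → Factorisation f θ → ℕ
  exponent {θ = θ} F = l ℕ.* d ℕ.∸ (ν (Factorisation.cofactor F θ) (Factorisation.nonvanishing F) %ℕ l)

  -- The next two lemmas connect Singular with 𝓡′.  The Carmichael function
  -- appears as an arbitrary least killing exponent c, since comparing two
  -- occurrences of it would unfold its definition.
  opaque
    factorisation⇒singular : ∀ {f θ c e} (F : Factorisation f θ) → let open Factorisation F in
      ¬ (l ℕD.∣ multiplicity) ⊎ ¬ (c ℕD.∣ multiplicity) →
      IsLeast (KillsUnits (p ^ e)) c → e ≡ exponent F →
      Σ[ L ∈ Local f θ ] Singular (Local.m L) (Local.w L ℕ.% l)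
    factorisation⇒singular {f} {θ} {c} F bad c-least refl = transfer (factorisation-local F)
        (Sum.map₂ (λ c∤m → c∤m ∘ UnitsKilled⇒least∣ prime (1≤∸ (ℤDM.n%ℕd<d i l)) (Factorisation.multiplicity F) c-least) bad)
      where
      i : ℤ
      i = ν (Factorisation.cofactor F θ) (Factorisation.nonvanishing F)
      transfer : ∀ {r} → Σ[ L ∈ Local f θ ] (Local.m L ≡ Factorisation.multiplicity F × r ≡ Local.w L ℕ.% l) →
        Singular (Factorisation.multiplicity F) r →
        Σ[ L ∈ Local f θ ] Singular (Local.m L) (Local.w L ℕ.% l)
      transfer (L , m≡ , r≡) bad = L , subst₂ Singular (sym m≡) r≡ bad

    singular⇒factorisation : ∀ {f : ℤₚ p → ℚₚ p} {θ} (L : Local f θ) → Singular (Local.m L) (Local.w L ℕ.% l) →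
      Σ[ F ∈ Factorisation f θ ] (¬ (l ℕD.∣ Factorisation.multiplicity F) ⊎
        (∀ {c e} → IsLeast (KillsUnits (p ^ e)) c → e ≡ exponent F → ¬ (c ℕD.∣ Factorisation.multiplicity F)))
    singular⇒factorisation {f} {θ} L bad = transfer (local-factorisation L)
      where
      transfer : Σ[ F ∈ Factorisation f θ ] (Local.m L ≡ Factorisation.multiplicity F
        × Local.w L ℕ.% l ≡ ν (Factorisation.cofactor F θ) (Factorisation.nonvanishing F) %ℕ l) →
        Σ[ F ∈ Factorisation f θ ] (¬ (l ℕD.∣ Factorisation.multiplicity F) ⊎
        (∀ {c e} → IsLeast (KillsUnits (p ^ e)) c → e ≡ exponent F → ¬ (c ℕD.∣ Factorisation.multiplicity F)))
      transfer (F , m≡ , r≡) = F , Sum.map₂ (λ unkilled c-least e≡ c∣m → unkilled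
          (killed e≡ c-least c∣m (1≤∸ (ℤDM.n%ℕd<d (ν (Factorisation.cofactor F θ) (Factorisation.nonvanishing F)) l))))
          (subst₂ Singular m≡ r≡ bad)
        where
        killed : ∀ {c e e′} → e ≡ e′ → IsLeast (KillsUnits (p ^ e)) c → c ℕD.∣ Factorisation.multiplicity F →
          1 ≤ e′ → UnitsKilled p e′ (Factorisation.multiplicity F)
        killed refl c-least c∣m 1≤e = least∣⇒UnitsKilled prime 1≤e c-least c∣m

  module _ {f : ℤₚ p → ℚₚ p} {θ : ℤₚ p} (L : Local f θ) where

    open Local L

    -- At this precision t(z) is known modulo p^(w+D), and division by pʷ leaves D digits of its
    -- unit part, as many as `ℓ` can show.
    radius : ℕ
    radius = w ℕ.+ D

    opaque
      cofactor-near : ∀ {z} → z ≋ θ [ radius ] → ∃[ γ′ ] (eval t z ≅ ϖ w ⊗ γ′ × γ′ ≋ γ [ D ])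
      cofactor-near {z} near = quotient (divide w (≋-trans (≋-down (ℕP.m≤m+n w D) close) (ϖ-≋0 γ ℕP.≤-refl)))
        where
        close : eval t z ≋ ϖ w ⊗ γ [ radius ]
        close = ≋-trans (eval-cong-≋ t near) (≅⇒≋ value)
        quotient : ∃[ γ′ ] eval t z ≅ ϖ w ⊗ γ′ → ∃[ γ′ ] (eval t z ≅ ϖ w ⊗ γ′ × γ′ ≋ γ [ D ])
        quotient (γ′ , e) = γ′ , e , ≋-cancel w (≋-trans (≅⇒≋ (≅-sym e)) close)

    cofactor-unit : ∀ {γ′} → γ′ ≋ γ [ D ] → Unit γ′
    cofactor-unit h = Unit-cong prime (1≤D) (≋-sym h) γ-unit

    near-~ : ∀ {z v u} → (z ⊖ θ) ↑ m ≅ ϖ (v ℕ.* m) ⊗ u ↑ m → ∀ {γ′} → eval t z ≅ ϖ w ⊗ γ′ →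
      f z ~ ϖ (v ℕ.* m ℕ.+ w) ⊗ (u ↑ m ⊗ γ′) [ l ℕ.* C ]
    near-~ {z} {v} {u} power {γ′} e = ~-cong {X = f z} (begin
      (z ⊖ θ) ↑ m ⊗ eval t z                           ≈⟨ *-cong power e ⟩
      (ϖ (v ℕ.* m) ⊗ u ↑ m) ⊗ (ϖ w ⊗ γ′)               ≈⟨ *-interchange _ _ _ _ ⟩
      (ϖ (v ℕ.* m) ⊗ ϖ w) ⊗ (u ↑ m ⊗ γ′)               ≈⟨ *-congʳ _ (ϖ-+ (v ℕ.* m) w) ⟨
      ϖ (v ℕ.* m ℕ.+ w) ⊗ (u ↑ m ⊗ γ′)                 ∎) (shape z)
      where open SetoidReasoning ≅-setoid

    opaque
      near-digits : ∀ {z v u} → z ≋ θ [ radius ] → (z ⊖ θ) ↑ m ≅ ϖ (v ℕ.* m) ⊗ u ↑ m → Unit u →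
        ℓ l d (f z) ≡ digits D (ϖ ((v ℕ.* m ℕ.+ w) ℕ.% l) ⊗ (u ↑ m ⊗ γ))
      near-digits {z} {v} {u} near power unit = from-cofactor (cofactor-near near)
        where
        from-cofactor : ∃[ γ′ ] (eval t z ≅ ϖ w ⊗ γ′ × γ′ ≋ γ [ D ]) →
          ℓ l d (f z) ≡ digits D (ϖ ((v ℕ.* m ℕ.+ w) ℕ.% l) ⊗ (u ↑ m ⊗ γ))
        from-cofactor (γ′ , e , γ′≋γ) = trans
          (ℓ-char em prime l d (f z) {v ℕ.* m ℕ.+ w} {u ↑ m ⊗ γ′} {C} (near-~ {z} {v} {u} power e)
            (Unit-⊗ prime (Unit-↑ prime m unit) (cofactor-unit γ′≋γ)))
          (digits-cong (*-cong-≋ ≋-refl (*-cong-≋ ≋-refl γ′≋γ)))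

      near-nonzero : ∀ {z v u} → z ≋ θ [ radius ] → (z ⊖ θ) ↑ m ≅ ϖ (v ℕ.* m) ⊗ u ↑ m → Unit u → ¬ (f z ≈ 0ₚ)
      near-nonzero {z} {v} {u} near power unit fz≈0 = from-cofactor (cofactor-near near)
        where
        from-cofactor : ∃[ γ′ ] (eval t z ≅ ϖ w ⊗ γ′ × γ′ ≋ γ [ D ]) → ⊥
        from-cofactor (γ′ , e , γ′≋γ) = ϖ-unit-≢0 prime (Unit-⊗ prime (Unit-↑ prime m unit) (cofactor-unit γ′≋γ))
          (ℕP.n<1+n (v ℕ.* m ℕ.+ w)) (≅⇒≋ (≈0⇒~ {X = f z} (near-~ {z} {v} {u} power e) fz≈0))

    power-of : ∀ {z v u} → z ⊖ θ ≅ ϖ v ⊗ u → (z ⊖ θ) ↑ m ≅ ϖ (v ℕ.* m) ⊗ u ↑ m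
    power-of {v = v} {u} e = ≅-trans (^-cong m e) (≅-trans (^-distrib-* (ϖ v) u m) (*-congʳ (u ↑ m) (ϖ-^ v m)))

    -- Only the m-th power is described: for m = 0 this includes z ≅ θ, where z ⊖ θ itself has no
    -- unit part.
    Power : ℤₚ p → Set
    Power z = ∃[ v ] ∃[ u ] ((z ⊖ θ) ↑ m ≅ ϖ (v ℕ.* m) ⊗ u ↑ m × Unit u)

    opaque
      ≇⇒power : ∀ {z} → ¬ (z ≅ θ) → Power z
      ≇⇒power {z} z≇θ = from-valuation (valuation em prime (z≇θ ∘ -≅0⇒≅))
        where
        from-valuation : ∃[ v ] ∃[ u ] (z ⊖ θ ≅ ϖ v ⊗ u × Unit u) → Power z
        from-valuation (v , u , e , unit) = v , u , power-of {z} {v} {u} e , unit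

    -- Elsewhere in the ball, f(z) is a power of p times a unit, divided by p^(lC).
    isolated : ∀ {z} → z ≋ θ [ radius ] → f z ≈ 0ₚ → z ≅ θ
    isolated {z} near fz≈0 = decidable-stable em λ z≇θ → contradict (≇⇒power z≇θ)
      where
      contradict : Power z → ⊥
      contradict (v , u , power , unit) = near-nonzero {z} {v} {u} near power unit fz≈0

    -- f is a bare function on representatives; its compatibility with equality is read off `shape`,
    -- which holds on all of ℤₚ.
    zero-cong : ∀ {z z′} → z ≅ z′ → f z ≈ 0ₚ → f z′ ≈ 0ₚ
    zero-cong {z} {z′} z≅z′ fz≈0 = ~⇒≈0 {X = f z′} (shape z′) (≅-trans
      (≅-sym (*-cong (^-cong m (-‿cong z≅z′ ≅-refl)) (≋⇒≅ (λ _ → eval-cong-≋ t (≅⇒≋ z≅z′)))))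
      (≈0⇒~ {X = f z} (shape z) fz≈0))

    nonzero⇒m≡0 : ¬ (f θ ≈ 0ₚ) → m ≡ 0
    nonzero⇒m≡0 fθ≉0 = from-exponent m refl
      where
      from-exponent : ∀ k → m ≡ k → m ≡ 0
      from-exponent zero    eq   = eq
      from-exponent (suc k) refl = ⊥-elim (fθ≉0 (~⇒≈0 {X = f θ} (shape θ)
        (≅-trans (*-congʳ _ (0↑-suc k (-‿inverse θ))) (*-zeroˡ _))))

    opaque
      nonzero⇒power : ∀ {z} → ¬ (f z ≈ 0ₚ) → Power z
      nonzero⇒power {z} fz≉0 = by-cases em
        where
        by-cases : Dec (z ≅ θ) → Power z
        by-cases (no z≇θ)  = ≇⇒power z≇θ
        by-cases (yes z≅θ) = 0 , 1ᶻ , from-exponent m refl , 1-unit prime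
          where
          from-exponent : ∀ k → m ≡ k → (z ⊖ θ) ↑ m ≅ ϖ 0 ⊗ 1ᶻ ↑ m
          from-exponent zero    refl = ≅-sym (ϖ-0 1ᶻ)
          from-exponent (suc k) refl = ⊥-elim (fz≉0 (~⇒≈0 {X = f z} (shape z)
            (≅-trans (*-congʳ _ (0↑-suc k (≅⇒-≅0 z≅θ))) (*-zeroˡ _))))

    non-singular : (f θ ≈ 0ₚ → ¬ Singular m (w ℕ.% l)) →
      l ℕD.∣ m × UnitsKilled p (l ℕ.* d ℕ.∸ w ℕ.% l) m
    non-singular h = by-cases em
      where
      by-cases : Dec (f θ ≈ 0ₚ) → l ℕD.∣ m × UnitsKilled p (l ℕ.* d ℕ.∸ w ℕ.% l) m
      by-cases (yes fθ≈0) = decidable-stable em (h fθ≈0 ∘ inj₁) , decidable-stable em (h fθ≈0 ∘ inj₂)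
      -- At a non-root m is 0, which l divides and which turns every unit into 1.
      by-cases (no fθ≉0)  = subst (λ m → l ℕD.∣ m × UnitsKilled p (l ℕ.* d ℕ.∸ w ℕ.% l) m)
        (sym (nonzero⇒m≡0 fθ≉0)) (ℕD._∣0 l , λ _ _ → ≋-refl)

    -- l ∣ m fixes the valuation modulo l, and uᵐ ≡ 1 removes the unit part.
    module _ (h : f θ ≈ 0ₚ → ¬ Singular m (w ℕ.% l)) where

      private
        l∣m = proj₁ (non-singular h)
        killed = proj₂ (non-singular h)

      opaque
        regular : ∀ {z} → z ≋ θ [ radius ] → ¬ (f z ≈ 0ₚ) → ℓ l d (f z) ≡ digits D (ϖ (w ℕ.% l) ⊗ γ)
        regular {z} near fz≉0 = from-power (nonzero⇒power fz≉0)
          where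
          from-power : Power z → ℓ l d (f z) ≡ digits D (ϖ (w ℕ.% l) ⊗ γ)
          from-power (v , u , power , unit) = trans (near-digits {z} {v} {u} near power unit) (digits-cong (begin
            ϖ ((v ℕ.* m ℕ.+ w) ℕ.% l) ⊗ (u ↑ m ⊗ γ)
              ≈⟨ ≅⇒≋ (*-congʳ _ (≅-reflexive (cong ϖ (%-absorb l w (ℕD.∣n⇒∣m*n v l∣m))))) ⟩
            ϖ r ⊗ (u ↑ m ⊗ γ)                         ≈⟨ ≅⇒≋ (*-assoc _ _ _) ⟨
            -- uᵐ ≡ 1 is known modulo p^(D - r); the factor pʳ supplies the missing r digits.
            (ϖ r ⊗ u ↑ m) ⊗ γ                         ≈⟨ *-cong-≋ (≋-level r+ (≋-+ r (killed u unit))) ≋-refl ⟩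
            (ϖ r ⊗ 1ᶻ) ⊗ γ                            ≈⟨ ≅⇒≋ (*-congʳ γ (*-identityʳ _)) ⟩
            ϖ r ⊗ γ                                   ∎))
            where
            open SetoidReasoning (≋-setoid {p} D)
            r : ℕ
            r = w ℕ.% l
            r+ : r ℕ.+ (D ℕ.∸ r) ≡ D
            r+ = ℕP.m+[n∸m]≡n (ℕP.<⇒≤ (%<D w))

  -- f does not occur, so pointwise equal sequences share their singular points. The index n = y is
  -- left out because ℓ(0) says nothing about the digits nearby.
  SingularAt : (ℕ → ℕ) → ℤₚ p → Set
  SingularAt b y = ∀ s → ∃[ n ] ∃[ n′ ]
    ((int (+ n) ≋ y [ s ] × ¬ (int (+ n) ≅ y)) × (int (+ n′) ≋ y [ s ] × ¬ (int (+ n′) ≅ y)) × b n ≢ b n′)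

  module _ {f : ℤₚ p → ℚₚ p} {θ : ℤₚ p} (L : Local f θ) (κ j : ℕ) (y : ℤₚ p) .{{_ : NonZero κ}}
           (κy+j≅θ : int (+ κ) ⊗ y ⊕ int (+ j) ≅ θ) where

    open Local L

    private
      b : ℕ → ℕ
      b n = ℓ l d (f (fromℕ (κ ℕ.* n ℕ.+ j)))

      module _ {τ : ℕ} {κ′ : ℤₚ p} (κ≅ : int (+ κ) ≅ ϖ τ ⊗ κ′) (κ′-unit : Unit κ′) where

        -- Every unit part u occurs, modulo pᴰ, at every large valuation v.
        opaque
          hit : ∀ v u → radius L ≤ v → Unit u → ∃[ n ] ((int (+ n) ≋ y [ v ] × ¬ (int (+ n) ≅ y))
            × b n ≡ digits D (ϖ (((τ ℕ.+ v) ℕ.* m ℕ.+ w) ℕ.% l) ⊗ ((κ′ ⊗ u) ↑ m ⊗ γ)))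
          hit v u r≤v unit = n , (≋-trans close-v (≅⇒≋ (+-identityʳ y)) , n≇y (proj₁ (proj₂ offset)) (proj₂ (proj₂ offset)))
              , from-offset offset
            where
            n : ℕ
            -- With v + D digits of y + pᵛ u, the difference n - y has valuation v and a unit part
            -- congruent to u modulo pᴰ.
            n = digits (v ℕ.+ D) (y ⊕ ϖ v ⊗ u)
            difference≋ : int (+ n) ⊖ y ≋ ϖ v ⊗ u [ v ℕ.+ D ]
            difference≋ = ≋-trans (-‿cong-≋ (≋-sym (digits-≋ (y ⊕ ϖ v ⊗ u) (v ℕ.+ D))) ≋-refl) (≅⇒≋ (x+y-x y (ϖ v ⊗ u)))
            close-v : int (+ n) ≋ y ⊕ 0ᶻ [ v ]
            close-v = ≋-trans (≋-down (ℕP.m≤m+n v D) (≋-sym (digits-≋ (y ⊕ ϖ v ⊗ u) (v ℕ.+ D))))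
              (+-cong-≋ ≋-refl (ϖ-≋0 u ℕP.≤-refl))
            quotient : ∃[ u′ ] int (+ n) ⊖ y ≅ ϖ v ⊗ u′ → ∃[ u′ ] (int (+ n) ⊖ y ≅ ϖ v ⊗ u′ × u′ ≋ u [ D ])
            quotient (u′ , e) = u′ , e , ≋-cancel v (≋-trans (≅⇒≋ (≅-sym e)) difference≋)
            offset : ∃[ u′ ] (int (+ n) ⊖ y ≅ ϖ v ⊗ u′ × u′ ≋ u [ D ])
            offset = quotient (divide v (≋-trans (≋-down (ℕP.m≤m+n v D) difference≋) (ϖ-≋0 u ℕP.≤-refl)))
            unit′ : ∀ {u′} → u′ ≋ u [ D ] → Unit u′
            unit′ h = Unit-cong prime (1≤D) (≋-sym h) unit
            n≇y : ∀ {u′} → int (+ n) ⊖ y ≅ ϖ v ⊗ u′ → u′ ≋ u [ D ] → ¬ (int (+ n) ≅ y)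
            n≇y e h n≅y = ϖ-unit-≢0 prime (unit′ h) (ℕP.n<1+n v) (≅⇒≋ (≅-trans (≅-sym e) (≅⇒-≅0 n≅y)))
            z : ℤₚ p
            z = fromℕ (κ ℕ.* n ℕ.+ j)
            z⊖θ : ∀ {u′} → int (+ n) ⊖ y ≅ ϖ v ⊗ u′ → z ⊖ θ ≅ ϖ (τ ℕ.+ v) ⊗ (κ′ ⊗ u′)
            z⊖θ {u′} e = begin
              z ⊖ θ                                       ≈⟨ -‿cong ≅-refl κy+j≅θ ⟨
              z ⊖ (int (+ κ) ⊗ y ⊕ int (+ j))             ≈⟨ int-offset prime κ n j y ⟩
              int (+ κ) ⊗ (int (+ n) ⊖ y)                 ≈⟨ *-cong κ≅ e ⟩
              (ϖ τ ⊗ κ′) ⊗ (ϖ v ⊗ u′)                     ≈⟨ *-interchange _ _ _ _ ⟩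
              (ϖ τ ⊗ ϖ v) ⊗ (κ′ ⊗ u′)                     ≈⟨ *-congʳ _ (ϖ-+ τ v) ⟨
              ϖ (τ ℕ.+ v) ⊗ (κ′ ⊗ u′)                     ∎
              where open SetoidReasoning ≅-setoid
            from-offset : ∃[ u′ ] (int (+ n) ⊖ y ≅ ϖ v ⊗ u′ × u′ ≋ u [ D ]) →
              b n ≡ digits D (ϖ (((τ ℕ.+ v) ℕ.* m ℕ.+ w) ℕ.% l) ⊗ ((κ′ ⊗ u) ↑ m ⊗ γ))
            from-offset (u′ , e , u′≋u) = trans
              (near-digits L {z} {τ ℕ.+ v} {κ′ ⊗ u′}
                (-≋0⇒≋ (≋-trans (≅⇒≋ (z⊖θ e)) (ϖ-≋0 _ (ℕP.≤-trans r≤v (ℕP.m≤n+m v τ)))))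
                (power-of L {z} {τ ℕ.+ v} {κ′ ⊗ u′} (z⊖θ e)) (Unit-⊗ prime κ′-unit (unit′ u′≋u)))
              (digits-cong (*-cong-≋ ≋-refl (*-cong-≋ (^-cong-≋ m (*-cong-≋ ≋-refl u′≋u)) ≋-refl)))

        -- Raising v by one raises the exponent of p by m. The digits reveal this exponent modulo l,
        -- so equal digits would force l ∣ m.
        singular-valuation : ¬ (l ℕD.∣ m) → SingularAt b y
        singular-valuation l∤m s = compare (hit v 1ᶻ r≤v (1-unit prime)) (hit (suc v) 1ᶻ (ℕP.m≤n⇒m≤1+n r≤v) (1-unit prime))
          where
          v : ℕ
          v = s ℕ.+ radius L
          r≤v : radius L ≤ v
          r≤v = ℕP.m≤n+m (radius L) s
          a : ℕ
          a = (τ ℕ.+ v) ℕ.* m ℕ.+ w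
          next : (τ ℕ.+ suc v) ℕ.* m ℕ.+ w ≡ m ℕ.+ a
          next = trans (cong (λ k → k ℕ.* m ℕ.+ w) (ℕP.+-suc τ v)) (ℕP.+-assoc m ((τ ℕ.+ v) ℕ.* m) w)
          U : ℤₚ p
          U = (κ′ ⊗ 1ᶻ) ↑ m ⊗ γ
          U-unit : Unit U
          U-unit = Unit-⊗ prime (Unit-↑ prime m (Unit-⊗ prime κ′-unit (1-unit prime))) γ-unit
          compare : ∃[ n ] ((int (+ n) ≋ y [ v ] × ¬ (int (+ n) ≅ y)) × b n ≡ digits D (ϖ (a ℕ.% l) ⊗ U)) →
            ∃[ n ] ((int (+ n) ≋ y [ suc v ] × ¬ (int (+ n) ≅ y))
                × b n ≡ digits D (ϖ (((τ ℕ.+ suc v) ℕ.* m ℕ.+ w) ℕ.% l) ⊗ U)) →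
            ∃[ n ] ∃[ n′ ] ((int (+ n) ≋ y [ s ] × ¬ (int (+ n) ≅ y)) × (int (+ n′) ≋ y [ s ] × ¬ (int (+ n′) ≅ y))
                × b n ≢ b n′)
          compare (n , (c , ≇) , e) (n′ , (c′ , ≇′) , e′) = n , n′
            , (≋-down (ℕP.m≤m+n s _) c , ≇) , (≋-down (ℕP.m≤n⇒m≤1+n (ℕP.m≤m+n s _)) c′ , ≇′)
            , λ eq → l∤m (%-cancel l a m (sym (trans
                (valuation-unique-≋ prime U-unit U-unit (%<D a) (%<D _)
                  (digits-injective (trans (sym e) (trans eq e′))))
                (cong (ℕ._% l) next))))

        -- The unit parts 1 and u are compared at the same valuation. Equal digits would give uᵐ ≡ 1
        -- after cancelling pʳ and the unit κ′ᵐ γ.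
        singular-unit : l ℕD.∣ m → ∀ u → Unit u → ¬ (u ↑ m ≋ 1ᶻ [ l ℕ.* d ℕ.∸ w ℕ.% l ]) → SingularAt b y
        singular-unit l∣m u unit unkilled s = compare (hit v 1ᶻ r≤v (1-unit prime)) (hit v u r≤v unit)
          where
          v : ℕ
          v = s ℕ.+ radius L
          r≤v : radius L ≤ v
          r≤v = ℕP.m≤n+m (radius L) s
          a r : ℕ
          a = (τ ℕ.+ v) ℕ.* m ℕ.+ w
          r = w ℕ.% l
          a%l : a ℕ.% l ≡ r
          a%l = %-absorb l w (ℕD.∣n⇒∣m*n (τ ℕ.+ v) l∣m)
          factor : ∀ u → (κ′ ⊗ u) ↑ m ⊗ γ ≅ (κ′ ↑ m ⊗ γ) ⊗ u ↑ m
          factor u = ≅-trans (*-congʳ γ (^-distrib-* κ′ u m)) (≅-trans (*-assoc _ _ _)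
            (≅-trans (*-congˡ _ (*-comm _ _)) (≅-sym (*-assoc _ _ _))))
          cancelled : ϖ (a ℕ.% l) ⊗ ((κ′ ⊗ 1ᶻ) ↑ m ⊗ γ) ≋ ϖ (a ℕ.% l) ⊗ ((κ′ ⊗ u) ↑ m ⊗ γ) [ D ] → u ↑ m ≋ 1ᶻ [ D ℕ.∸ r ]
          cancelled h = ≋-sym (unit-cancel prime (Unit-⊗ prime (Unit-↑ prime m κ′-unit) γ-unit)
            (≋-trans (*-cong-≋ ≋-refl (≅⇒≋ (≅-sym (1^ m)))) (≋-trans (≅⇒≋ (≅-sym (factor 1ᶻ)))
              (≋-trans (≋-cancel r (≋-level (sym (ℕP.m+[n∸m]≡n (ℕP.<⇒≤ (%<D w))))
                (subst (λ r → ϖ r ⊗ ((κ′ ⊗ 1ᶻ) ↑ m ⊗ γ) ≋ ϖ r ⊗ ((κ′ ⊗ u) ↑ m ⊗ γ) [ D ]) a%l h))) (≅⇒≋ (factor u))))))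
          Hit : ℤₚ p → Set
          Hit u = ∃[ n ] ((int (+ n) ≋ y [ v ] × ¬ (int (+ n) ≅ y)) × b n ≡ digits D (ϖ (a ℕ.% l) ⊗ ((κ′ ⊗ u) ↑ m ⊗ γ)))
          compare : Hit 1ᶻ → Hit u →
            ∃[ n ] ∃[ n′ ] ((int (+ n) ≋ y [ s ] × ¬ (int (+ n) ≅ y)) × (int (+ n′) ≋ y [ s ] × ¬ (int (+ n′) ≅ y))
                × b n ≢ b n′)
          compare (n , (c , ≇) , e) (n′ , (c′ , ≇′) , e′) = n , n′
            , (≋-down (ℕP.m≤m+n s _) c , ≇) , (≋-down (ℕP.m≤m+n s _) c′ , ≇′)
            , λ eq → unkilled (cancelled (digits-injective (trans (sym e) (trans eq e′))))

    opaque
      -- Writing κ = p^τ κ′ with κ′ a unit, passage to the kernel sequence shifts all valuations by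
      -- τ and multiplies all unit parts by κ′. Neither hides a dependence on v or u.
      singular : Singular m (w ℕ.% l) → SingularAt b y
      singular bad = from-valuation (valuation em prime (pos≇0 prime κ))
        where
        from-valuation : ∃[ τ ] ∃[ κ′ ] (int {p} (+ κ) ≅ ϖ τ ⊗ κ′ × Unit κ′) → SingularAt b y
        from-valuation (τ , κ′ , κ≅ , unit) = by-cases (l ℕD.∣? m) bad
          where
          by-cases : Dec (l ℕD.∣ m) → Singular m (w ℕ.% l) → SingularAt b y
          by-cases (no l∤m)  _               = singular-valuation κ≅ unit l∤m
          by-cases (yes l∣m) (inj₁ l∤m)      = contradiction l∣m l∤m
          by-cases (yes l∣m) (inj₂ unkilled) = from-unit (decidable-stable em λ none →
            unkilled λ u u-unit → decidable-stable em λ h → none (u , u-unit , h))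
            where
            from-unit : ∃[ u ] (Unit {p} u × ¬ (u ↑ m ≋ 1ᶻ [ l ℕ.* d ℕ.∸ w ℕ.% l ])) → SingularAt b y
            from-unit (u , u-unit , h) = singular-unit κ≅ unit l∣m u u-unit h

  -- Covering balls, separation of roots and singular points of kernel sequences

  module _ {f : ℤₚ p → ℚₚ p} (f-analytic : Analytic f) (nonzero : ¬ (∀ x → f x ≈ 0ₚ)) where

    private
      loc : ∀ x → Local f x
      loc = local {f} f-analytic nonzero

      r : ℤₚ p → ℕ
      r x = radius (loc x)

      balls : ∃[ S ] (∀ z → ∃[ x ] ∃[ s ] (s ≤ S × z ≋ x [ s ] × s ≡ r x))
      balls = compact em prime (λ x s → s ≡ r x) (λ x → r x , refl)

    seq : ℕ → ℕ
    seq n = ℓ l d (f (fromℕ n))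

    -- One modulus for all of ℤₚ: points congruent modulo `p ^ level` lie in a common ball around
    -- some center.
    level : ℕ
    level = proj₁ balls

    center : ∀ z → ∃[ x ] (r x ≤ level × z ≋ x [ r x ])
    center z = strip (proj₂ balls z)
      where
      strip : ∃[ x ] ∃[ s ] (s ≤ level × z ≋ x [ s ] × s ≡ r x) → ∃[ x ] (r x ≤ level × z ≋ x [ r x ])
      strip (x , _ , s≤ , near , refl) = x , s≤ , near

    -- Both roots lie in a common ball, whose only possible root is its center. Hence f has at most
    -- `p ^ level` roots.
    roots-separated : ∀ {z z′} → f z ≈ 0ₚ → f z′ ≈ 0ₚ → z ≋ z′ [ level ] → z ≅ z′
    roots-separated {z} {z′} fz≈0 fz′≈0 z≋z′ = from-center (center z)
      where
      from-center : ∃[ x ] (r x ≤ level × z ≋ x [ r x ]) → z ≅ z′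
      from-center (x , r≤ , near) = ≅-trans (isolated (loc x) near fz≈0)
        (≅-sym (isolated (loc x) (≋-trans (≋-down r≤ (≋-sym z≋z′)) near) fz′≈0))

    near-nonroot : ∀ {x z} → z ≋ x [ r x ] → ¬ (f x ≈ 0ₚ) → ¬ (f z ≈ 0ₚ)
    near-nonroot {x} near fx≉0 fz≈0 =
      fx≉0 (zero-cong (loc x) (isolated (loc x) near fz≈0) fz≈0)

    -- Around a non-root the digits of f are constant, and κ n + j approaches κ y + j as n
    -- approaches y.
    singular⇒root : ∀ κ j .{{_ : NonZero κ}} y → SingularAt (λ n → seq (κ ℕ.* n ℕ.+ j)) y →
      f (int (+ κ) ⊗ y ⊕ int (+ j)) ≈ 0ₚ
    singular⇒root κ j y sing = decidable-stable em λ fθ≉0 → contradict fθ≉0 (sing (r θ))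
      where
      θ : ℤₚ p
      θ = int (+ κ) ⊗ y ⊕ int (+ j)
      near : ∀ n → int (+ n) ≋ y [ r θ ] → fromℕ (κ ℕ.* n ℕ.+ j) ≋ θ [ r θ ]
      near n h = -≋0⇒≋ (≋-trans (≅⇒≋ (int-offset prime κ n j y)) (*-≋0ʳ _ (≋⇒-≋0 h)))
      contradict : ¬ (f θ ≈ 0ₚ) → ∃[ n ] ∃[ n′ ] ((int (+ n) ≋ y [ r θ ] × ¬ (int (+ n) ≅ y)) ×
        (int (+ n′) ≋ y [ r θ ] × ¬ (int (+ n′) ≅ y)) × seq (κ ℕ.* n ℕ.+ j) ≢ seq (κ ℕ.* n′ ℕ.+ j)) → ⊥
      contradict fθ≉0 (n , n′ , (h , _) , (h′ , _) , ≢) = ≢ (trans (constant n h) (sym (constant n′ h′)))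
        where
        constant : ∀ n → int (+ n) ≋ y [ r θ ] → seq (κ ℕ.* n ℕ.+ j) ≡
            digits (l ℕ.* d) (ϖ (Local.w (loc θ) ℕ.% l) ⊗ Local.γ (loc θ))
        constant n h = regular (loc θ) (λ fθ≈0 → ⊥-elim (fθ≉0 fθ≈0)) (near n h) (near-nonroot (near n h) fθ≉0)

    module _ {k : ℕ} .{{_ : NonZero k}} {θ : ℤₚ p} (L : Local f θ)
             (bad : Singular (Local.m L) (Local.w L ℕ.% l)) where

      private
        kernel : ℕ → ℕ → ℕ → ℕ
        kernel κ j n = seq (κ ℕ.* n ℕ.+ j)

      point-singular : ∀ {i j} (P : Point k θ i j) → SingularAt (kernel (k ^ i) j) (y P)
      point-singular {i} {j} P = singular L (k ^ i) j (y P) {{ℕP.m^n≢0 k i}} (equation P) bad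

      SingularAt-≗ : ∀ {b b′} {y : ℤₚ p} → b ≗ b′ → SingularAt b y → SingularAt b′ y
      SingularAt-≗ b≗b′ sing s = let n , n′ , h , h′ , ≢ = sing s in
        n , n′ , h , h′ , λ eq → ≢ (trans (b≗b′ n) (trans eq (sym (b≗b′ n′))))

      -- A kernel sequence has at most as many singular points as f has roots,
      -- so a finite kernel leaves room for finitely many points only.
      module _ (ss : List (ℕ → ℕ)) where

        private
          Representative : Fin (length ss) → Set
          Representative c = ∃[ κ ] ∃[ j ] (NonZero κ × lookup ss c ≗ kernel κ j)

          -- κ and j belong to one chosen representative of the list entry and not to the point. So
          -- points over different powers of k are compared through the same injective map y ↦ κ y +
          -- j into the roots.
          codeBy : ∀ {c} → Dec (Representative c) → ℤₚ p → Fin (p ^ level)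
          codeBy (yes (κ , j , _)) y = fromℕ< (digits< level (int (+ κ) ⊗ y ⊕ int (+ j)))
          -- A default value: every entry that is hit by a point has a representative.
          codeBy (no _)            y = fromℕ< (digits< level y)

          codeBy-injective : ∀ {c} (rep? : Dec (Representative c)) → Representative c → ∀ {y y′} →
            SingularAt (lookup ss c) y → SingularAt (lookup ss c) y′ →
            codeBy rep? y ≡ codeBy rep? y′ → y ≅ y′
          codeBy-injective (no none) rep _ _ _ = contradiction rep none
          codeBy-injective (yes (κ , j , κ≢0 , agree)) _ {y} {y′} sing sing′ eq =
            ⊗-cancelˡ em prime (pos≇0 prime κ {{κ≢0}}) (begin
              int (+ κ) ⊗ y                                       ≈⟨ x+y-y _ (int (+ j)) ⟨
              (int (+ κ) ⊗ y ⊕ int (+ j)) ⊖ int (+ j)             ≈⟨ -‿cong (roots-separated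
                (singular⇒root κ j {{κ≢0}} y (SingularAt-≗ agree sing))
                    (singular⇒root κ j {{κ≢0}} y′ (SingularAt-≗ agree sing′))
                (digits-injective (FinP.fromℕ<-injective _ _ _ _ eq))) ≅-refl ⟩
              (int (+ κ) ⊗ y′ ⊕ int (+ j)) ⊖ int (+ j)            ≈⟨ x+y-y _ (int (+ j)) ⟩
              int (+ κ) ⊗ y′                                      ∎)
            where open SetoidReasoning (≅-setoid {p})

        -- Pigeonhole on pairs of a list entry and a residue modulo `p ^ level`. Within one entry
        -- the residue determines the root, and the root determines the point.
        collision : (∀ i j → j < k ^ i → Any (kernel (k ^ i) j ≗_) ss) →
          (i j : Fin (suc (length ss ℕ.* p ^ level)) → ℕ) (P : ∀ c → Point k θ (i c) (j c)) →
          ∃[ c ] ∃[ c′ ] (c Fin.< c′ × y (P c) ≅ y (P c′))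
        collision cover i j P = found (FinP.pigeonhole (ℕP.n<1+n _) code)
          where
          place : ∀ c → Any (kernel (k ^ i c) (j c) ≗_) ss
          place c = cover (i c) (j c) (j<kⁱ (P c))
          index : ∀ c → Fin (length ss)
          index c = Any.index (place c)
          at-index : ∀ c → kernel (k ^ i c) (j c) ≗ lookup ss (index c)
          at-index c = AnyP.lookup-index (place c)
          rep : ∀ c → Representative (index c)
          rep c = k ^ i c , j c , ℕP.m^n≢0 k (i c) , λ n → sym (at-index c n)
          code : Fin (suc (length ss ℕ.* p ^ level)) → Fin (length ss ℕ.* p ^ level)
          code c = Fin.combine (index c) (codeBy (em {Representative (index c)}) (y (P c)))
          sing : ∀ c → SingularAt (lookup ss (index c)) (y (P c))
          sing c = SingularAt-≗ (at-index c) (point-singular (P c))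
          same : ∀ {I I′} y y′ → I ≡ I′ → codeBy (em {Representative I}) y ≡ codeBy (em {Representative I′}) y′ →
            Representative I → SingularAt (lookup ss I) y → SingularAt (lookup ss I′) y′ → y ≅ y′
          same {I} y y′ refl eq rep s s′ = codeBy-injective {I} em rep {y} {y′} s s′ eq
          found : ∃[ c ] ∃[ c′ ] (c Fin.< c′ × code c ≡ code c′) → ∃[ c ] ∃[ c′ ] (c Fin.< c′ × y (P c) ≅ y (P c′))
          found (c , c′ , c<c′ , eq) = c , c′ , c<c′ , uncurried (FinP.combine-injective (index c) _ (index c′) _ eq)
            where
            uncurried : index c ≡ index c′ × codeBy (em {Representative (index c)}) (y (P c)) ≡ codeBy (em {Representative (index c′)}) (y (P c′))
                → y (P c) ≅ y (P c′)
            uncurried (e , e′) = same (y (P c)) (y (P c′)) e e′ (rep c) (sing c) (sing c′)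

    -- Points over the powers of k, and failure of automaticity

    module _ (k t k′ : ℕ) (k≡ : k ≡ p ^ t ℕ.* k′) (p∤k′ : ¬ (p ℕD.∣ k′)) (θ : ℤₚ p) where

      -- Since k′ⁱ is a unit, (θ - j)/kⁱ lies in ℤₚ exactly if j ≡ θ modulo p^(ti). The s below k′ⁱ
      -- number the solutions j below kⁱ.
      offset : ℕ → ℕ → ℕ
      offset i s = digits (t ℕ.* i) θ ℕ.+ p ^ (t ℕ.* i) ℕ.* s

      kⁱ≡ : ∀ i → k ^ i ≡ p ^ (t ℕ.* i) ℕ.* k′ ^ i
      kⁱ≡ i = trans (cong (_^ i) k≡) (trans (^-distribʳ-* (p ^ t) k′ i) (cong (ℕ._* k′ ^ i) (ℕP.^-*-assoc p t i)))

      point : ∀ i s → s < k′ ^ i → Point k θ i (offset i s)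
      point i s s<k′ⁱ = from-quotient (divide τ (≋⇒-≋0 (≋-trans (digits-≋ θ τ) (≋-sym
          (int-affine-≋ τ s (digits τ θ))))))
                                      (inverse em prime (int (+ (k′ ^ i))) (prime∤^ prime p∤k′ i ∘ int-∣ em prime))
        where
        τ : ℕ
        τ = t ℕ.* i
        j : ℕ
        j = offset i s
        bound : j < k ^ i
        bound = ℕP.<-≤-trans (ℕP.+-monoˡ-< (p ^ τ ℕ.* s) (digits< τ θ))
          (subst₂ _≤_ (ℕP.*-suc (p ^ τ) s) (sym (kⁱ≡ i)) (ℕP.*-monoʳ-≤ (p ^ τ) s<k′ⁱ))
        from-quotient : ∃[ q ] θ ⊖ int (+ j) ≅ ϖ τ ⊗ q → ∃[ v ] int (+ (k′ ^ i)) ⊗ v ≅ 1ᶻ → Point k θ i j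
        from-quotient (q , e) (v , e′) = record { j<kⁱ = bound ; y = v ⊗ q ; equation = solved }
          where
          open SetoidReasoning (≅-setoid {p})
          solved : int (+ (k ^ i)) ⊗ (v ⊗ q) ⊕ int (+ j) ≅ θ
          solved = begin
            int (+ (k ^ i)) ⊗ (v ⊗ q) ⊕ int (+ j)                        ≈⟨ +-cong (*-congʳ _ (≅-reflexive (cong int
              (trans (cong +_ (kⁱ≡ i)) (ℤP.pos-* (p ^ τ) (k′ ^ i)))))) ≅-refl ⟩
            int (+ (p ^ τ) ℤ.* + (k′ ^ i)) ⊗ (v ⊗ q) ⊕ int (+ j)
              ≈⟨ +-cong (*-congʳ _ (≅-trans (int-⊗ _ _) (*-congʳ _ (≅-sym (ϖ-int τ))))) ≅-refl ⟩
            (ϖ τ ⊗ int (+ (k′ ^ i))) ⊗ (v ⊗ q) ⊕ int (+ j)               ≈⟨ +-cong (*-assoc _ _ _) ≅-refl ⟩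
            ϖ τ ⊗ (int (+ (k′ ^ i)) ⊗ (v ⊗ q)) ⊕ int (+ j)
              ≈⟨ +-cong (*-congˡ (ϖ τ) (≅-trans (≅-sym (*-assoc _ v q))
              (≅-trans (*-congʳ q e′) (*-identityˡ q)))) ≅-refl ⟩
            ϖ τ ⊗ q ⊕ int (+ j)                                          ≈⟨ +-cong e ≅-refl ⟨
            (θ ⊖ int (+ j)) ⊕ int (+ j)                                  ≈⟨ x-y+y θ (int (+ j)) ⟩
            θ                                                            ∎

    -- Two points over different powers of k determine θ by a linear equation.
    points-rational : ∀ {k θ i j i′ j′} → 1 < k → (P : Point k θ i j) (Q : Point k θ i′ j′) →
      i < i′ → y P ≅ y Q → Rational θ
    points-rational {k} {θ} {i} {j} {i′} {j′} 1<k P Q i<i′ y≅y′ =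
      rational-by-equation em prime (K′ ℤ.* J ℤ.- K ℤ.* J′) (k ^ i′ ℕ.∸ k ^ i) {{ℕ.>-nonZero (ℕP.m<n⇒0<n∸m kⁱ<)}} (begin
        int (+ (k ^ i′ ℕ.∸ k ^ i)) ⊗ θ                              ≈⟨ *-congʳ θ (≅-reflexive (cong int difference≡)) ⟩
        int (K′ ℤ.- K) ⊗ θ                                             ≈⟨ expand K′ K θ ⟩
        int K′ ⊗ θ ⊖ int K ⊗ θ
          ≈⟨ -‿cong (*-congˡ _ (equation P)) (*-congˡ _ (equation Q)) ⟨
        int K′ ⊗ (int K ⊗ y P ⊕ int J) ⊖ int K ⊗ (int K′ ⊗ y Q ⊕ int J′)
          ≈⟨ -‿cong ≅-refl (*-congˡ _ (+-cong (*-congˡ _ y≅y′) ≅-refl)) ⟨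
        int K′ ⊗ (int K ⊗ y P ⊕ int J) ⊖ int K ⊗ (int K′ ⊗ y P ⊕ int J′)   ≈⟨ eliminate K K′ J J′ (y P) ⟩
        int (K′ ℤ.* J ℤ.- K ℤ.* J′)                                    ∎)
      where
      open SetoidReasoning (≅-setoid {p})
      K K′ J J′ : ℤ
      K = + (k ^ i)
      K′ = + (k ^ i′)
      J = + j
      J′ = + j′
      kⁱ< : k ^ i < k ^ i′
      kⁱ< = ℕP.^-monoʳ-< k 1<k i<i′
      difference≡ : + (k ^ i′ ℕ.∸ k ^ i) ≡ K′ ℤ.- K
      difference≡ = sym (trans (ℤP.[+m]-[+n]≡m⊖n (k ^ i′) (k ^ i)) (ℤP.⊖-≥ (ℕP.<⇒≤ kⁱ<)))
      opaque
        unfolding _⊕_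
        expand : ∀ a b (x : ℤₚ p) → int (a ℤ.- b) ⊗ x ≅ int a ⊗ x ⊖ int b ⊗ x
        expand a b x = identity λ n → lemma a b (residue x n)
          where
          lemma : ∀ a b x → (a ℤ.- b) ℤ.* x ≡ a ℤ.* x ℤ.+ ℤ.-1ℤ ℤ.* (b ℤ.* x)
          lemma = solve-∀
        eliminate : ∀ a b c e (x : ℤₚ p) →
          int b ⊗ (int a ⊗ x ⊕ int c) ⊖ int a ⊗ (int b ⊗ x ⊕ int e) ≅ int (b ℤ.* c ℤ.- a ℤ.* e)
        eliminate a b c e x = identity λ n → lemma a b c e (residue x n)
          where
          lemma : ∀ a b c e x → b ℤ.* (a ℤ.* x ℤ.+ c) ℤ.+ ℤ.-1ℤ ℤ.* (a ℤ.* (b ℤ.* x ℤ.+ e)) ≡ b ℤ.* c ℤ.- a ℤ.* e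
          lemma = solve-∀

    module _ {θ : ℤₚ p} (L : Local f θ)
             (bad : Singular (Local.m L) (Local.w L ℕ.% l)) where

      irrational⇒¬automatic : ¬ Rational θ → ∀ k → 2 ≤ k → ¬ Automatic[ k ] seq
      irrational⇒¬automatic irrational k 2≤k (ss , cover) = from-factor (factor-out p (p>1 prime) k (ℕP.<⇒≤ 2≤k))
        where
        from-factor : ∃[ t ] ∃[ k′ ] (k ≡ p ^ t ℕ.* k′ × ¬ (p ℕD.∣ k′)) → ⊥
        from-factor (t , k′ , k≡ , p∤k′) = from-collision (collision
            {k} {{ℕ.>-nonZero (ℕP.<⇒≤ 2≤k)}} {θ} L bad ss cover toℕ _ P)
          where
          k′≢0 : NonZero k′
          k′≢0 = ℕ.≢-nonZero λ { refl → p∤k′ (ℕD._∣0 p) }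
          P : ∀ (c : Fin (suc (length ss ℕ.* p ^ level))) →
            Point k θ (toℕ c) (offset k t k′ k≡ p∤k′ θ (toℕ c) 0)
          P c = point k t k′ k≡ p∤k′ θ (toℕ c) 0 (ℕ.>-nonZero⁻¹ (k′ ^ toℕ c) {{ℕP.m^n≢0 k′ (toℕ c) {{k′≢0}}}})
          from-collision : ∃[ c ] ∃[ c′ ] (c Fin.< c′ × y (P c) ≅ y (P c′)) → ⊥
          from-collision (c , c′ , c<c′ , e) = irrational (points-rational 2≤k (P c) (P c′) c<c′ e)

      independent⇒¬automatic : ∀ k → 2 ≤ k → (∀ t → k ≢ p ^ t) → ¬ Automatic[ k ] seq
      independent⇒¬automatic k 2≤k not-power (ss , cover) = from-factor (factor-out p (p>1 prime) k (ℕP.<⇒≤ 2≤k))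
        where
        from-factor : ∃[ t ] ∃[ k′ ] (k ≡ p ^ t ℕ.* k′ × ¬ (p ℕD.∣ k′)) → ⊥
        from-factor (t , k′ , k≡ , p∤k′) = from-collision (collision
            {k} {{ℕ.>-nonZero (ℕP.<⇒≤ 2≤k)}} {θ} L bad ss cover (λ _ → M) _ P)
          where
          1<k′ : 1 < k′
          1<k′ = ℕP.≤∧≢⇒< (ℕP.n≢0⇒n>0 λ { refl → p∤k′ (ℕD._∣0 p) })
            λ { refl → not-power t (trans k≡ (ℕP.*-identityʳ (p ^ t))) }
          -- M is both the number of points wanted and the exponent i; k′ > 1 makes k′^M larger than
          -- M, which leaves room for them.
          M : ℕ
          M = suc (length ss ℕ.* p ^ level)
          P : ∀ (c : Fin M) → Point k θ M (offset k t k′ k≡ p∤k′ θ M (toℕ c))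
          P c = point k t k′ k≡ p∤k′ θ M (toℕ c) (ℕP.<-trans (FinP.toℕ<n c) (n<b^n 1<k′ M))
          from-collision : ∃[ c ] ∃[ c′ ] (c Fin.< c′ × y (P c) ≅ y (P c′)) → ⊥
          -- Equal points over the same k^M have the same offset θ - k^M y, and hence the same s.
          from-collision (c , c′ , c<c′ , e) = ℕP.<⇒≢ c<c′ (ℕP.*-cancelˡ-≡ (toℕ c) (toℕ c′) (p ^ (t ℕ.* M)) {{p^≢0 (t ℕ.* M)}}
            (ℕP.+-cancelˡ-≡ (digits (t ℕ.* M) θ) _ _ (int-injective em prime (begin
              int (+ offset k t k′ k≡ p∤k′ θ M (toℕ c))       ≈⟨ x+y-x _ _ ⟨
              (Kᶻ ⊗ y (P c) ⊕ int (+ offset k t k′ k≡ p∤k′ θ M (toℕ c))) ⊖ Kᶻ ⊗ y (P c)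
                ≈⟨ -‿cong (≅-trans (equation (P c)) (≅-sym (equation (P c′)))) (*-congˡ Kᶻ e) ⟩
              (Kᶻ ⊗ y (P c′) ⊕ int (+ offset k t k′ k≡ p∤k′ θ M (toℕ c′))) ⊖ Kᶻ ⊗ y (P c′)  ≈⟨ x+y-x _ _ ⟩
              int (+ offset k t k′ k≡ p∤k′ θ M (toℕ c′))      ∎))))
            where
            open SetoidReasoning (≅-setoid {p})
            Kᶻ : ℤₚ p
            Kᶻ = int (+ (k ^ M))

    -- Periodicity in the absence of singular roots

    private
      Bad : ℤₚ p → Set
      Bad x = Singular (Local.m (loc x)) (Local.w (loc x) ℕ.% l)

      fromℕ-≋ : ∀ {n n′ k} → int {p} (+ n) ≋ int (+ n′) [ k ] → fromℕ n ≋ fromℕ n′ [ k ]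
      fromℕ-≋ h = ≋-trans (≅⇒≋ (fromℕ≅int em prime _)) (≋-trans h (≅⇒≋ (≅-sym (fromℕ≅int em prime _))))

    -- Each residue class modulo `p ^ level` contains at most one root. The bound becomes the
    -- preperiod: beyond it the exceptional value ℓ(0) does not occur.
    natural-roots-bounded : ∃[ N ] (∀ n → f (fromℕ n) ≈ 0ₚ → n < N)
    natural-roots-bounded = collect (bounded-choice Q (λ S≤S′ q n root eq → ℕP.≤-trans (q n root eq) S≤S′)
        (p ^ level) (λ c _ → bound c em))
      where
      Q : ℕ → ℕ → Set
      Q c N = ∀ n → f (fromℕ n) ≈ 0ₚ → digits {p} level (fromℕ n) ≡ c → n < N
      bound : ∀ c → Dec (∃[ n ] (f (fromℕ n) ≈ 0ₚ × digits {p} level (fromℕ n) ≡ c)) → ∃[ N ] Q c N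
      bound c (no none) = 0 , λ n root eq → ⊥-elim (none (n , root , eq))
      bound c (yes (n₀ , root₀ , eq₀)) = suc n₀ , λ n root eq → s≤s (ℕP.≤-reflexive (int-injective em prime
        (≅-trans (≅-sym (fromℕ≅int em prime n)) (≅-trans (roots-separated root root₀
          (digits-injective (trans eq (sym eq₀)))) (fromℕ≅int em prime n₀)))))
      collect : ∃[ N ] (∀ c → c < p ^ level → Q c N) → ∃[ N ] (∀ n → f (fromℕ n) ≈ 0ₚ → n < N)
      collect (N , q) = N , λ n root → q _ (digits< level (fromℕ n)) n root refl

    constant-near : ∀ {x z z′} → (f x ≈ 0ₚ → ¬ Bad x) → z ≋ x [ r x ] → z′ ≋ x [ r x ] →
      ¬ (f z ≈ 0ₚ) → ¬ (f z′ ≈ 0ₚ) → ℓ l d (f z) ≡ ℓ l d (f z′)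
    constant-near {x} {z} {z′} good near near′ fz≉0 fz′≉0 =
      trans (regular (loc x) good near fz≉0) (sym (regular (loc x) good near′ fz′≉0))

    -- The numbers n and n + `p ^ level` share a ball, in which the digits are constant outside the
    -- zeros of f.
    periodic : (∀ x → f x ≈ 0ₚ → ¬ Bad x) →
      ∃[ s ] ∃[ N ] (PeriodicFrom N (p ^ s) seq × ((∀ n → ¬ (f (fromℕ n) ≈ 0ₚ)) → N ≡ 0))
    periodic good = from-bound natural-roots-bounded em
      where
      1≤p^level : 1 ≤ p ^ level
      1≤p^level = ℕ.>-nonZero⁻¹ (p ^ level) {{p^≢0 level}}
      step : ∀ n → ¬ (f (fromℕ n) ≈ 0ₚ) → ¬ (f (fromℕ (n ℕ.+ p ^ level)) ≈ 0ₚ) → seq (n ℕ.+ p ^ level) ≡ seq n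
      step n ≉ ≉′ = from-center (center (fromℕ n))
        where
        from-center : ∃[ x ] (r x ≤ level × fromℕ n ≋ x [ r x ]) → seq (n ℕ.+ p ^ level) ≡ seq n
        from-center (x , r≤level , near) = constant-near (good x) (≋-trans (≋-down r≤level (fromℕ-≋
          (subst (λ t → int {p} (+ (n ℕ.+ t)) ≋ int (+ n) [ level ]) (ℕP.*-identityʳ (p ^ level))
              (int-affine-≋ level 1 n)))) near) near ≉′ ≉
      from-bound : ∃[ N ] (∀ n → f (fromℕ n) ≈ 0ₚ → n < N) → Dec (∃[ n ] f (fromℕ n) ≈ 0ₚ) →
        ∃[ s ] ∃[ N ] (PeriodicFrom N (p ^ s) seq × ((∀ n → ¬ (f (fromℕ n) ≈ 0ₚ)) → N ≡ 0))
      from-bound _ (no none) = level , 0 , (1≤p^level , λ n _ → step n (λ h → none (n , h)) (λ h → none (_ , h))) , λ _ → refl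
      from-bound (N , bound) (yes (n₀ , root)) = level , N , (1≤p^level , λ n N≤n → step n
        (λ h → ℕP.<⇒≱ (bound n h) N≤n) (λ h → ℕP.<⇒≱ (bound _ h) (ℕP.≤-trans N≤n (ℕP.m≤m+n n _))))
        , λ none → ⊥-elim (none n₀ root)

    -- The exponent of p in f grows by δ m, a multiple of l, and the unit part stays the same. For z
    -- ≅ x both sides are ℓ(0).
    scaling : ∀ {x z z′} δ → f x ≈ 0ₚ → z ≋ x [ r x ] → z′ ≋ x [ r x ] → l ℕD.∣ δ →
      z′ ⊖ x ≅ ϖ δ ⊗ (z ⊖ x) → ℓ l d (f z) ≡ ℓ l d (f z′)
    scaling {x} {z} {z′} δ fx≈0 near near′ l∣δ scaled = by-cases em
      where
      open Local (loc x)
      by-cases : Dec (z ≅ x) → ℓ l d (f z) ≡ ℓ l d (f z′)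
      by-cases (yes z≅x) = trans (ℓ-zero em prime l d (f z) (zero-cong (loc x) (≅-sym z≅x) fx≈0))
        (sym (ℓ-zero em prime l d (f z′) (zero-cong (loc x) (≅-sym z′≅x) fx≈0)))
        where
        z′≅x : z′ ≅ x
        z′≅x = -≅0⇒≅ (≅-trans scaled (≅-trans (*-congˡ (ϖ δ) (≅⇒-≅0 z≅x)) (*-zeroʳ (ϖ δ))))
      by-cases (no z≇x) = from-valuation (valuation em prime (z≇x ∘ -≅0⇒≅))
        where
        from-valuation : ∃[ v ] ∃[ u ] (z ⊖ x ≅ ϖ v ⊗ u × Unit u) → ℓ l d (f z) ≡ ℓ l d (f z′)
        from-valuation (v , u , e , unit) = trans
          (near-digits (loc x) {z} {v} {u} near (power-of (loc x) {z} {v} {u} e) unit)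
          (trans (cong (λ k → digits {p} (l ℕ.* d) (ϖ k ⊗ (u ↑ m ⊗ γ))) (sym exponents))
            (sym (near-digits (loc x) {z′} {δ ℕ.+ v} {u} near′
              (power-of (loc x) {z′} {δ ℕ.+ v} {u} (≅-trans scaled (≅-trans (*-congˡ (ϖ δ) e) (≅-sym (ϖ-+-* δ v u))))) unit)))
          where
          exponents : ((δ ℕ.+ v) ℕ.* m ℕ.+ w) ℕ.% l ≡ (v ℕ.* m ℕ.+ w) ℕ.% l
          exponents = trans (cong (ℕ._% l) (trans (cong (ℕ._+ w) (ℕP.*-distribʳ-+ m δ v)) (ℕP.+-assoc (δ ℕ.* m) (v ℕ.* m) w)))
            (%-absorb l (v ℕ.* m ℕ.+ w) (ℕD.∣m⇒∣m*n m l∣δ))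

    -- Finiteness of the p-kernel

    private
      kernel : ℕ → ℕ → ℕ → ℕ
      kernel i j n = seq (p ^ i ℕ.* n ℕ.+ j)

    kernel-≋ : ∀ i j n → fromℕ (p ^ i ℕ.* n ℕ.+ j) ≅ int (+ j) ⊕ ϖ i ⊗ int {p} (+ n)
    kernel-≋ i j n = ≅-trans (fromℕ≅int em prime _) (≅-trans
      (≅-reflexive (cong (λ t → int (+ t)) (ℕP.+-comm (p ^ i ℕ.* n) j)))
      (≅-trans (≅-sym (int-affine i n j)) (+-comm _ _)))

    kernel-near : ∀ i j n {x} k → k ≤ i → int (+ j) ≋ x [ k ] → fromℕ (p ^ i ℕ.* n ℕ.+ j) ≋ x [ k ]
    kernel-near i j n k k≤i near = ≋-trans (≅⇒≋ (kernel-≋ i j n)) (≋-trans (≋-+0 (ϖ-≋0 _ k≤i)) near)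

    Level : ℕ → (ℕ → ℕ) → Set
    Level i b = ∃[ j ] (j < p ^ i × b ≗ kernel i j)

    finite-level : ∀ i → FiniteFamily (Level i)
    finite-level i = finite-⊆ em
      (λ { b (j , j< , h) → fromℕ< j< , λ n → trans (h n) (cong (λ j → kernel i j n) (sym (FinP.toℕ-fromℕ< j<))) })
      (finite-⋃ em {p ^ i} {λ c b → b ≗ kernel i (toℕ c)}
        λ c → finite-subsingleton em λ b b′ h h′ n → trans (h n) (sym (h′ n)))

    -- Exponents i below a radius, for which pⁱ n + j can leave the ball, are dealt with by
    -- counting.
    finite-below : ∀ T → FiniteFamily (λ b → ∃[ i ] (i < T × Level i b))
    finite-below T = finite-⊆ em
      (λ { b (i , i< , h) → fromℕ< i< , subst (λ i → Level i b) (sym (FinP.toℕ-fromℕ< i<)) h })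
      (finite-⋃ em {T} {λ c b → Level (toℕ c) b} λ c → finite-level (toℕ c))

    constant⇒periodic : ∀ {T B b} → (∀ n n′ → b n ≡ b n′) → (∀ n → b n < B) → Periodic em T B b
    constant⇒periodic same bounded = (λ n → same _ n) , bounded

    -- If the center x of a ball around j is not in j + pⁱ ℤₚ, the valuation of
    -- pⁱ n + j - x does not depend on n.
    off-center-periodic : ∀ i j x → r x ≤ i → int (+ j) ≋ x [ r x ] → ¬ (int (+ j) ≋ x [ i ]) →
      ∀ n → kernel i j (n ℕ.+ p ^ (l ℕ.* d)) ≡ kernel i j n
    off-center-periodic i j x r≤i near far n = from-valuation (valuation em prime (λ h → far (-≋0⇒≋ (≅⇒≋ h))))
      where
      open Local (loc x)
      from-valuation : ∃[ v ] ∃[ u ] (int (+ j) ⊖ x ≅ ϖ v ⊗ u × Unit u) → kernel i j (n ℕ.+ p ^ D) ≡ kernel i j n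
      from-valuation (v , u , e , unit) = trans (digits-at (n ℕ.+ p ^ D)) (trans
        (digits-cong (*-cong-≋ ≋-refl (*-cong-≋ (^-cong-≋ m (+-cong-≋ ≋-refl (*-cong-≋ ≋-refl
          (subst (λ t → int {p} (+ (n ℕ.+ t)) ≋ int (+ n) [ D ]) (ℕP.*-identityʳ (p ^ D))
              (int-affine-≋ D 1 n))))) ≋-refl)))
        (sym (digits-at n)))
        where
        v<i : v < i
        v<i = ℕP.≰⇒> λ i≤v → far (-≋0⇒≋ (≋-trans (≅⇒≋ e) (ϖ-≋0 u i≤v)))
        -- As v < i, the term pⁱ n changes the unit part by a multiple of p; modulo pᴰ this change
        -- depends on n modulo pᴰ only.
        u′ : ℕ → ℤₚ p
        u′ n = u ⊕ ϖ (i ℕ.∸ v) ⊗ int (+ n)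
        u′-unit : ∀ n → Unit (u′ n)
        u′-unit n = Unit-cong prime ℕP.≤-refl (≋-sym (≋-+0 (ϖ-≋0 _ (ℕP.m<n⇒0<n∸m v<i)))) unit
        offset≅ : ∀ n → fromℕ (p ^ i ℕ.* n ℕ.+ j) ⊖ x ≅ ϖ v ⊗ u′ n
        offset≅ n = begin
          fromℕ (p ^ i ℕ.* n ℕ.+ j) ⊖ x                    ≈⟨ -‿cong (kernel-≋ i j n) ≅-refl ⟩
          (int (+ j) ⊕ ϖ i ⊗ int (+ n)) ⊖ x                ≈⟨ regroup (int (+ j)) (ϖ i ⊗ int (+ n)) x ⟩
          (int (+ j) ⊖ x) ⊕ ϖ i ⊗ int (+ n)                ≈⟨ +-cong e (≅-trans (*-congʳ _ (≅-reflexive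
            (cong ϖ (sym (ℕP.m+[n∸m]≡n (ℕP.<⇒≤ v<i)))))) (ϖ-+-* v (i ℕ.∸ v) _)) ⟩
          ϖ v ⊗ u ⊕ ϖ v ⊗ (ϖ (i ℕ.∸ v) ⊗ int (+ n))        ≈⟨ *-distrib-+ _ _ _ ⟨
          ϖ v ⊗ u′ n                                       ∎
          where
          open SetoidReasoning (≅-setoid {p})
          opaque
            unfolding _⊕_
            regroup : ∀ (a b c : ℤₚ p) → (a ⊕ b) ⊖ c ≅ (a ⊖ c) ⊕ b
            regroup a b c = identity λ n → lemma (residue a n) (residue b n) (residue c n)
              where
              lemma : ∀ a b c → (a ℤ.+ b) ℤ.+ ℤ.-1ℤ ℤ.* c ≡ (a ℤ.+ ℤ.-1ℤ ℤ.* c) ℤ.+ b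
              lemma = solve-∀
        digits-at : ∀ n → kernel i j n ≡ digits {p} D (ϖ ((v ℕ.* m ℕ.+ w) ℕ.% l) ⊗ (u′ n ↑ m ⊗ γ))
        digits-at n = near-digits (loc x) {fromℕ (p ^ i ℕ.* n ℕ.+ j)} {v} {u′ n}
          (kernel-near i j n (r x) r≤i near)
          (power-of (loc x) {fromℕ (p ^ i ℕ.* n ℕ.+ j)} {v} {u′ n} (offset≅ n)) (u′-unit n)

    -- Around a rational root x with B x = A, the sequence n ↦ a(pⁱ n + j) is
    -- determined by i mod l and by the integer N with A - B j = N pⁱ, which is bounded.
    module _ {x : ℤₚ p} (root : f x ≈ 0ₚ) (A : ℤ) (B : ℕ) .{{_ : NonZero B}} (Bx≅A : int (+ B) ⊗ x ≅ int A) where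

      AtRoot : (ℕ → ℕ) → Set
      AtRoot b = ∃[ i ] ∃[ j ] (j < p ^ i × int (+ j) ≋ x [ i ] × b ≗ kernel i j)

      Class : ℕ → ℤ → (ℕ → ℕ) → Set
      Class ρ N b = ∃[ i ] ∃[ j ] (r x ≤ i × int (+ j) ≋ x [ i ] × i ℕ.% l ≡ ρ
        × A ℤ.- + B ℤ.* + j ≡ N ℤ.* + (p ^ i) × b ≗ kernel i j)

      private
        -- Up to the factor pⁱ, the distance to the root depends on n and N alone. Equal N therefore
        -- means proportional distances, to which `scaling` applies.
        offset-multiple : ∀ {i j N} n → A ℤ.- + B ℤ.* + j ≡ N ℤ.* + (p ^ i) →
          int (+ B) ⊗ (fromℕ (p ^ i ℕ.* n ℕ.+ j) ⊖ x) ≅ ϖ i ⊗ int (+ B ℤ.* + n ℤ.- N)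
        offset-multiple {i} {j} {N} n eq = begin
          int (+ B) ⊗ (z ⊖ x)                                     ≈⟨ *-distrib-- _ _ _ ⟩
          int (+ B) ⊗ z ⊖ int (+ B) ⊗ x                           ≈⟨ -‿cong (*-congˡ _ (kernel-≋ i j n)) Bx≅A ⟩
          int (+ B) ⊗ (int (+ j) ⊕ ϖ i ⊗ int (+ n)) ⊖ int A
            ≈⟨ -‿cong ≅-refl (≅-reflexive (cong int (A≡ A (+ B ℤ.* + j) (N ℤ.* + (p ^ i)) eq))) ⟩
          int (+ B) ⊗ (int (+ j) ⊕ ϖ i ⊗ int (+ n)) ⊖ int (N ℤ.* + (p ^ i) ℤ.+ + B ℤ.* + j)
            ≈⟨ collect (+ B) (+ j) (+ n) N ⟩
          ϖ i ⊗ int (+ B ℤ.* + n ℤ.- N)                           ∎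
          where
          open SetoidReasoning (≅-setoid {p})
          z : ℤₚ p
          z = fromℕ (p ^ i ℕ.* n ℕ.+ j)
          add-back : ∀ A c → A ≡ (A ℤ.- c) ℤ.+ c
          add-back = solve-∀
          A≡ : ∀ A c e → A ℤ.- c ≡ e → A ≡ e ℤ.+ c
          A≡ A c e eq = trans (add-back A c) (cong (ℤ._+ c) eq)
          opaque
            unfolding _⊕_
            collect : ∀ B j n N → int {p} B ⊗ (int j ⊕ ϖ i ⊗ int n) ⊖ int (N ℤ.* + (p ^ i) ℤ.+ B ℤ.* j)
                ≅ ϖ i ⊗ int (B ℤ.* n ℤ.- N)
            collect B j n N = identity λ _ → lemma B j n N (+ (p ^ i))
              where
              lemma : ∀ B j n N q → B ℤ.* (j ℤ.+ q ℤ.* n) ℤ.+ ℤ.-1ℤ ℤ.* (N ℤ.* q ℤ.+ B ℤ.* j) ≡ q ℤ.* (B ℤ.* n ℤ.- N)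
              lemma = solve-∀

        class-ordered : ∀ {N i j i′ j′} → i ≤ i′ → r x ≤ i → int (+ j) ≋ x [ i ] → int (+ j′) ≋ x [ i′ ] → i ℕ.% l ≡ i′ ℕ.% l →
          A ℤ.- + B ℤ.* + j ≡ N ℤ.* + (p ^ i) → A ℤ.- + B ℤ.* + j′ ≡ N ℤ.* + (p ^ i′) → kernel i j ≗ kernel i′ j′
        class-ordered {N} {i} {j} {i′} {j′} i≤i′ r≤i near near′ i≡i′ eq eq′ n =
          scaling (i′ ℕ.∸ i) root
            (kernel-near i j n (r x) r≤i (≋-down r≤i near))
            (kernel-near i′ j′ n (r x) (ℕP.≤-trans r≤i i≤i′) (≋-down (ℕP.≤-trans r≤i i≤i′) near′))
            (%-cancel l i (i′ ℕ.∸ i) (trans (cong (ℕ._% l) (ℕP.m∸n+n≡m i≤i′)) (sym i≡i′)))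
            (⊗-cancelˡ em prime (pos≇0 prime B) (begin
              int (+ B) ⊗ (z′ ⊖ x)                                 ≈⟨ offset-multiple {i′} {j′} {N} n eq′ ⟩
              ϖ i′ ⊗ int (+ B ℤ.* + n ℤ.- N)
                ≈⟨ *-congʳ _ (≅-reflexive (cong ϖ (sym (ℕP.m∸n+n≡m i≤i′)))) ⟩
              ϖ (i′ ℕ.∸ i ℕ.+ i) ⊗ int (+ B ℤ.* + n ℤ.- N)         ≈⟨ ϖ-+-* (i′ ℕ.∸ i) i _ ⟩
              ϖ (i′ ℕ.∸ i) ⊗ (ϖ i ⊗ int (+ B ℤ.* + n ℤ.- N))       ≈⟨ *-congˡ _ (offset-multiple {i} {j} {N} n eq) ⟨
              ϖ (i′ ℕ.∸ i) ⊗ (int (+ B) ⊗ (z ⊖ x))                 ≈⟨ *-swap _ _ _ ⟩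
              int (+ B) ⊗ (ϖ (i′ ℕ.∸ i) ⊗ (z ⊖ x))                 ∎))
          where
          open SetoidReasoning (≅-setoid {p})
          z z′ : ℤₚ p
          z = fromℕ (p ^ i ℕ.* n ℕ.+ j)
          z′ = fromℕ (p ^ i′ ℕ.* n ℕ.+ j′)

      class-subsingleton : ∀ ρ N b b′ → Class ρ N b → Class ρ N b′ → b ≗ b′
      class-subsingleton ρ N b b′ (i , j , r≤i , near , i≡ , eq , h) (i′ , j′ , r≤i′ , near′ , i′≡ , eq′ , h′) n =
        trans (h n) (trans ([ (λ i≤i′ → class-ordered {N} {i} {j} {i′} {j′} i≤i′ r≤i
            near near′ (trans i≡ (sym i′≡)) eq eq′ n)
                            , (λ i′≤i → sym (class-ordered {N} {i′} {j′} {i} {j} i′≤i r≤i′ near′ near (trans i′≡ (sym i≡)) eq′ eq n)) ]′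
                            (ℕP.≤-total i i′)) (sym (h′ n)))

      private
        W : ℕ
        W = ℤ.∣ A ∣ ℕ.+ B

        divisible : ∀ {i j} → int (+ j) ≋ x [ i ] → + (p ^ i) ∣ℤ A ℤ.- + B ℤ.* + j
        divisible near = ≋-int {p} (≋-trans (≅⇒≋ (≅-sym Bx≅A))
          (≋-trans (*-cong-≋ ≋-refl (≋-sym near)) (≅⇒≋ (≅-sym (int-⊗ _ _)))))

        -- As 0 ≤ j < pⁱ, the integer A - B j is at most (|A| + B) pⁱ in absolute value.
        quotient-bound : ∀ {i j} N → j < p ^ i → A ℤ.- + B ℤ.* + j ≡ N ℤ.* + (p ^ i) → ℤ.∣ N ∣ ≤ W
        quotient-bound {i} {j} N j< eq = ℕP.*-cancelʳ-≤ ℤ.∣ N ∣ W (p ^ i) {{p^≢0 i}} (begin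
          ℤ.∣ N ∣ ℕ.* p ^ i                            ≡⟨ ℤP.abs-* N (+ (p ^ i)) ⟨
          ℤ.∣ N ℤ.* + (p ^ i) ∣                        ≡⟨ cong ℤ.∣_∣ eq ⟨
          ℤ.∣ A ℤ.- + B ℤ.* + j ∣                      ≤⟨ ℤP.∣i-j∣≤∣i∣+∣j∣ A (+ B ℤ.* + j) ⟩
          ℤ.∣ A ∣ ℕ.+ ℤ.∣ + B ℤ.* + j ∣                ≡⟨ cong (ℤ.∣ A ∣ ℕ.+_) (ℤP.abs-* (+ B) (+ j)) ⟩
          ℤ.∣ A ∣ ℕ.+ B ℕ.* j
            ≤⟨ ℕP.+-mono-≤ (ℕP.m≤m*n ℤ.∣ A ∣ (p ^ i) {{p^≢0 i}}) (ℕP.*-monoʳ-≤ B (ℕP.<⇒≤ j<)) ⟩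
          ℤ.∣ A ∣ ℕ.* p ^ i ℕ.+ B ℕ.* p ^ i            ≡⟨ ℕP.*-distribʳ-+ (p ^ i) ℤ.∣ A ∣ B ⟨
          W ℕ.* p ^ i                                  ∎)
          where open ℕP.≤-Reasoning

      finite-at-root : FiniteFamily AtRoot
      finite-at-root = finite-⊆ em classify (finite-∪ em (finite-below (r x))
          (finite-⋃ em {l} λ ρ → finite-∪ em
            (finite-⋃ em {suc W} λ N → finite-subsingleton em (class-subsingleton (toℕ ρ) (+ toℕ N)))
            (finite-⋃ em {suc W} λ N → finite-subsingleton em (class-subsingleton (toℕ ρ) -[1+ toℕ N ]))))
        where
        Classes : (ℕ → ℕ) → Set
        Classes b = ∃[ ρ ] ((∃[ N ] Class (toℕ {l} ρ) (+ toℕ {suc W} N) b) ⊎ (∃[ N ] Class (toℕ ρ) -[1+ toℕ {suc W} N ] b))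
        by-quotient : ∀ {b i j} N → r x ≤ i → j < p ^ i → int (+ j) ≋ x [ i ] → b ≗ kernel i j →
          A ℤ.- + B ℤ.* + j ≡ N ℤ.* + (p ^ i) → Classes b
        by-quotient {b} {i} {j} (+ n) r≤i j< near h eq = fromℕ< (ℕDM.m%n<n i l) , inj₁ (fromℕ< n< ,
          i , j , r≤i , near , sym (FinP.toℕ-fromℕ< (ℕDM.m%n<n i l)) ,
          trans eq (cong (λ n → + n ℤ.* + (p ^ i)) (sym (FinP.toℕ-fromℕ< n<))) , h)
          where
          n< : n < suc W
          n< = s≤s (quotient-bound {i} {j} (+ n) j< eq)
        by-quotient {b} {i} {j} -[1+ n ] r≤i j< near h eq = fromℕ< (ℕDM.m%n<n i l) , inj₂ (fromℕ< n< ,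
          i , j , r≤i , near , sym (FinP.toℕ-fromℕ< (ℕDM.m%n<n i l)) ,
          trans eq (cong (λ n → -[1+ n ] ℤ.* + (p ^ i)) (sym (FinP.toℕ-fromℕ< n<))) , h)
          where
          n< : n < suc W
          n< = ℕP.≤-trans (quotient-bound {i} {j} -[1+ n ] j< eq) (ℕP.n≤1+n W)
        classify : ∀ b → AtRoot b → (∃[ i ] (i < r x × Level i b)) ⊎ Classes b
        classify b (i , j , j< , near , h) = Sum.map (λ i<r → i , i<r , j , j< , h)
          (λ r≤i → from-divides (divisible {i} {j} near) r≤i) (ℕP.<-≤-connex i (r x))
          where
          from-divides : + (p ^ i) ∣ℤ A ℤ.- + B ℤ.* + j → r x ≤ i → Classes b
          from-divides (divides N eq) r≤i = by-quotient {b} {i} {j} N r≤i j< near h eq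

    private
      RationalRoot : ℤₚ p → Set
      RationalRoot x = f x ≈ 0ₚ × Rational x

    -- A residue c modulo `p ^ level` names at most one root, so finitely many classes exhaust the
    -- rational roots.
    RootClass : Fin (p ^ level) → (ℕ → ℕ) → Set
    RootClass c b = ∃[ i ] ∃[ j ] ∃[ x ] (j < p ^ i × int (+ j) ≋ x [ i ]
        × b ≗ kernel i j × RationalRoot x × digits level x ≡ toℕ c)

    finite-root-class : ∀ c → FiniteFamily (RootClass c)
    finite-root-class c = by-cases em
      where
      by-cases : Dec (∃[ x ] (RationalRoot x × digits level x ≡ toℕ c)) → FiniteFamily (RootClass c)
      by-cases (no none) = finite-∅ em λ { b (_ , _ , x , _ , _ , _ , root , eq) → none (x , root , eq) }
      by-cases (yes (x , (root , rational) , eq)) = from-equation (Rational-elim em prime rational)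
        where
        from-equation : ∃[ q ] (int (ℚ.↧ q) ⊗ x ≅ int (ℚ.↥ q)) → FiniteFamily (RootClass c)
        from-equation (q , e) = finite-⊆ em (λ { b (i , j , x′ , j< , near , h , (root′ , _) , eq′) → i , j , j< ,
            ≋-trans near (≅⇒≋ (roots-separated root′ root (digits-injective (trans eq′ (sym eq))))) , h })
          (finite-at-root {x} root (ℚ.↥ q) (ℚ.↧ₙ q) e)

    automatic : (∀ x → f x ≈ 0ₚ → Bad x → Rational x) → Automatic[ p ] seq
    automatic rational = proj₁ finite , λ i j j< → proj₂ finite (kernel i j) (i , j , j< , λ _ → refl)
      where
      B : ℕ
      B = p ^ (l ℕ.* d)
      bounded : ∀ i j n → kernel i j n < B
      bounded i j n = ℓ< em prime l d (f (fromℕ (p ^ i ℕ.* n ℕ.+ j)))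
      Kernel Cases : (ℕ → ℕ) → Set
      Kernel b = ∃[ i ] ∃[ j ] (j < p ^ i × b ≗ kernel i j)
      -- Either i is small, or the sequence is periodic because j + pⁱ ℤₚ contains no root or an
      -- irrational one, or that ball contains a rational root.
      Cases b = (∃[ i ] (i < level × Level i b)) ⊎ (Periodic em B B b ⊎ ∃[ c ] RootClass c b)
      Periodic-≗ : ∀ {b b′} → b ≗ b′ → Periodic em B B b′ → Periodic em B B b
      Periodic-≗ h (periodic , bound) = (λ n → trans (h _) (trans (periodic n) (sym (h n))))
          , λ n → subst (_< B) (sym (h n)) (bound n)
      module _ (b : ℕ → ℕ) (i j : ℕ) (j< : j < p ^ i) (h : b ≗ kernel i j) (level≤i : level ≤ i) where
        centered : ∀ {x} → r x ≤ level → int (+ j) ≋ x [ r x ] → int (+ j) ≋ x [ i ] →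
          Periodic em B B b ⊎ ∃[ c ] RootClass c b
        centered {x} r≤level near close = by-root em
          where
          near-n : ∀ n → fromℕ (p ^ i ℕ.* n ℕ.+ j) ≋ x [ r x ]
          near-n n = kernel-near i j n (r x) (ℕP.≤-trans r≤level level≤i) near
          constant : (f x ≈ 0ₚ → ¬ Bad x) → (∀ n → ¬ (f (fromℕ (p ^ i ℕ.* n ℕ.+ j)) ≈ 0ₚ)) → Periodic em B B b
          constant good ≉ = Periodic-≗ h (constant⇒periodic (λ n n′ →
            constant-near {x} good (near-n n) (near-n n′) (≉ n) (≉ n′)) (bounded i j))
          by-rational : f x ≈ 0ₚ → Dec (Rational x) → Periodic em B B b ⊎ ∃[ c ] RootClass c b
          -- Rational roots outside 𝓡′ belong here too: some pⁱ n + j may equal x, where the digits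
          -- jump to ℓ(0).
          by-rational root (yes rat) = inj₂ (fromℕ< (digits< level x) , i , j , x
              , j< , close , h , (root , rat) , sym (FinP.toℕ-fromℕ< (digits< level x)))
          -- An irrational root is not singular by hypothesis, and no integer pⁱ n + j equals it.
          by-rational root (no irrational) = inj₁ (constant (λ root bad → irrational (rational x root bad)) λ n fz≈0 →
            irrational (rational-by-equation em prime (+ (p ^ i ℕ.* n ℕ.+ j)) 1 (≅-trans (*-identityˡ x)
              (≅-trans (≅-sym (isolated (loc x) (near-n n) fz≈0)) (fromℕ≅int em prime _)))))
          by-root : Dec (f x ≈ 0ₚ) → Periodic em B B b ⊎ ∃[ c ] RootClass c b
          by-root (yes root) = by-rational root em
          by-root (no fx≉0)  = inj₁ (constant (λ root → contradiction root fx≉0)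
            (λ n → near-nonroot (near-n n) fx≉0))
        from-center : ∃[ x ] (r x ≤ level × int (+ j) ≋ x [ r x ]) → Periodic em B B b ⊎ ∃[ c ] RootClass c b
        from-center (x , r≤level , near) = by-distance em
          where
          by-distance : Dec (int (+ j) ≋ x [ i ]) → Periodic em B B b ⊎ ∃[ c ] RootClass c b
          by-distance (yes close) = centered r≤level near close
          by-distance (no far)    = inj₁ (Periodic-≗ h
            (off-center-periodic i j x (ℕP.≤-trans r≤level level≤i) near far , bounded i j))
      classify : ∀ b → Kernel b → Cases b
      classify b (i , j , j< , h) = Sum.map (λ i<level → i , i<level , j , j< , h)
        (λ level≤i → from-center b i j j< h level≤i (center (int (+ j)))) (ℕP.<-≤-connex i level)
      finite : FiniteFamily Kernel
      finite = finite-⊆ em classify (finite-∪ em (finite-below level)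
        (finite-∪ em (finite-periodic em B B {{p^≢0 (l ℕ.* d)}}) (finite-⋃ em finite-root-class)))

theorem2p7 : (em : ExcludedMiddle 0ℓ)
    (p : ℕ) .{{_ : NonZero p}} → Prime p →
    (l d : ℕ) .{{_ : NonZero l}} .{{_ : NonZero d}} →
    (f : ℤₚ p → ℚₚ p) → Analytic f → ¬ (∀ x → f x ≈ 0ₚ) →
    let open Digits em
        a : ℕ → ℕ
        a n = ℓ l d (f (fromℕ n))
    in
    ((∀ θ → ¬ 𝓡′ l d f θ) →
       ∃[ s ] ∃[ N ] (PeriodicFrom N (p ^ s) a
                      × ((∀ n → ¬ (f (fromℕ n) ≈ 0ₚ)) → N ≡ 0)))
    × (∃ (𝓡′ l d f) → (∀ θ → 𝓡′ l d f θ → Rational θ) → StrictlyAutomatic[ p ] a)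
    × (¬ (∀ θ → 𝓡′ l d f θ → Rational θ) → ¬ Automatic a)
theorem2p7 em p p-prime l d f f-analytic nonzero =
    (λ empty → periodic em p-prime l d {f} f-analytic nonzero (λ x root bad → empty x (bad⇒𝓡′ x root bad)))
  , (λ { (θ , θ∈) rational →
       automatic em p-prime l d {f} f-analytic nonzero (λ x root bad → rational x (bad⇒𝓡′ x root bad))
       , λ m 2≤m independent → let L , bad = 𝓡′⇒bad θ θ∈ in
           independent⇒¬automatic em p-prime l d {f} f-analytic nonzero L bad m 2≤m (not-power m 2≤m independent) })
  , λ { irrational (k , 2≤k , auto) → irrational λ θ θ∈ → decidable-stable em λ θ∉ℚ → let L , bad = 𝓡′⇒bad θ θ∈ in
           irrational⇒¬automatic em p-prime l d {f} f-analytic nonzero L bad θ∉ℚ k 2≤k auto }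
  where
  open Digits em {p}
  Defect : ∀ θ → Local em p-prime l d f θ → Set
  Defect θ L = Singular em p-prime l d (Local.m L) (Local.w L ℕ.% l)
  𝓡′⇒bad : ∀ θ → 𝓡′ l d f θ → Σ[ L ∈ Local em p-prime l d f θ ] Defect θ L
  𝓡′⇒bad θ (_ , F , bad) =
    factorisation⇒singular em p-prime l d F bad (proj₂ (least em (KillsUnits _) _)) refl
  bad⇒𝓡′ : ∀ θ → f θ ≈ 0ₚ → Defect θ (local em p-prime l d {f} f-analytic nonzero θ) → 𝓡′ l d f θ
  bad⇒𝓡′ θ root bad = from-factorisation
      (singular⇒factorisation em p-prime l d (local em p-prime l d {f} f-analytic nonzero θ) bad)
    where
    from-factorisation : Σ[ F ∈ Factorisation f θ ] (¬ (l ℕD.∣ Factorisation.multiplicity F) ⊎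
      (∀ {c e} → IsLeast (KillsUnits (p ^ e)) c → e ≡ exponent em p-prime l d F →
        ¬ (c ℕD.∣ Factorisation.multiplicity F))) → 𝓡′ l d f θ
    from-factorisation (F , inj₁ l∤m) = root , F , inj₁ l∤m
    from-factorisation (F , inj₂ c∤m) = root , F , inj₂ (c∤m (proj₂ (least em (KillsUnits _) _)) refl)
  not-power : ∀ m → 2 ≤ m → MultiplicativelyIndependent p m → ∀ t → m ≢ p ^ t
  -- Multiplicative independence concerns positive exponents, so m = p⁰ is excluded by its size.
  not-power m 2≤m independent zero    m≡1 = ℕP.<⇒≢ 2≤m (sym m≡1)
  not-power m 2≤m independent (suc t) m≡  = independent (suc t) 1 (s≤s z≤n) ℕP.≤-refl (trans (sym m≡) (sym (ℕP.*-identityʳ m)))
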